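{- $\pi_{5.4}(\emptyset)=\pi_{5.6}(\emptyset)=\dfrac{20}{27}$.
   Context: A $3$-graph is a pair $G=(V,E)$ with $E$ a set of $3$-element subsets of $V$. For integers $m,k$, $m.k$ denotes the family of all $3$-graphs on $m$ vertices with exactly $k$ edges. For a $3$-graph $G$ on $n\ge m$ vertices, $e_{m.k}(G)$ is the number of $m$-element subsets of $V(G)$ spanning exactly $k$ edges of $G$, and $\pi_{m.k}(\emptyset)=\lim_{n\to\infty}\max\{e_{m.k}(G): |V(G)|=n\}/\binom{n}{m}$ (the limit exists). -}

module Defs where

open import Data.Nat using (ℕ; zero; suc; _+_; _*_; _≤_; _≟_)
open import Data.Nat.Combinatorics using (_C_)
open import Data.Bool using (Bool; true; false)
open import Data.Bool.Properties renaming (_≟_ to _≟ᵇ_)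
open import Data.List using (List; []; _∷_; _++_; map; filter; length)
open import Data.Vec using (Vec; []; _∷_)
open import Data.Fin.Subset using (Subset; Side; inside; outside; _⊆_; ∣_∣)
open import Data.Fin.Subset.Properties using (_⊆?_)
open import Data.Product using (Σ; _×_; _,_; ∃)
open import Relation.Nullary.Decidable using (_×-dec_)
open import Relation.Binary.PropositionalEquality using (_≡_)

allSubsets : (n : ℕ) → List (Subset n)
allSubsets zero    = [] ∷ []
allSubsets (suc n) = map (outside ∷_) (allSubsets n) ++ map (inside ∷_) (allSubsets n)

-- A 3-graph on vertex set Fin n: a 3-element subset T is an edge iff
-- G T ≡ true (the values of G on subsets of other sizes are ignored).
Graph3 : ℕ → Set
Graph3 n = Subset n → Bool

IsEdge : {n : ℕ} → Graph3 n → Subset n → Set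
IsEdge G T = (∣ T ∣ ≡ 3) × (G T ≡ true)

edgesIn : {n : ℕ} → Graph3 n → Subset n → ℕ
edgesIn {n} G S =
  length (filter (λ T → (T ⊆? S) ×-dec ((∣ T ∣ ≟ 3) ×-dec (G T ≟ᵇ true))) (allSubsets n))

e : (m k : ℕ) {n : ℕ} → Graph3 n → ℕ
e m k {n} G =
  length (filter (λ S → (∣ S ∣ ≟ m) ×-dec (edgesIn G S ≟ k)) (allSubsets n))

-- π_{m.k}(∅) = p/q, i.e. max{ e_{m.k}(G) : |V(G)| = n } / (n choose m) → p/q
-- as n → ∞.  Written with ε = 1/(suc j) and cross-multiplied:
--   for every j there is N such that for all n ≥ N,
--   every G on n vertices has e/(n C m) ≤ p/q + 1/(suc j), and
--   some G on n vertices has e/(n C m) ≥ p/q - 1/(suc j).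
TuranDensityIs : (m k p q : ℕ) → Set
TuranDensityIs m k p q =
  (j : ℕ) → ∃ λ (N : ℕ) → (n : ℕ) → N ≤ n →
    ((G : Graph3 n) → q * suc j * e m k G ≤ (p * suc j + q) * (n C m))
    × (Σ (Graph3 n) λ G → p * suc j * (n C m) ≤ q * suc j * e m k G + q * (n C m))

{-# OPTIONS --safe #-}

-- Lower bound: split the vertices into three nearly equal parts and take as edges the triples that lie
-- inside a part or meet all three parts; a 5-set spans 4 edges unless it lies in a part or is split 3 + 2.
-- Complementation exchanges 4 and 6 edges.
-- Upper bound: a flag algebra certificate on 6-vertex graphs.  Summing squares of linear statistics of flags
-- over all tuples of vertices gives nonnegative quantities, and a fixed positive definite combination of them
-- bounds, in every graph on six vertices, the number of 5-subsets with exactly 4 edges.  Tuples with repeated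
-- vertices are included, so the inequality 27 · 120 · e(G) ≤ 20 n⁵ has no error term.

module Submission where

-- The obstacle is the finite check: there are 2^20 labelled graphs on six vertices. The six-vertex
-- quantity is invariant under permutations, so five of the vertices may be relabelled until they
-- induce one of 34 graphs; triples of a 5-set are complements of pairs, so the isomorphism classes
-- are those of ordinary graphs on five vertices. The link of the sixth vertex stays arbitrary,
-- which leaves 34 · 1024 evaluations. Two versions of the kernels therefore run through the proof:
-- formulas, whose sums are visibly nonnegative, and tables, which can be evaluated quickly.
-- Everything in between is proved for arbitrary kernels with the right symmetries. Tightness at the
-- extremal construction forces every form to vanish in the limit on the averaged flag vectors found
-- there. The statistics are centred or antisymmetrised so that these averages are zero, which
-- leaves room for strictly positive definite matrices, and strict positivity can be verified by
-- elimination over the integers.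

open import Defs
open import Data.Product using (_×_)

-- Sums over tuples of vertices and over splittings of a tuple.

module Sums where

  open import Algebra.Bundles using (CommutativeSemiring)
  open import Data.Nat as ℕ using (ℕ; zero; suc; s≤s)
  import Data.Nat.Properties as ℕₚ
  open import Data.Fin using (Fin; zero; suc)
  open import Data.List using (List; []; _∷_; map; _++_; foldr; length)
  open import Data.Vec using (Vec; []; _∷_; toList)
  open import Data.List.Properties using (map-∘)
  open import Data.Product using (_×_; _,_; map₁; map₂; uncurry)
  open import Data.Sum as Sum using (_⊎_; inj₁; inj₂)
  open import Function using (_∘_)
  open import Relation.Binary.PropositionalEquality as ≡ using (_≡_; cong)

  -- Adjacent transpositions generate all permutations, so invariance of a function of lists is
  -- stated and proved for these alone.
  data Swap {A : Set} : List A → List A → Set where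
    here  : ∀ {x y xs} → Swap (x ∷ y ∷ xs) (y ∷ x ∷ xs)
    there : ∀ {x xs ys} → Swap xs ys → Swap (x ∷ xs) (x ∷ ys)

  swapAt : {A : Set} → ℕ → List A → List A
  swapAt zero    (x ∷ y ∷ xs) = y ∷ x ∷ xs
  swapAt (suc i) (x ∷ xs)     = x ∷ swapAt i xs
  swapAt _       xs           = xs

  swapAt-Swap : ∀ {A : Set} i (xs : List A) → swapAt i xs ≡ xs ⊎ Swap xs (swapAt i xs)
  swapAt-Swap zero    []           = inj₁ ≡.refl
  swapAt-Swap zero    (x ∷ [])     = inj₁ ≡.refl
  swapAt-Swap zero    (x ∷ y ∷ xs) = inj₂ here
  swapAt-Swap (suc i) []           = inj₁ ≡.refl
  swapAt-Swap (suc i) (x ∷ xs)     = Sum.map (cong (x ∷_)) there (swapAt-Swap i xs)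

  choices : ∀ {A : Set} → ℕ → List A → List (List A × List A)
  choices zero    xs       = ([] , xs) ∷ []
  choices (suc m) []       = []
  choices (suc m) (x ∷ xs) = map (map₁ (x ∷_)) (choices m xs) ++ map (map₂ (x ∷_)) (choices (suc m) xs)

  -- Pascal's rule in the form in which `splits` recurses: an entry goes to the chosen part or to
  -- the rest. Closed instances such as `binom 6 4` evaluate to numerals.
  binom : ℕ → ℕ → ℕ
  binom n       zero    = 1
  binom zero    (suc k) = 0
  binom (suc n) (suc k) = binom n k ℕ.+ binom n (suc k)

  n<k⇒binom≡0 : ∀ {n k} → n ℕ.< k → binom n k ≡ 0
  n<k⇒binom≡0 {zero}  {suc k} _         = ≡.refl
  n<k⇒binom≡0 {suc n} {suc k} (s≤s n<k) =
    ≡.cong₂ ℕ._+_ (n<k⇒binom≡0 n<k) (n<k⇒binom≡0 (ℕₚ.m<n⇒m<1+n n<k))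

  module TupleSums {c ℓ} (R : CommutativeSemiring c ℓ) where

    open CommutativeSemiring R hiding (zero)
    open import Algebra.Properties.Semiring.Sum semiring public
    open import Algebra.Properties.Semiring.Mult semiring using (×-homo-+; ×-congʳ) renaming (_×_ to _×ₙ_)
    open import Relation.Binary.Reasoning.Setoid setoid
    open import Algebra.Properties.CommutativeSemigroup +-commutativeSemigroup using (interchange; x∙yz≈y∙xz)

    ∑ᵗ : ∀ {n} (k : ℕ) → (List (Fin n) → Carrier) → Carrier
    ∑ᵗ     zero    f = f []
    ∑ᵗ {n} (suc k) f = ∑[ x < n ] ∑ᵗ k (f ∘ (x ∷_))

    ∑ᵗ-cong : ∀ {n} (k : ℕ) {f g : List (Fin n) → Carrier} → (∀ xs → f xs ≈ g xs) → ∑ᵗ k f ≈ ∑ᵗ k g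
    ∑ᵗ-cong     zero    f≈g = f≈g []
    ∑ᵗ-cong {n} (suc k) f≈g = sum-cong-≋ {n} (λ x → ∑ᵗ-cong k (f≈g ∘ (x ∷_)))

    ∑ᵗ-congᵛ : ∀ {n} (k : ℕ) {f g : List (Fin n) → Carrier} →
               (∀ (xs : Vec (Fin n) k) → f (toList xs) ≈ g (toList xs)) → ∑ᵗ k f ≈ ∑ᵗ k g
    ∑ᵗ-congᵛ     zero    f≈g = f≈g []
    ∑ᵗ-congᵛ {n} (suc k) f≈g = sum-cong-≋ {n} (λ x → ∑ᵗ-congᵛ k (f≈g ∘ (x ∷_)))

    ∑ᵗ-distrib-+ : ∀ {n} (k : ℕ) (f g : List (Fin n) → Carrier) →
                   ∑ᵗ k (λ xs → f xs + g xs) ≈ ∑ᵗ k f + ∑ᵗ k g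
    ∑ᵗ-distrib-+     zero    f g = refl
    ∑ᵗ-distrib-+ {n} (suc k) f g =
      trans (sum-cong-≋ {n} (λ x → ∑ᵗ-distrib-+ k (f ∘ (x ∷_)) (g ∘ (x ∷_)))) (∑-distrib-+ {n} _ _)

    ∑ᵗ-*ˡ : ∀ {n} (k : ℕ) c (f : List (Fin n) → Carrier) → ∑ᵗ k (λ xs → c * f xs) ≈ c * ∑ᵗ k f
    ∑ᵗ-*ˡ     zero    c f = refl
    ∑ᵗ-*ˡ {n} (suc k) c f =
      trans (sum-cong-≋ {n} (λ x → ∑ᵗ-*ˡ k c (f ∘ (x ∷_)))) (sym (*-distribˡ-sum {n} c _))

    ∑ᵗ-∑-comm : ∀ {n p} (k : ℕ) (f : List (Fin n) → Fin p → Carrier) →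
                ∑ᵗ k (λ xs → ∑[ y < p ] f xs y) ≈ ∑[ y < p ] ∑ᵗ k (λ xs → f xs y)
    ∑ᵗ-∑-comm         zero    f = refl
    ∑ᵗ-∑-comm {n} {p} (suc k) f =
      trans (sum-cong-≋ {n} (λ x → ∑ᵗ-∑-comm k (f ∘ (x ∷_)))) (∑-comm {n} {p} _)

    ∑ᵗ-comm : ∀ {n p} (k l : ℕ) (f : List (Fin n) → List (Fin p) → Carrier) →
              ∑ᵗ k (λ xs → ∑ᵗ l (f xs)) ≈ ∑ᵗ l (λ ys → ∑ᵗ k (λ xs → f xs ys))
    ∑ᵗ-comm     k zero    f = refl
    ∑ᵗ-comm {n} {p} k (suc l) f = trans (∑ᵗ-∑-comm k (λ xs y → ∑ᵗ l (f xs ∘ (y ∷_))))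
      (sum-cong-≋ {p} (λ y → ∑ᵗ-comm k l (λ xs → f xs ∘ (y ∷_))))

    -- The averaging step of a flag computation. Positions are chosen, not values, so repeated
    -- vertices count separately; both parts keep their order, so no symmetry of `F` is presupposed.
    splits : {A : Set} → ℕ → (List A → List A → Carrier) → List A → Carrier
    splits zero    F xs       = F [] xs
    splits (suc m) F []       = 0#
    splits (suc m) F (x ∷ xs) = splits m (F ∘ (x ∷_)) xs + splits (suc m) (λ ys → F ys ∘ (x ∷_)) xs

    splits-cong : ∀ {A : Set} (m : ℕ) {F G : List A → List A → Carrier} →
                  (∀ ys zs → F ys zs ≈ G ys zs) → ∀ xs → splits m F xs ≈ splits m G xs
    splits-cong zero    F≈G xs       = F≈G [] xs
    splits-cong (suc m) F≈G []       = refl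
    splits-cong (suc m) F≈G (x ∷ xs) =
      +-cong (splits-cong m (F≈G ∘ (x ∷_)) xs) (splits-cong (suc m) (λ ys → F≈G ys ∘ (x ∷_)) xs)

    splits-cong-length : ∀ {A : Set} (m : ℕ) {F G : List A → List A → Carrier} →
      (∀ ys zs → length ys ≡ m → F ys zs ≈ G ys zs) → ∀ xs → splits m F xs ≈ splits m G xs
    splits-cong-length zero    F≈G xs       = F≈G [] xs ≡.refl
    splits-cong-length (suc m) F≈G []       = refl
    splits-cong-length (suc m) F≈G (x ∷ xs) =
      +-cong (splits-cong-length m (λ ys zs eq → F≈G (x ∷ ys) zs (cong suc eq)) xs)
             (splits-cong-length (suc m) (λ ys zs → F≈G ys (x ∷ zs)) xs)

    splits-zero : ∀ {A : Set} (m : ℕ) (xs : List A) → splits m (λ _ _ → 0#) xs ≈ 0#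
    splits-zero zero    xs       = refl
    splits-zero (suc m) []       = refl
    splits-zero (suc m) (x ∷ xs) = trans (+-cong (splits-zero m xs) (splits-zero (suc m) xs)) (+-identityˡ 0#)

    splits-distrib-+ : ∀ {A : Set} (m : ℕ) (F G : List A → List A → Carrier) xs →
                       splits m (λ ys zs → F ys zs + G ys zs) xs ≈ splits m F xs + splits m G xs
    splits-distrib-+ zero    F G xs       = refl
    splits-distrib-+ (suc m) F G []       = sym (+-identityˡ 0#)
    splits-distrib-+ (suc m) F G (x ∷ xs) =
      trans (+-cong (splits-distrib-+ m _ _ xs) (splits-distrib-+ (suc m) _ _ xs)) (interchange _ _ _ _)

    ∑-splits : ∀ {A : Set} {n} (m : ℕ) (F : Fin n → List A → List A → Carrier) xs →
               ∑[ w < n ] splits m (F w) xs ≈ splits m (λ ys zs → ∑[ w < n ] F w ys zs) xs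
    ∑-splits {n = zero}  m F xs = sym (splits-zero m xs)
    ∑-splits {n = suc n} m F xs =
      trans (+-congˡ (∑-splits {n = n} m (F ∘ suc) xs)) (sym (splits-distrib-+ m (F zero) _ xs))

    ∑ᵗ-splits-inner : ∀ {A : Set} {n} (k m : ℕ) (F : List (Fin n) → List A → List A → Carrier) xs →
                      ∑ᵗ k (λ r → splits m (F r) xs) ≈ splits m (λ ys zs → ∑ᵗ k (λ r → F r ys zs)) xs
    ∑ᵗ-splits-inner         zero    m F xs = refl
    ∑ᵗ-splits-inner {n = n} (suc k) m F xs =
      trans (sum-cong-≋ {n} (λ w → ∑ᵗ-splits-inner k m (F ∘ (w ∷_)) xs)) (∑-splits {n = n} m _ xs)

    splits-map : ∀ {A B : Set} (f : A → B) (m : ℕ) (F : List B → List B → Carrier) xs →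
                 splits m F (map f xs) ≡ splits m (λ ys zs → F (map f ys) (map f zs)) xs
    splits-map f zero    F xs       = ≡.refl
    splits-map f (suc m) F []       = ≡.refl
    splits-map f (suc m) F (x ∷ xs) = ≡.cong₂ _+_ (splits-map f m _ xs) (splits-map f (suc m) _ xs)

    -- If both swapped entries land on the same side, the symmetry of `F` on that side applies; if
    -- they are separated, the two mixed terms change places. With only one position to choose, both
    -- entries cannot land on the left, hence the separate case.
    splits-swap : ∀ {A : Set} (m : ℕ) {F : List A → List A → Carrier} →
                  (∀ {ys ys′} zs → Swap ys ys′ → F ys zs ≈ F ys′ zs) →
                  (∀ ys {zs zs′} → Swap zs zs′ → F ys zs ≈ F ys zs′) →
                  ∀ {xs xs′} → Swap xs xs′ → splits m F xs ≈ splits m F xs′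
    splits-swap zero F-swapˡ F-swapʳ s = F-swapʳ [] s
    splits-swap (suc zero) {F} F-swapˡ F-swapʳ (here {x} {y} {xs}) = begin
      F (x ∷ []) (y ∷ xs) + (F (y ∷ []) (x ∷ xs) + splits 1 (λ ys zs → F ys (x ∷ y ∷ zs)) xs)
        ≈⟨ x∙yz≈y∙xz _ _ _ ⟩
      F (y ∷ []) (x ∷ xs) + (F (x ∷ []) (y ∷ xs) + splits 1 (λ ys zs → F ys (x ∷ y ∷ zs)) xs)
        ≈⟨ +-congˡ (+-congˡ (splits-cong 1 (λ ys zs → F-swapʳ ys here) xs)) ⟩
      _ ∎
    splits-swap (suc (suc m)) {F} F-swapˡ F-swapʳ (here {x} {y} {xs}) = begin
      (splits m (λ ys → F (x ∷ y ∷ ys)) xs + a) + (b + splits (suc (suc m)) (λ ys zs → F ys (x ∷ y ∷ zs)) xs)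
        ≈⟨ interchange _ a b _ ⟩
      (splits m (λ ys → F (x ∷ y ∷ ys)) xs + b) + (a + splits (suc (suc m)) (λ ys zs → F ys (x ∷ y ∷ zs)) xs)
        ≈⟨ +-cong (+-congʳ (splits-cong m (λ ys zs → F-swapˡ zs here) xs))
                  (+-congˡ (splits-cong (suc (suc m)) (λ ys zs → F-swapʳ ys here) xs)) ⟩
      _ ∎
      where
      a = splits (suc m) (λ ys zs → F (x ∷ ys) (y ∷ zs)) xs
      b = splits (suc m) (λ ys zs → F (y ∷ ys) (x ∷ zs)) xs
    splits-swap (suc m) F-swapˡ F-swapʳ (there {x} s) = +-cong
      (splits-swap m (λ zs → F-swapˡ zs ∘ there) (λ ys → F-swapʳ (x ∷ ys)) s)
      (splits-swap (suc m) (λ zs → F-swapˡ (x ∷ zs)) (λ ys → F-swapʳ ys ∘ there) s)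

    splits-choices : ∀ {A : Set} m (F : List A → List A → Carrier) xs →
                     splits m F xs ≈ foldr _+_ 0# (map (uncurry F) (choices m xs))
    splits-choices zero    F xs       = sym (+-identityʳ _)
    splits-choices (suc m) F []       = refl
    splits-choices (suc m) F (x ∷ xs) = begin
      splits m (F ∘ (x ∷_)) xs + splits (suc m) (λ ys → F ys ∘ (x ∷_)) xs
        ≈⟨ +-cong (splits-choices m _ xs) (splits-choices (suc m) _ xs) ⟩
      total (map (uncurry (F ∘ (x ∷_))) cs) + total (map (uncurry (λ ys → F ys ∘ (x ∷_))) ds)
        ≡⟨ ≡.cong₂ (λ us vs → total us + total vs) (map-∘ cs) (map-∘ ds) ⟩
      total (map (uncurry F) (map (map₁ (x ∷_)) cs)) + total (map (uncurry F) (map (map₂ (x ∷_)) ds))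
        ≈⟨ total-++ (map (map₁ (x ∷_)) cs) _ ⟨
      total (map (uncurry F) (map (map₁ (x ∷_)) cs ++ map (map₂ (x ∷_)) ds)) ∎
      where
      total = foldr _+_ 0#
      cs = choices m xs
      ds = choices (suc m) xs
      total-++ : ∀ us vs → total (map (uncurry F) (us ++ vs)) ≈ total (map (uncurry F) us) + total (map (uncurry F) vs)
      total-++ []       vs = sym (+-identityˡ _)
      total-++ (u ∷ us) vs = trans (+-congˡ (total-++ us vs)) (sym (+-assoc _ _ _))

    -- Summed over all `k`-tuples, every choice of `m` positions gives the same value, since the
    -- entries are bound variables that may be renamed; Pascal's rule counts the choices.
    ∑ᵗ-splits : ∀ {n} (k m : ℕ) (F : List (Fin n) → List (Fin n) → Carrier) →
                ∑ᵗ k (splits m F) ≈ binom k m ×ₙ ∑ᵗ m (λ ys → ∑ᵗ (k ℕ.∸ m) (F ys))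
    ∑ᵗ-splits     k       zero    F = sym (+-identityʳ _)
    ∑ᵗ-splits     zero    (suc m) F = refl
    ∑ᵗ-splits {n} (suc k) (suc m) F = begin
      ∑[ x < n ] ∑ᵗ k (λ xs → splits m (F ∘ (x ∷_)) xs + splits (suc m) (λ ys → F ys ∘ (x ∷_)) xs)
        ≈⟨ sum-cong-≋ {n} (λ x → ∑ᵗ-distrib-+ k _ _) ⟩
      ∑[ x < n ] (∑ᵗ k (splits m (F ∘ (x ∷_))) + ∑ᵗ k (splits (suc m) (λ ys → F ys ∘ (x ∷_))))
        ≈⟨ ∑-distrib-+ {n} _ _ ⟩
      ∑[ x < n ] ∑ᵗ k (splits m (F ∘ (x ∷_))) + ∑[ x < n ] ∑ᵗ k (splits (suc m) (λ ys → F ys ∘ (x ∷_)))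
        ≈⟨ +-cong (sum-cong-≋ {n} (λ x → ∑ᵗ-splits k m (F ∘ (x ∷_))))
                  (sum-cong-≋ {n} (λ x → ∑ᵗ-splits k (suc m) (λ ys → F ys ∘ (x ∷_)))) ⟩
      ∑[ x < n ] (binom k m ×ₙ ∑ᵗ m (λ ys → ∑ᵗ (k ℕ.∸ m) (F (x ∷ ys))))
        + ∑[ x < n ] (binom k (suc m) ×ₙ ∑ᵗ (suc m) (λ ys → ∑ᵗ (k ℕ.∸ suc m) (F ys ∘ (x ∷_))))
        ≈⟨ +-cong (∑-× (binom k m)) (trans (∑-× (binom k (suc m))) (rest (ℕₚ.≤-<-connex (suc m) k))) ⟩
      binom k m ×ₙ S + binom k (suc m) ×ₙ S
        ≈⟨ ×-homo-+ S (binom k m) (binom k (suc m)) ⟨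
      (binom k m ℕ.+ binom k (suc m)) ×ₙ S ∎
      where
      S = ∑ᵗ (suc m) (λ ys → ∑ᵗ (k ℕ.∸ m) (F ys))
      ∑-× : ∀ c {f : Fin n → Carrier} → ∑[ x < n ] (c ×ₙ f x) ≈ c ×ₙ (∑[ x < n ] f x)
      ∑-× zero    = sum-replicate-zero n
      ∑-× (suc c) = trans (∑-distrib-+ {n} _ _) (+-congˡ (∑-× c))
      rest : suc m ℕ.≤ k ⊎ k ℕ.< suc m →
             binom k (suc m) ×ₙ ∑[ x < n ] ∑ᵗ (suc m) (λ ys → ∑ᵗ (k ℕ.∸ suc m) (F ys ∘ (x ∷_)))
               ≈ binom k (suc m) ×ₙ S
      -- Truncated subtraction makes the two sums differ in this range, but the binomial factor is
      -- zero.
      rest (inj₂ k≤m) rewrite n<k⇒binom≡0 k≤m = refl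
      rest (inj₁ m<k) = ×-congʳ (binom k (suc m)) (begin
        ∑[ x < n ] ∑ᵗ (suc m) (λ ys → ∑ᵗ (k ℕ.∸ suc m) (F ys ∘ (x ∷_)))
          ≈⟨ ∑ᵗ-∑-comm (suc m) (λ ys x → ∑ᵗ (k ℕ.∸ suc m) (F ys ∘ (x ∷_))) ⟨
        ∑ᵗ (suc m) (λ ys → ∑ᵗ (suc (k ℕ.∸ suc m)) (F ys))
          ≡⟨ cong (λ j → ∑ᵗ (suc m) (λ ys → ∑ᵗ j (F ys))) (≡.sym (ℕₚ.+-∸-assoc 1 m<k)) ⟩
        S ∎)

-- Integer quadratic forms and a test of positive definiteness.

module Forms where

  open Sums
  open import Data.Nat as ℕ using (ℕ; zero; suc)
  open import Data.Integer using (ℤ; +_; -[1+_]; 0ℤ; 1ℤ; _+_; _*_; _-_; _≤_; +≤+; +<+; _≤ᵇ_; Positive)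
  import Data.Integer as ℤ
  open import Data.Integer.Properties
  open import Data.Integer.Tactic.RingSolver using (solve-∀)
  open import Data.Bool using (Bool; true; T; _∧_)
  open import Data.Bool.Properties using (T-∧)
  open import Data.List as List using (List; []; _∷_)
  open import Data.Vec as Vec using (Vec; []; _∷_; zipWith; replicate)
  open import Data.Fin using (Fin; zero; suc)
  open import Data.Product using (proj₁; proj₂)
  open import Function using (_∘_; Equivalence)
  open import Relation.Binary.PropositionalEquality
  open TupleSums +-*-commutativeSemiring

  infixr 5 _▹_
  -- The rows of the upper triangle, each starting on the diagonal: symmetry holds by construction,
  -- and dropping the first row leaves the block on which elimination continues.
  data Sym : ℕ → Set where
    []  : Sym 0
    _▹_ : ∀ {n} → Vec ℤ (suc n) → Sym n → Sym (suc n)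

  infixl 7 _·_
  _·_ : ∀ {n} → Vec ℤ n → Vec ℤ n → ℤ
  []       · []       = 0ℤ
  (x ∷ xs) · (y ∷ ys) = x * y + xs · ys

  form : ∀ {n} → Sym n → Vec ℤ n → Vec ℤ n → ℤ
  form []            []       []       = 0ℤ
  form ((a ∷ r) ▹ M) (x ∷ xs) (y ∷ ys) = a * (x * y) + (x * (r · ys) + r · xs * y) + form M xs ys

  -- The Schur complement of the pivot `a`, multiplied by `a` to keep all entries integral.
  schur : ∀ {n} → ℤ → Vec ℤ n → Sym n → Sym n
  schur a []       []      = []
  schur a (x ∷ xs) (r ▹ M) = zipWith (λ m y → a * m - x * y) r (x ∷ xs) ▹ schur a xs M

  -- Gaussian elimination without division: the scaled pivots have the signs of the true ones.
  positive : ∀ {n} → Sym n → Bool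
  positive []            = true
  positive ((a ∷ r) ▹ M) = (1ℤ ≤ᵇ a) ∧ positive (schur a r M)

  zipWith-· : ∀ {n} a b (r s xs : Vec ℤ n) →
              zipWith (λ m y → a * m - b * y) r s · xs ≡ a * (r · xs) - b * (s · xs)
  zipWith-· a b []       []       []       = base a b
    where
    base : ∀ a b → 0ℤ ≡ a * 0ℤ - b * 0ℤ
    base = solve-∀
  zipWith-· a b (m ∷ r) (y ∷ s) (x ∷ xs) = begin
    (a * m - b * y) * x + zipWith (λ m y → a * m - b * y) r s · xs
      ≡⟨ cong (λ u → (a * m - b * y) * x + u) (zipWith-· a b r s xs) ⟩
    (a * m - b * y) * x + (a * (r · xs) - b * (s · xs))
      ≡⟨ lemma a b m y x (r · xs) (s · xs) ⟩
    a * (m * x + r · xs) - b * (y * x + s · xs) ∎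
    where
    open ≡-Reasoning
    lemma : ∀ a b m y x p q → (a * m - b * y) * x + (a * p - b * q) ≡ a * (m * x + p) - b * (y * x + q)
    lemma = solve-∀

  form-schur : ∀ {n} a (r : Vec ℤ n) M xs →
               form (schur a r M) xs xs ≡ a * form M xs xs - r · xs * (r · xs)
  form-schur a []       []            []       = base a
    where
    base : ∀ a → 0ℤ ≡ a * 0ℤ - 0ℤ * 0ℤ
    base = solve-∀
  form-schur a (y ∷ r) ((m ∷ s) ▹ M) (x ∷ xs) = begin
    (a * m - y * y) * (x * x) + (x * (z · xs) + z · xs * x) + form (schur a r M) xs xs
      ≡⟨ cong₂ (λ u v → (a * m - y * y) * (x * x) + (x * u + u * x) + v) (zipWith-· a y s r xs) (form-schur a r M xs) ⟩
    (a * m - y * y) * (x * x) + (x * (a * (s · xs) - y * (r · xs)) + (a * (s · xs) - y * (r · xs)) * x)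
      + (a * form M xs xs - r · xs * (r · xs))
      ≡⟨ lemma a m y x (s · xs) (r · xs) (form M xs xs) ⟩
    a * (m * (x * x) + (x * (s · xs) + s · xs * x) + form M xs xs) - (y * x + r · xs) * (y * x + r · xs) ∎
    where
    open ≡-Reasoning
    z = zipWith (λ m y′ → a * m - y * y′) s r
    lemma : ∀ a m y x p q f →
      (a * m - y * y) * (x * x) + (x * (a * p - y * q) + (a * p - y * q) * x) + (a * f - q * q)
        ≡ a * (m * (x * x) + (x * p + p * x) + f) - (y * x + q) * (y * x + q)
    lemma = solve-∀

  0≤i*i : ∀ i → 0ℤ ≤ i * i
  0≤i*i (+ n)    rewrite sym (pos-* n n) = +≤+ ℕ.z≤n
  0≤i*i -[1+ n ] = +≤+ ℕ.z≤n

  -- Multiplying by the pivot a completes the square: a Q(x) = (a x₀ + r·x′)² + Q′(x′).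
  0≤form : ∀ {n} (M : Sym n) → T (positive M) → ∀ xs → 0ℤ ≤ form M xs xs
  0≤form []            _   []       = ≤-refl
  0≤form ((a ∷ r) ▹ M) pos (x ∷ xs) =
    *-cancelˡ-≤-pos 0ℤ _ a {{a-pos}} (begin
      a * 0ℤ
        ≡⟨ *-zeroʳ a ⟩
      0ℤ
        ≤⟨ +-mono-≤ (0≤i*i (a * x + r · xs)) (0≤form (schur a r M) (proj₂ pos′) xs) ⟩
      (a * x + r · xs) * (a * x + r · xs) + form (schur a r M) xs xs
        ≡⟨ cong (λ u → (a * x + r · xs) * (a * x + r · xs) + u) (form-schur a r M xs) ⟩
      (a * x + r · xs) * (a * x + r · xs) + (a * form M xs xs - r · xs * (r · xs))
        ≡⟨ lemma a x (r · xs) (form M xs xs) ⟩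
      a * (a * (x * x) + (x * (r · xs) + r · xs * x) + form M xs xs) ∎)
    where
    open ≤-Reasoning
    pos′ = Equivalence.to T-∧ pos
    a-pos : Positive a
    a-pos = ℤ.positive (<-≤-trans (+<+ (ℕ.s≤s ℕ.z≤n)) (≤ᵇ⇒≤ (proj₁ pos′)))
    lemma : ∀ a x p f → (a * x + p) * (a * x + p) + (a * f - p * p) ≡ a * (a * (x * x) + (x * p + p * x) + f)
    lemma = solve-∀

  _⊹_ : ∀ {n} → Vec ℤ n → Vec ℤ n → Vec ℤ n
  _⊹_ = zipWith _+_

  0ᵛ : ∀ {n} → Vec ℤ n
  0ᵛ = replicate _ 0ℤ

  ·-distribˡ : ∀ {n} (r xs ys : Vec ℤ n) → r · (xs ⊹ ys) ≡ r · xs + r · ys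
  ·-distribˡ []      []       []       = refl
  ·-distribˡ (a ∷ r) (x ∷ xs) (y ∷ ys) rewrite ·-distribˡ r xs ys = lemma a x y (r · xs) (r · ys)
    where
    lemma : ∀ a x y p q → a * (x + y) + (p + q) ≡ a * x + p + (a * y + q)
    lemma = solve-∀

  ·-zeroʳ : ∀ {n} (r : Vec ℤ n) → r · 0ᵛ ≡ 0ℤ
  ·-zeroʳ []      = refl
  ·-zeroʳ (a ∷ r) rewrite ·-zeroʳ r | *-zeroʳ a = refl

  form-sym : ∀ {n} (M : Sym n) xs ys → form M xs ys ≡ form M ys xs
  form-sym []            []       []       = refl
  form-sym ((a ∷ r) ▹ M) (x ∷ xs) (y ∷ ys) rewrite form-sym M xs ys =
    lemma a x y (r · xs) (r · ys) (form M ys xs)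
    where
    lemma : ∀ a x y p q f → a * (x * y) + (x * q + p * y) + f ≡ a * (y * x) + (y * p + q * x) + f
    lemma = solve-∀

  form-distribˡ : ∀ {n} (M : Sym n) xs ys zs → form M (xs ⊹ ys) zs ≡ form M xs zs + form M ys zs
  form-distribˡ []            []       []       []       = refl
  form-distribˡ ((a ∷ r) ▹ M) (x ∷ xs) (y ∷ ys) (z ∷ zs)
    rewrite form-distribˡ M xs ys zs | ·-distribˡ r xs ys =
    lemma a x y z (r · xs) (r · ys) (r · zs) (form M xs zs) (form M ys zs)
    where
    lemma : ∀ a x y z p q s f g →
      a * ((x + y) * z) + ((x + y) * s + (p + q) * z) + (f + g)
        ≡ a * (x * z) + (x * s + p * z) + f + (a * (y * z) + (y * s + q * z) + g)
    lemma = solve-∀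

  form-zeroˡ : ∀ {n} (M : Sym n) zs → form M 0ᵛ zs ≡ 0ℤ
  form-zeroˡ []            []       = refl
  form-zeroˡ ((a ∷ r) ▹ M) (z ∷ zs) rewrite form-zeroˡ M zs | ·-zeroʳ r = lemma a z (r · zs)
    where
    lemma : ∀ a z s → a * (0ℤ * z) + (0ℤ * s + 0ℤ * z) + 0ℤ ≡ 0ℤ
    lemma = solve-∀

  ∑ᵛ : ∀ {n d} → (Fin n → Vec ℤ d) → Vec ℤ d
  ∑ᵛ {zero}  φ = 0ᵛ
  ∑ᵛ {suc n} φ = φ zero ⊹ ∑ᵛ (φ ∘ suc)

  ∑ᵛᵗ : ∀ {n d} (k : ℕ) → (List (Fin n) → Vec ℤ d) → Vec ℤ d
  ∑ᵛᵗ zero    φ = φ []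
  ∑ᵛᵗ (suc k) φ = ∑ᵛ (λ x → ∑ᵛᵗ k (φ ∘ (x ∷_)))

  form-∑ᵛ : ∀ {n d} (M : Sym d) (φ : Fin n → Vec ℤ d) zs → form M (∑ᵛ φ) zs ≡ ∑[ x < n ] form M (φ x) zs
  form-∑ᵛ {zero}  M φ zs = form-zeroˡ M zs
  form-∑ᵛ {suc n} M φ zs =
    trans (form-distribˡ M (φ zero) _ zs) (cong (λ u → form M (φ zero) zs + u) (form-∑ᵛ M (φ ∘ suc) zs))

  form-∑ᵛᵗ : ∀ {n d} (k : ℕ) (M : Sym d) (φ : List (Fin n) → Vec ℤ d) zs →
             form M (∑ᵛᵗ k φ) zs ≡ ∑ᵗ k (λ xs → form M (φ xs) zs)
  form-∑ᵛᵗ     zero    M φ zs = refl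
  form-∑ᵛᵗ {n} (suc k) M φ zs =
    trans (form-∑ᵛ {n} M _ zs) (sum-cong-≗ {n} (λ x → form-∑ᵛᵗ k M (φ ∘ (x ∷_)) zs))

  -- By bilinearity the double sum is the form evaluated at the single vector `Φ`, the sum of all
  -- `φ xs`. The diagonal terms `xs = ys` belong to it, which is why the inequality is exact.
  0≤∑∑form : ∀ {n d} (k : ℕ) (M : Sym d) → T (positive M) → (φ : List (Fin n) → Vec ℤ d) →
             0ℤ ≤ ∑ᵗ k (λ xs → ∑ᵗ k (λ ys → form M (φ xs) (φ ys)))
  0≤∑∑form k M pos φ = subst (0ℤ ≤_) (begin
    form M Φ Φ                                              ≡⟨ form-∑ᵛᵗ k M φ Φ ⟩
    ∑ᵗ k (λ xs → form M (φ xs) Φ)                           ≡⟨ ∑ᵗ-cong k (λ xs → form-sym M (φ xs) Φ) ⟩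
    ∑ᵗ k (λ xs → form M Φ (φ xs))                           ≡⟨ ∑ᵗ-cong k (λ xs → form-∑ᵛᵗ k M φ (φ xs)) ⟩
    ∑ᵗ k (λ xs → ∑ᵗ k (λ ys → form M (φ ys) (φ xs)))        ≡⟨ ∑ᵗ-cong k (λ xs → ∑ᵗ-cong k (λ ys → form-sym M (φ ys) (φ xs))) ⟩
    ∑ᵗ k (λ xs → ∑ᵗ k (λ ys → form M (φ xs) (φ ys)))        ∎)
    (0≤form M pos Φ)
    where
    open ≡-Reasoning
    Φ = ∑ᵛᵗ k φ

-- The flag statistics and the kernels of the certificate.

module Flags where

  open Sums
  open Forms
  open import Data.Nat as ℕ using (ℕ; zero; suc)
  open import Data.Integer using (ℤ; +_; 0ℤ; 1ℤ; _+_; _*_; _-_; -_)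
  import Data.Integer as ℤ
  open import Data.Integer.Properties using (+-*-commutativeSemiring; neg-involutive)
  open import Data.Integer.Tactic.RingSolver using (solve-∀)
  import Data.Nat.Properties as ℕₚ
  open import Data.Bool using (Bool; true; false; T; _∧_)
  open import Data.List as List using ([]; _∷_)
  open import Data.Vec as Vec using (Vec; []; _∷_)
  import Data.Vec.Properties as Vecₚ
  open import Data.Fin using (zero; suc)
  open import Data.Fin.Patterns
  open import Data.Product using (_×_; _,_; proj₁; proj₂)
  open import Data.Unit using (tt)
  open import Function using (_∘_)
  open import Relation.Nullary.Decidable using (⌊_⌋; toWitness)
  open import Relation.Binary.PropositionalEquality
  open TupleSums +-*-commutativeSemiring using (splits; splits-cong; splits-swap; splits-map; splits-choices)
  module ℕΣ = TupleSums ℕₚ.+-*-commutativeSemiring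

  Bits : ℕ → Set
  Bits = Vec Bool

  allBits : ∀ n → (Bits n → Bool) → Bool
  allBits zero    p = p []
  allBits (suc n) p = allBits n (p ∘ (true ∷_)) ∧ allBits n (p ∘ (false ∷_))

  ∧-true : ∀ {a b} → a ∧ b ≡ true → a ≡ true × b ≡ true
  ∧-true {true} b≡true = refl , b≡true

  allBits-sound : ∀ {n} (p : Bits n → Bool) → allBits n p ≡ true → ∀ bs → p bs ≡ true
  allBits-sound p ok []           = ok
  allBits-sound p ok (true ∷ bs)  = allBits-sound (p ∘ (true ∷_)) (proj₁ (∧-true ok)) bs
  allBits-sound p ok (false ∷ bs) = allBits-sound (p ∘ (false ∷_)) (proj₂ (∧-true ok)) bs

  ≡true⇒T : ∀ {b} → b ≡ true → T b
  ≡true⇒T refl = tt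

  ⟦_⟧ : Bool → ℤ
  ⟦ true ⟧  = 1ℤ
  ⟦ false ⟧ = 0ℤ

  -- Flags over the 4-vertex type whose only edge is abc: a further vertex w gives the bits bcw, acw, abw, adw,
  -- bdw, cdw.  Here and below the statistics are chosen to have mean zero over w in the extremal construction.
  features₁ : Bits 6 → Vec ℤ 6
  features₁ (a ∷ b ∷ c ∷ a′ ∷ b′ ∷ c′ ∷ []) =
    U - 1ℤ ∷ V - 1ℤ ∷ UU - 1ℤ ∷ VV - 1ℤ ∷ D ∷ U * V - D ∷ []
    where
    u₁ = ⟦ a ⟧; u₂ = ⟦ b ⟧; u₃ = ⟦ c ⟧; v₁ = ⟦ a′ ⟧; v₂ = ⟦ b′ ⟧; v₃ = ⟦ c′ ⟧
    U  = u₁ + u₂ + u₃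
    V  = v₁ + v₂ + v₃
    UU = u₁ * u₂ + u₁ * u₃ + u₂ * u₃
    VV = v₁ * v₂ + v₁ * v₃ + v₂ * v₃
    D  = u₁ * v₁ + u₂ * v₂ + u₃ * v₃

  -- Statistics seen from a: the opposite bit bcw and the bit adw are singled out, and nothing
  -- changes when b and c are exchanged.
  attached : Bits 6 → Vec ℤ 7
  attached (a ∷ b ∷ c ∷ a′ ∷ b′ ∷ c′ ∷ []) =
    u₁ ∷ v₁ ∷ u₂ * u₃ ∷ v₂ * v₃ ∷ u₁ * v₁ ∷ u₁ * (v₂ + v₃) ∷ v₁ * (u₂ + u₃) ∷ []
    where
    u₁ = ⟦ a ⟧; u₂ = ⟦ b ⟧; u₃ = ⟦ c ⟧; v₁ = ⟦ a′ ⟧; v₂ = ⟦ b′ ⟧; v₃ = ⟦ c′ ⟧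

  rot : Bits 6 → Bits 6
  rot (a ∷ b ∷ c ∷ a′ ∷ b′ ∷ c′ ∷ []) = b ∷ c ∷ a ∷ b′ ∷ c′ ∷ a′ ∷ []

  -- Twice one statistic minus its two rotations, so that the three rotated versions add up to zero.
  -- In the extremal construction a, b, c lie in one part and d in another, so this component
  -- averages to zero by symmetry.
  features₁′ : Bits 6 → Vec ℤ 7
  features₁′ p = Vec.zipWith _-_ (Vec.map (+ 2 *_) (attached p)) (attached (rot p) ⊹ attached (rot (rot p)))

  -- Flags over the 4-vertex type with edges abc and abd; w gives the bits abw, cdw, acw, adw, bcw, bdw.
  features₂ : Bits 6 → Vec ℤ 9
  features₂ (ab ∷ cd ∷ ac ∷ ad ∷ bc ∷ bd ∷ []) =
    + 3 * x - 1ℤ ∷ + 3 * y - 1ℤ ∷ + 3 * s - + 4 ∷ + 3 * (x * y) - 1ℤ ∷ x * s ∷ y * s ∷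
    + 3 * (u * v + u′ * v′) - + 2 ∷ u * u′ + v * v′ ∷ u * v′ + v * u′ ∷ []
    where
    x = ⟦ ab ⟧; y = ⟦ cd ⟧; u = ⟦ ac ⟧; v = ⟦ ad ⟧; u′ = ⟦ bc ⟧; v′ = ⟦ bd ⟧
    s = u + v + (u′ + v′)

  -- In the extremal construction a and b lie in two different parts and c, d both in the third;
  -- being odd under exchange of a and b, these statistics then have mean zero over w.
  features₂′ : Bits 6 → Vec ℤ 4
  features₂′ (ab ∷ cd ∷ ac ∷ ad ∷ bc ∷ bd ∷ []) = t ∷ x * t ∷ y * t ∷ u * v - u′ * v′ ∷ []
    where
    x = ⟦ ab ⟧; y = ⟦ cd ⟧; u = ⟦ ac ⟧; v = ⟦ ad ⟧; u′ = ⟦ bc ⟧; v′ = ⟦ bd ⟧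
    t = u + v - (u′ + v′)

  -- Flags over the type of two vertices x, y: the bits are xyu, xyv, xuv, yuv.
  features₃ : Bits 4 → Vec ℤ 7
  features₃ (xu ∷ xv ∷ a ∷ b ∷ []) =
    + 3 * s - + 2 ∷ + 9 * p - 1ℤ ∷ + 3 * t - + 2 ∷ + 9 * (s * t) - + 4 ∷
    s * r - + 2 * (p * r) ∷ p * t - + 2 * (p * r) ∷ r - + 3 * (p * r) ∷ []
    where
    s = ⟦ xu ⟧ + ⟦ xv ⟧
    p = ⟦ xu ⟧ * ⟦ xv ⟧
    t = ⟦ a ⟧ + ⟦ b ⟧
    r = ⟦ a ⟧ * ⟦ b ⟧

  -- Solution of the semidefinite program, rounded so that equality holds for the subgraphs of the extremal
  -- construction; it is scaled by 288000, whence 7776000 = 27 · 288000 and 34560000 = 120 · 288000 below.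
  M₁ : Sym 6
  M₁ =
    (+ 191952 ∷ + 294768 ∷ - + 57456 ∷ + 197424 ∷ - + 7920 ∷ - + 119088 ∷ []) ▹
    (+ 1318032 ∷ + 143460 ∷ + 335232 ∷ - + 5040 ∷ - + 408384 ∷ []) ▹
    (+ 82656 ∷ - + 43776 ∷ + 7488 ∷ - + 23760 ∷ []) ▹
    (+ 252576 ∷ + 40608 ∷ - + 139248 ∷ []) ▹
    (+ 112608 ∷ - + 40464 ∷ []) ▹
    (+ 154224 ∷ []) ▹
    []

  M₁′ : Sym 7
  M₁′ =
    (+ 430848 ∷ - + 104256 ∷ + 87696 ∷ - + 42912 ∷ - + 22608 ∷ - + 17712 ∷ + 4032 ∷ []) ▹
    (+ 160416 ∷ - + 139680 ∷ + 4896 ∷ - + 31248 ∷ + 38592 ∷ - + 74736 ∷ []) ▹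
    (+ 174384 ∷ - + 4176 ∷ + 26064 ∷ - + 65376 ∷ + 101952 ∷ []) ▹
    (+ 20736 ∷ - + 22608 ∷ - + 4320 ∷ - + 22464 ∷ []) ▹
    (+ 121536 ∷ + 21600 ∷ + 100656 ∷ []) ▹
    (+ 42480 ∷ - + 24192 ∷ []) ▹
    (+ 141408 ∷ []) ▹
    []

  M₂ : Sym 9
  M₂ =
    (+ 368352 ∷ - + 193824 ∷ + 210528 ∷ + 151776 ∷ - + 538992 ∷ + 145872 ∷ - + 100656 ∷ - + 51984 ∷ - + 28080 ∷ []) ▹
    (+ 301104 ∷ - + 79056 ∷ - + 234720 ∷ + 313920 ∷ - + 260064 ∷ + 116064 ∷ - + 4896 ∷ + 28800 ∷ []) ▹
    (+ 135936 ∷ + 80208 ∷ - + 283248 ∷ + 41472 ∷ - + 59040 ∷ - + 89424 ∷ - + 12816 ∷ []) ▹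
    (+ 223092 ∷ - + 205056 ∷ + 187776 ∷ - + 118800 ∷ - + 100368 ∷ - + 47376 ∷ []) ▹
    (+ 884736 ∷ - + 283680 ∷ + 137232 ∷ - + 136224 ∷ + 98352 ∷ []) ▹
    (+ 264096 ∷ - + 92880 ∷ + 113616 ∷ - + 86832 ∷ []) ▹
    (+ 73728 ∷ + 56736 ∷ + 56880 ∷ []) ▹
    (+ 525168 ∷ - + 148176 ∷ []) ▹
    (+ 259344 ∷ []) ▹
    []

  M₂′ : Sym 4
  M₂′ =
    (+ 997983 ∷ - + 303696 ∷ + 858384 ∷ - + 699696 ∷ []) ▹
    (+ 1525824 ∷ - + 435888 ∷ - + 593424 ∷ []) ▹
    (+ 937152 ∷ - + 381744 ∷ []) ▹
    (+ 1079280 ∷ []) ▹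
    []

  M₃ : Sym 7
  M₃ =
    (+ 79056 ∷ - + 34992 ∷ + 67886 ∷ - + 25632 ∷ + 195408 ∷ + 7776 ∷ - + 179856 ∷ []) ▹
    (+ 16416 ∷ - + 30844 ∷ + 13290 ∷ - + 144720 ∷ - + 32400 ∷ + 108864 ∷ []) ▹
    (+ 59904 ∷ - + 24336 ∷ + 231840 ∷ + 38304 ∷ - + 187632 ∷ []) ▹
    (+ 13680 ∷ - + 216720 ∷ - + 81216 ∷ + 136656 ∷ []) ▹
    (+ 4921488 ∷ + 2271024 ∷ - + 2694960 ∷ []) ▹
    (+ 1181952 ∷ - + 1170720 ∷ []) ▹
    (+ 1556496 ∷ []) ▹
    []

  -- A single copy of the form `M₁′` distinguishes the vertex a. Using the same matrix for all three
  -- rotations makes the sum invariant under every permutation of a, b, c.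
  τ₁ τ₂ : Bits 6 → Bits 6 → ℤ
  τ₁ p q = form M₁ (features₁ p) (features₁ q)
         + (form M₁′ (features₁′ p) (features₁′ q)
         + (form M₁′ (features₁′ (rot p)) (features₁′ (rot q))
         + form M₁′ (features₁′ (rot (rot p))) (features₁′ (rot (rot q)))))
  τ₂ p q = form M₂ (features₂ p) (features₂ q) + form M₂′ (features₂′ p) (features₂′ q)

  τ₃ : Bits 4 → Bits 4 → ℤ
  τ₃ p q = form M₃ (features₃ p) (features₃ q)

  swap₁₂ swap₂₃ : Bits 6 → Bits 6
  swap₁₂ (a ∷ b ∷ c ∷ a′ ∷ b′ ∷ c′ ∷ []) = b ∷ a ∷ c ∷ b′ ∷ a′ ∷ c′ ∷ []
  swap₂₃ (a ∷ b ∷ c ∷ a′ ∷ b′ ∷ c′ ∷ []) = a ∷ c ∷ b ∷ a′ ∷ c′ ∷ b′ ∷ []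

  swap-ab swap-cd : Bits 6 → Bits 6
  swap-ab (ab ∷ cd ∷ ac ∷ ad ∷ bc ∷ bd ∷ []) = ab ∷ cd ∷ bc ∷ bd ∷ ac ∷ ad ∷ []
  swap-cd (ab ∷ cd ∷ ac ∷ ad ∷ bc ∷ bd ∷ []) = ab ∷ cd ∷ ad ∷ ac ∷ bd ∷ bc ∷ []

  swap-xy swap-uv : Bits 4 → Bits 4
  swap-xy (xyu ∷ xyv ∷ xuv ∷ yuv ∷ []) = xyu ∷ xyv ∷ yuv ∷ xuv ∷ []
  swap-uv (xyu ∷ xyv ∷ xuv ∷ yuv ∷ []) = xyv ∷ xyu ∷ xuv ∷ yuv ∷ []

  module _ {k d : ℕ} (f h : Bits k → Vec ℤ d) where

    -- Symmetries of the statistics are decided on all bit patterns, 64 of them for six bits,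
    -- instead of being derived algebraically.
    agree : Bool
    agree = allBits k (λ p → ⌊ Vecₚ.≡-dec ℤ._≟_ (f p) (h p) ⌋)

    agree-sound : agree ≡ true → ∀ p → f p ≡ h p
    agree-sound ok p = toWitness (≡true⇒T (allBits-sound (λ p → ⌊ Vecₚ.≡-dec ℤ._≟_ (f p) (h p) ⌋) ok p))

  ·-negʳ : ∀ {n} (r xs : Vec ℤ n) → r · Vec.map -_ xs ≡ - (r · xs)
  ·-negʳ []      []       = refl
  ·-negʳ (a ∷ r) (x ∷ xs) rewrite ·-negʳ r xs = base a x (r · xs)
    where
    base : ∀ a x p → a * (- x) + - p ≡ - (a * x + p)
    base = solve-∀

  form-negˡ : ∀ {n} (M : Sym n) xs ys → form M (Vec.map -_ xs) ys ≡ - form M xs ys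
  form-negˡ []            []       []       = refl
  form-negˡ ((a ∷ r) ▹ M) (x ∷ xs) (y ∷ ys) rewrite form-negˡ M xs ys | ·-negʳ r xs =
    lemma a x y (r · xs) (r · ys) (form M xs ys)
    where
    lemma : ∀ a x y p q f → a * (- x * y) + (- x * q + - p * y) + - f ≡ - (a * (x * y) + (x * q + p * y) + f)
    lemma = solve-∀

  τ₁-comm : ∀ p q → τ₁ p q ≡ τ₁ q p
  τ₁-comm p q = cong₂ _+_ (form-sym M₁ (features₁ p) (features₁ q))
    (cong₂ _+_ (form-sym M₁′ (features₁′ p) (features₁′ q))
    (cong₂ _+_ (form-sym M₁′ (features₁′ (rot p)) (features₁′ (rot q)))
               (form-sym M₁′ (features₁′ (rot (rot p))) (features₁′ (rot (rot q))))))

  τ₂-comm : ∀ p q → τ₂ p q ≡ τ₂ q p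
  τ₂-comm p q = cong₂ _+_ (form-sym M₂ (features₂ p) (features₂ q)) (form-sym M₂′ (features₂′ p) (features₂′ q))

  τ₃-comm : ∀ p q → τ₃ p q ≡ τ₃ q p
  τ₃-comm p q = form-sym M₃ (features₃ p) (features₃ q)

  -- Exchanging a and b interchanges the first two rotated copies and fixes the third.
  τ₁-swap₁₂ : ∀ p q → τ₁ (swap₁₂ p) (swap₁₂ q) ≡ τ₁ p q
  τ₁-swap₁₂ p q = trans
    (cong₂ _+_ (cong₂ (form M₁) (s p) (s q)) (cong₂ _+_ (cong₂ (form M₁′) (s₀ p) (s₀ q))
      (cong₂ _+_ (cong₂ (form M₁′) (s₁ p) (s₁ q)) (cong₂ (form M₁′) (s₂ p) (s₂ q)))))
    (lemma (form M₁ (features₁ p) (features₁ q)) (form M₁′ (features₁′ p) (features₁′ q))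
      (form M₁′ (features₁′ (rot p)) (features₁′ (rot q))) (form M₁′ (features₁′ (rot (rot p))) (features₁′ (rot (rot q)))))
    where
    s  = agree-sound (features₁ ∘ swap₁₂) features₁ refl
    s₀ = agree-sound (features₁′ ∘ swap₁₂) (features₁′ ∘ rot) refl
    s₁ = agree-sound (features₁′ ∘ rot ∘ swap₁₂) features₁′ refl
    s₂ = agree-sound (features₁′ ∘ rot ∘ rot ∘ swap₁₂) (features₁′ ∘ rot ∘ rot) refl
    lemma : ∀ a b c d → a + (c + (b + d)) ≡ a + (b + (c + d))
    lemma = solve-∀

  -- Exchanging b and c fixes the first copy and interchanges the other two.
  τ₁-swap₂₃ : ∀ p q → τ₁ (swap₂₃ p) (swap₂₃ q) ≡ τ₁ p q
  τ₁-swap₂₃ p q = trans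
    (cong₂ _+_ (cong₂ (form M₁) (s p) (s q)) (cong₂ _+_ (cong₂ (form M₁′) (s₀ p) (s₀ q))
      (cong₂ _+_ (cong₂ (form M₁′) (s₁ p) (s₁ q)) (cong₂ (form M₁′) (s₂ p) (s₂ q)))))
    (lemma (form M₁ (features₁ p) (features₁ q)) (form M₁′ (features₁′ p) (features₁′ q))
      (form M₁′ (features₁′ (rot p)) (features₁′ (rot q))) (form M₁′ (features₁′ (rot (rot p))) (features₁′ (rot (rot q)))))
    where
    s  = agree-sound (features₁ ∘ swap₂₃) features₁ refl
    s₀ = agree-sound (features₁′ ∘ swap₂₃) features₁′ refl
    s₁ = agree-sound (features₁′ ∘ rot ∘ swap₂₃) (features₁′ ∘ rot ∘ rot) refl
    s₂ = agree-sound (features₁′ ∘ rot ∘ rot ∘ swap₂₃) (features₁′ ∘ rot) refl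
    lemma : ∀ a b c d → a + (b + (d + c)) ≡ a + (b + (c + d))
    lemma = solve-∀

  τ₂-swap-cd : ∀ p q → τ₂ (swap-cd p) (swap-cd q) ≡ τ₂ p q
  τ₂-swap-cd p q = cong₂ _+_ (cong₂ (form M₂) (s p) (s q)) (cong₂ (form M₂′) (s′ p) (s′ q))
    where
    s  = agree-sound (features₂ ∘ swap-cd) features₂ refl
    s′ = agree-sound (features₂′ ∘ swap-cd) features₂′ refl

  -- features₂′ is antisymmetric in a and b, so the signs cancel in the product.
  τ₂-swap-ab : ∀ p q → τ₂ (swap-ab p) (swap-ab q) ≡ τ₂ p q
  τ₂-swap-ab p q = cong₂ _+_ (cong₂ (form M₂) (s p) (s q)) (begin
    form M₂′ (features₂′ (swap-ab p)) (features₂′ (swap-ab q))      ≡⟨ cong₂ (form M₂′) (s′ p) (s′ q) ⟩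
    form M₂′ (Vec.map -_ (features₂′ p)) (Vec.map -_ (features₂′ q)) ≡⟨ form-negˡ M₂′ (features₂′ p) _ ⟩
    - form M₂′ (features₂′ p) (Vec.map -_ (features₂′ q))           ≡⟨ cong -_ (form-sym M₂′ (features₂′ p) _) ⟩
    - form M₂′ (Vec.map -_ (features₂′ q)) (features₂′ p)           ≡⟨ cong -_ (form-negˡ M₂′ (features₂′ q) _) ⟩
    - - form M₂′ (features₂′ q) (features₂′ p)                      ≡⟨ neg-involutive (form M₂′ (features₂′ q) (features₂′ p)) ⟩
    form M₂′ (features₂′ q) (features₂′ p)                          ≡⟨ form-sym M₂′ (features₂′ q) _ ⟩
    form M₂′ (features₂′ p) (features₂′ q)                          ∎)
    where
    open ≡-Reasoning
    s  = agree-sound (features₂ ∘ swap-ab) features₂ refl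
    s′ = agree-sound (features₂′ ∘ swap-ab) (Vec.map -_ ∘ features₂′) refl

  τ₃-swap-xy : ∀ p q → τ₃ (swap-xy p) (swap-xy q) ≡ τ₃ p q
  τ₃-swap-xy p q = cong₂ (form M₃) (s p) (s q)
    where s = agree-sound (features₃ ∘ swap-xy) features₃ refl

  τ₃-swap-uv : ∀ p q → τ₃ (swap-uv p) q ≡ τ₃ p q
  τ₃-swap-uv p q = cong (λ x → form M₃ x (features₃ q)) (agree-sound (features₃ ∘ swap-uv) features₃ refl p)

-- The six-vertex quantity and its symmetry.

module Total where

  open Sums
  open Forms
  open Flags
  open import Data.Nat as ℕ using (ℕ; _≡ᵇ_)
  open import Data.Integer using (ℤ; +_; 0ℤ; 1ℤ; _+_; _*_)
  open import Data.Integer.Properties using (+-*-commutativeSemiring)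
  open import Data.Bool using (Bool; true; false; _∧_; not; if_then_else_)
  open import Data.Bool.Properties using (∧-comm)
  open import Data.List as List using (List; []; _∷_)
  open import Data.Vec as Vec using ([]; _∷_)
  open import Relation.Binary.PropositionalEquality
  open TupleSums +-*-commutativeSemiring using (splits; splits-cong; splits-swap; splits-map; splits-choices)

  module _ {V A : Set} (default : A) where

    -- Tuples are lists, so a list of the wrong length must get some value. On six-tuples `splits`
    -- produces the expected lengths and the default is never met.
    on₁ : List V → (V → A) → A
    on₁ (a ∷ []) f = f a
    on₁ _        f = default

    on₂ : List V → (V → V → A) → A
    on₂ (a ∷ b ∷ []) f = f a b
    on₂ _            f = default

    on₃ : List V → (V → V → V → A) → A
    on₃ (a ∷ b ∷ c ∷ []) f = f a b c
    on₃ _                f = default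

    on₁-cong : ∀ xs {f g} → (∀ a → f a ≡ g a) → on₁ xs f ≡ on₁ xs g
    on₁-cong []          f≗g = refl
    on₁-cong (a ∷ [])    f≗g = f≗g a
    on₁-cong (_ ∷ _ ∷ _) f≗g = refl

    on₂-cong : ∀ xs {f g} → (∀ a b → f a b ≡ g a b) → on₂ xs f ≡ on₂ xs g
    on₂-cong []              f≗g = refl
    on₂-cong (_ ∷ [])        f≗g = refl
    on₂-cong (a ∷ b ∷ [])    f≗g = f≗g a b
    on₂-cong (_ ∷ _ ∷ _ ∷ _) f≗g = refl

    on₃-cong : ∀ xs {f g} → (∀ a b c → f a b c ≡ g a b c) → on₃ xs f ≡ on₃ xs g
    on₃-cong []                  f≗g = refl
    on₃-cong (_ ∷ [])            f≗g = refl
    on₃-cong (_ ∷ _ ∷ [])        f≗g = refl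
    on₃-cong (a ∷ b ∷ c ∷ [])    f≗g = f≗g a b c
    on₃-cong (_ ∷ _ ∷ _ ∷ _ ∷ _) f≗g = refl

    on₁-swap : ∀ {xs ys} f → Swap xs ys → on₁ xs f ≡ on₁ ys f
    on₁-swap f here              = refl
    on₁-swap f (there here)      = refl
    on₁-swap f (there (there _)) = refl

    on₂-swap : ∀ {xs ys f} → (∀ a b → f a b ≡ f b a) → Swap xs ys → on₂ xs f ≡ on₂ ys f
    on₂-swap f-comm (here {xs = []})          = f-comm _ _
    on₂-swap f-comm (here {xs = _ ∷ _})       = refl
    on₂-swap f-comm (there here)              = refl
    on₂-swap f-comm (there (there here))      = refl
    on₂-swap f-comm (there (there (there _))) = refl

    on₃-swap : ∀ {xs ys f} → (∀ a b c → f a b c ≡ f b a c) → (∀ a b c → f a b c ≡ f a c b) →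
               Swap xs ys → on₃ xs f ≡ on₃ ys f
    on₃-swap s₁ s₂ (here {xs = []})                   = refl
    on₃-swap s₁ s₂ (here {xs = _ ∷ []})               = s₁ _ _ _
    on₃-swap s₁ s₂ (here {xs = _ ∷ _ ∷ _})            = refl
    on₃-swap s₁ s₂ (there (here {xs = []}))           = s₂ _ _ _
    on₃-swap s₁ s₂ (there (here {xs = _ ∷ _}))        = refl
    on₃-swap s₁ s₂ (there (there here))               = refl
    on₃-swap s₁ s₂ (there (there (there here)))       = refl
    on₃-swap s₁ s₂ (there (there (there (there _))))  = refl

  -- The four bits say which of abc, abd, acd, bcd are edges, so the guard tests that a, b, c, d
  -- induce the type. It does not involve the further vertices, hence the sum over these is a full
  -- double sum or zero.
  guarded₁ guarded₂ : (Bits 6 → Bits 6 → ℤ) → (e₁ e₂ e₃ e₄ : Bool) → Bits 6 → Bits 6 → ℤ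
  guarded₁ t e₁ e₂ e₃ e₄ p q = if e₁ ∧ not e₂ ∧ not e₃ ∧ not e₄ then t p q else 0ℤ
  guarded₂ t e₁ e₂ e₃ e₄ p q = if e₁ ∧ e₂ ∧ not e₃ ∧ not e₄ then t p q else 0ℤ

  module _ {V : Set} (g : V → V → V → Bool) where

    bits₁ bits₂ : (a b c d w : V) → Bits 6
    bits₁ a b c d w = g b c w ∷ g a c w ∷ g a b w ∷ g a d w ∷ g b d w ∷ g c d w ∷ []
    bits₂ a b c d w = g a b w ∷ g c d w ∷ g a c w ∷ g a d w ∷ g b c w ∷ g b d w ∷ []

    bits₃ : (x y u v : V) → Bits 4
    bits₃ x y u v = g x y u ∷ g x y v ∷ g u v x ∷ g u v y ∷ []

    core₁ core₂ : (Bits 6 → Bits 6 → ℤ) → (w v a b c d : V) → ℤ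
    core₁ t w v a b c d = guarded₁ t (g a b c) (g a b d) (g a c d) (g b c d) (bits₁ a b c d w) (bits₁ a b c d v)
    core₂ t w v a b c d = guarded₂ t (g a b c) (g a b d) (g a c d) (g b c d) (bits₂ a b c d w) (bits₂ a b c d v)

    -- Here the roles are reversed: `w`, `v` carry the type, while the pairs `a`, `b` and `c`, `d`
    -- are the two flags over it. All three cores thus use six vertices split as four and two.
    core₃ : (Bits 4 → Bits 4 → ℤ) → (w v a b c d : V) → ℤ
    core₃ t w v a b c d = t (bits₃ w v a b) (bits₃ w v c d)

    edge₃ : List V → ℕ
    edge₃ xs = on₃ 0 xs (λ a b c → if g a b c then 1 else 0)

    edges : List V → ℕ
    edges = ℕΣ.splits 3 (λ ys _ → edge₃ ys)

    spans4 : List V → ℤ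
    spans4 xs = if edges xs ≡ᵇ 4 then 1ℤ else 0ℤ

  -- Symmetry and evaluation are proved for arbitrary kernels and then applied to the formulas `τ`
  -- and to their tables; as variables, the kernels also do not unfold into large integer
  -- expressions.
  record Kernels : Set where
    field
      t₁ t₂ : Bits 6 → Bits 6 → ℤ
      t₃    : Bits 4 → Bits 4 → ℤ
  open Kernels

  τ : Kernels
  τ = record { t₁ = τ₁ ; t₂ = τ₂ ; t₃ = τ₃ }

  record Invariant (t : Kernels) : Set where
    field
      t₁-comm    : ∀ p q → t₁ t p q ≡ t₁ t q p
      t₂-comm    : ∀ p q → t₂ t p q ≡ t₂ t q p
      t₃-comm    : ∀ p q → t₃ t p q ≡ t₃ t q p
      t₁-swap₁₂  : ∀ p q → t₁ t (swap₁₂ p) (swap₁₂ q) ≡ t₁ t p q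
      t₁-swap₂₃  : ∀ p q → t₁ t (swap₂₃ p) (swap₂₃ q) ≡ t₁ t p q
      t₂-swap-ab : ∀ p q → t₂ t (swap-ab p) (swap-ab q) ≡ t₂ t p q
      t₂-swap-cd : ∀ p q → t₂ t (swap-cd p) (swap-cd q) ≡ t₂ t p q
      t₃-swap-xy : ∀ p q → t₃ t (swap-xy p) (swap-xy q) ≡ t₃ t p q
      t₃-swap-uv : ∀ p q → t₃ t (swap-uv p) q ≡ t₃ t p q

  τ-invariant : Invariant τ
  τ-invariant = record
    { t₁-comm = τ₁-comm ; t₂-comm = τ₂-comm ; t₃-comm = τ₃-comm
    ; t₁-swap₁₂ = τ₁-swap₁₂ ; t₁-swap₂₃ = τ₁-swap₂₃
    ; t₂-swap-ab = τ₂-swap-ab ; t₂-swap-cd = τ₂-swap-cd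
    ; t₃-swap-xy = τ₃-swap-xy ; t₃-swap-uv = τ₃-swap-uv }

  module _ {V : Set} (g : V → V → V → Bool) (t : Kernels) where

    term₁ term₂ term₃ : List V → List V → List V → ℤ
    term₁ r ys zs = on₃ 0ℤ ys λ a b c → on₁ 0ℤ zs λ d → on₂ 0ℤ r λ w v → core₁ g (t₁ t) w v a b c d
    term₂ r ys zs = on₂ 0ℤ ys λ a b → on₂ 0ℤ zs λ c d → on₂ 0ℤ r λ w v → core₂ g (t₂ t) w v a b c d
    term₃ r ys zs = on₂ 0ℤ ys λ a b → on₂ 0ℤ zs λ c d → on₂ 0ℤ r λ w v → core₃ g (t₃ t) w v a b c d

    -- Splits of the four vertices suffice in place of all 24 orderings, because for invariant
    -- kernels each core is unchanged by permutations within the two parts.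
    flag₁ flag₂ flag₃ flags : List V → List V → ℤ
    flag₁ Q r = splits 3 (term₁ r) Q
    flag₂ Q r = splits 2 (term₂ r) Q
    flag₃ Q r = splits 2 (term₃ r) Q
    flags Q r = flag₁ Q r + flag₂ Q r + flag₃ Q r

    -- The flag part has nonnegative sum over all six-tuples, so a uniform upper bound on `total`
    -- bounds the sum of the second part, which counts five-subtuples with four edges. The bound
    -- aimed at is 6 · 20/27 · 7776000 = 34560000.
    total : List V → ℤ
    total xs = splits 4 flags xs + splits 1 (λ _ → spans4 g) xs * + 7776000

  record Symmetric {V : Set} (g : V → V → V → Bool) : Set where
    field
      sym₁₂ : ∀ a b c → g a b c ≡ g b a c
      sym₂₃ : ∀ a b c → g a b c ≡ g a c b

  module _ {V : Set} {g : V → V → V → Bool} (symm : Symmetric g) {t : Kernels} (inv : Invariant t) where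

    open Symmetric symm
    open Invariant inv

    edges-swap : ∀ {xs ys} → Swap xs ys → edges g xs ≡ edges g ys
    edges-swap = ℕΣ.splits-swap 3
      (λ zs → on₃-swap 0 (λ a b c → cong (λ e → if e then 1 else 0) (sym₁₂ a b c))
                         (λ a b c → cong (λ e → if e then 1 else 0) (sym₂₃ a b c)))
      (λ _ _ → refl)

    spans4-swap : ∀ {xs ys} → Swap xs ys → spans4 g xs ≡ spans4 g ys
    spans4-swap s = cong (λ m → if m ≡ᵇ 4 then 1ℤ else 0ℤ) (edges-swap s)

    bits₁-swap₁₂ : ∀ a b c d w → bits₁ g b a c d w ≡ swap₁₂ (bits₁ g a b c d w)
    bits₁-swap₁₂ a b c d w rewrite sym₁₂ b a w = refl

    bits₁-swap₂₃ : ∀ a b c d w → bits₁ g a c b d w ≡ swap₂₃ (bits₁ g a b c d w)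
    bits₁-swap₂₃ a b c d w rewrite sym₁₂ c b w = refl

    bits₂-swap-ab : ∀ a b c d w → bits₂ g b a c d w ≡ swap-ab (bits₂ g a b c d w)
    bits₂-swap-ab a b c d w rewrite sym₁₂ b a w = refl

    bits₂-swap-cd : ∀ a b c d w → bits₂ g a b d c w ≡ swap-cd (bits₂ g a b c d w)
    bits₂-swap-cd a b c d w rewrite sym₁₂ d c w = refl

    bits₃-swap-xy : ∀ x y u v → bits₃ g y x u v ≡ swap-xy (bits₃ g x y u v)
    bits₃-swap-xy x y u v rewrite sym₁₂ y x u | sym₁₂ y x v = refl

    bits₃-swap-uv : ∀ x y u v → bits₃ g x y v u ≡ swap-uv (bits₃ g x y u v)
    bits₃-swap-uv x y u v rewrite sym₁₂ v u x | sym₁₂ v u y = refl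

    core₁-swap-ab : ∀ w v a b c d → core₁ g (t₁ t) w v a b c d ≡ core₁ g (t₁ t) w v b a c d
    core₁-swap-ab w v a b c d = sym (cong₂ (λ e x → if e then x else 0ℤ)
      (cong₂ _∧_ (sym₁₂ b a c) (cong₂ _∧_ (cong not (sym₁₂ b a d)) (∧-comm (not (g b c d)) (not (g a c d)))))
      (trans (cong₂ (t₁ t) (bits₁-swap₁₂ a b c d w) (bits₁-swap₁₂ a b c d v)) (t₁-swap₁₂ _ _)))

    core₁-swap-bc : ∀ w v a b c d → core₁ g (t₁ t) w v a b c d ≡ core₁ g (t₁ t) w v a c b d
    core₁-swap-bc w v a b c d = sym (cong₂ (λ e x → if e then x else 0ℤ)
      (cong₂ _∧_ (sym₂₃ a c b) (∧-swap (not (g a c d)) (not (g a b d)) (sym₁₂ c b d)))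
      (trans (cong₂ (t₁ t) (bits₁-swap₂₃ a b c d w) (bits₁-swap₂₃ a b c d v)) (t₁-swap₂₃ _ _)))
      where
      ∧-swap : ∀ x y {z z′} → z ≡ z′ → x ∧ y ∧ not z ≡ y ∧ x ∧ not z′
      ∧-swap true  true  refl = refl
      ∧-swap true  false refl = refl
      ∧-swap false true  refl = refl
      ∧-swap false false refl = refl

    core₁-swap-wv : ∀ w v a b c d → core₁ g (t₁ t) w v a b c d ≡ core₁ g (t₁ t) v w a b c d
    core₁-swap-wv w v a b c d = cong (λ x → if _ then x else 0ℤ) (t₁-comm (bits₁ g a b c d w) (bits₁ g a b c d v))

    core₂-swap-ab : ∀ w v a b c d → core₂ g (t₂ t) w v a b c d ≡ core₂ g (t₂ t) w v b a c d
    core₂-swap-ab w v a b c d = sym (cong₂ (λ e x → if e then x else 0ℤ)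
      (cong₂ _∧_ (sym₁₂ b a c) (cong₂ _∧_ (sym₁₂ b a d) (∧-comm (not (g b c d)) (not (g a c d)))))
      (trans (cong₂ (t₂ t) (bits₂-swap-ab a b c d w) (bits₂-swap-ab a b c d v)) (t₂-swap-ab _ _)))

    core₂-swap-cd : ∀ w v a b c d → core₂ g (t₂ t) w v a b c d ≡ core₂ g (t₂ t) w v a b d c
    core₂-swap-cd w v a b c d = sym (cong₂ (λ e x → if e then x else 0ℤ)
      (∧-swap (g a b d) (g a b c) (cong₂ (λ x y → not x ∧ not y) (sym₂₃ a d c) (sym₂₃ b d c)))
      (trans (cong₂ (t₂ t) (bits₂-swap-cd a b c d w) (bits₂-swap-cd a b c d v)) (t₂-swap-cd _ _)))
      where
      ∧-swap : ∀ x y {z z′} → z ≡ z′ → x ∧ y ∧ z ≡ y ∧ x ∧ z′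
      ∧-swap true  true  refl = refl
      ∧-swap true  false refl = refl
      ∧-swap false true  refl = refl
      ∧-swap false false refl = refl

    core₂-swap-wv : ∀ w v a b c d → core₂ g (t₂ t) w v a b c d ≡ core₂ g (t₂ t) v w a b c d
    core₂-swap-wv w v a b c d = cong (λ x → if _ then x else 0ℤ) (t₂-comm (bits₂ g a b c d w) (bits₂ g a b c d v))

    core₃-swap-ab : ∀ w v a b c d → core₃ g (t₃ t) w v a b c d ≡ core₃ g (t₃ t) w v b a c d
    core₃-swap-ab w v a b c d = sym (trans (cong (λ p → t₃ t p (bits₃ g w v c d)) (bits₃-swap-uv w v a b)) (t₃-swap-uv _ _))

    core₃-swap-cd : ∀ w v a b c d → core₃ g (t₃ t) w v a b c d ≡ core₃ g (t₃ t) w v a b d c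
    core₃-swap-cd w v a b c d = sym (trans (cong (t₃ t (bits₃ g w v a b)) (bits₃-swap-uv w v c d)) (trans (t₃-comm _ _) (trans (t₃-swap-uv _ _) (t₃-comm _ _))))

    core₃-swap-wv : ∀ w v a b c d → core₃ g (t₃ t) w v a b c d ≡ core₃ g (t₃ t) v w a b c d
    core₃-swap-wv w v a b c d = sym (trans (cong₂ (t₃ t) (bits₃-swap-xy w v a b) (bits₃-swap-xy w v c d)) (t₃-swap-xy _ _))

    flags-swapˡ : ∀ {Q Q′} r → Swap Q Q′ → flags g t Q r ≡ flags g t Q′ r
    flags-swapˡ r s = cong₂ _+_ (cong₂ _+_
      (splits-swap 3
        (λ zs → on₃-swap 0ℤ (λ a b c → on₁-cong 0ℤ zs λ d → on₂-cong 0ℤ r λ w v → core₁-swap-ab w v a b c d)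
                            (λ a b c → on₁-cong 0ℤ zs λ d → on₂-cong 0ℤ r λ w v → core₁-swap-bc w v a b c d))
        (λ ys s → on₃-cong 0ℤ ys λ a b c → on₁-swap 0ℤ _ s) s)
      (splits-swap 2
        (λ zs → on₂-swap 0ℤ λ a b → on₂-cong 0ℤ zs λ c d → on₂-cong 0ℤ r λ w v → core₂-swap-ab w v a b c d)
        (λ ys s → on₂-cong 0ℤ ys λ a b → on₂-swap 0ℤ (λ c d → on₂-cong 0ℤ r λ w v → core₂-swap-cd w v a b c d) s) s))
      (splits-swap 2
        (λ zs → on₂-swap 0ℤ λ a b → on₂-cong 0ℤ zs λ c d → on₂-cong 0ℤ r λ w v → core₃-swap-ab w v a b c d)
        (λ ys s → on₂-cong 0ℤ ys λ a b → on₂-swap 0ℤ (λ c d → on₂-cong 0ℤ r λ w v → core₃-swap-cd w v a b c d) s) s)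

    flags-swapʳ : ∀ Q {r r′} → Swap r r′ → flags g t Q r ≡ flags g t Q r′
    flags-swapʳ Q s = cong₂ _+_ (cong₂ _+_
      (splits-cong 3 (λ ys zs → on₃-cong 0ℤ ys λ a b c → on₁-cong 0ℤ zs λ d → on₂-swap 0ℤ (λ w v → core₁-swap-wv w v a b c d) s) Q)
      (splits-cong 2 (λ ys zs → on₂-cong 0ℤ ys λ a b → on₂-cong 0ℤ zs λ c d → on₂-swap 0ℤ (λ w v → core₂-swap-wv w v a b c d) s) Q))
      (splits-cong 2 (λ ys zs → on₂-cong 0ℤ ys λ a b → on₂-cong 0ℤ zs λ c d → on₂-swap 0ℤ (λ w v → core₃-swap-wv w v a b c d) s) Q)

    -- This is what permits relabelling before the finite check.
    total-swap : ∀ {xs ys} → Swap xs ys → total g t xs ≡ total g t ys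
    total-swap s = cong₂ (λ x y → x + y * + 7776000)
      (splits-swap 4 (λ r → flags-swapˡ r) (λ Q → flags-swapʳ Q) s)
      (splits-swap 1 (λ _ _ → refl) (λ _ → spans4-swap) s)

-- The six-vertex quantity as an explicit expression in twenty edge bits.

module Value where

  open Sums
  open Forms
  open Flags
  open Total
  open import Data.Nat as ℕ using (ℕ; zero; suc; _≡ᵇ_)
  open import Data.Integer using (ℤ; +_; 0ℤ; 1ℤ; _+_; _*_)
  open import Data.Integer.Properties using (+-*-commutativeSemiring; +-identityˡ; +-identityʳ)
  open import Data.Integer.Tactic.RingSolver using (solve-∀)
  open import Data.Bool using (Bool; true; false; if_then_else_)
  open import Data.List as List using (List; []; _∷_; foldr; _++_; replicate)
  open import Data.Vec as Vec using (Vec; []; _∷_; lookup; toList)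
  open import Data.Fin using (Fin; zero; suc)
  open import Data.Fin.Patterns
  open import Data.Product using (_×_; _,_)
  open import Data.Unit using (⊤; tt)
  open import Relation.Binary.PropositionalEquality
  open TupleSums +-*-commutativeSemiring using (splits; splits-cong; splits-swap; splits-map; splits-choices)
  open Kernels

  Graph₂ : ℕ → Set
  Graph₂ zero    = ⊤
  Graph₂ (suc n) = Bits n × Graph₂ n

  -- The first component is the link of the first vertex.
  Graph₃ : ℕ → Set
  Graph₃ zero    = ⊤
  Graph₃ (suc n) = Graph₂ n × Graph₃ n

  at₂ : ∀ {n} → Graph₂ n → Fin n → Fin n → Bool
  at₂ (l , g) zero    zero    = false
  at₂ (l , g) zero    (suc j) = lookup l j
  at₂ (l , g) (suc i) zero    = lookup l i
  at₂ (l , g) (suc i) (suc j) = at₂ g i j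

  at₃ : ∀ {n} → Graph₃ n → Fin n → Fin n → Fin n → Bool
  at₃ (l , g) zero    zero    k       = false
  at₃ (l , g) zero    (suc j) zero    = false
  at₃ (l , g) zero    (suc j) (suc k) = at₂ l j k
  at₃ (l , g) (suc i) zero    zero    = false
  at₃ (l , g) (suc i) zero    (suc k) = at₂ l i k
  at₃ (l , g) (suc i) (suc j) zero    = at₂ l i j
  at₃ (l , g) (suc i) (suc j) (suc k) = at₃ g i j k

  at₂-sym : ∀ {n} (g : Graph₂ n) i j → at₂ g i j ≡ at₂ g j i
  at₂-sym (l , g) zero    zero    = refl
  at₂-sym (l , g) zero    (suc j) = refl
  at₂-sym (l , g) (suc i) zero    = refl
  at₂-sym (l , g) (suc i) (suc j) = at₂-sym g i j

  at₃-symmetric : ∀ {n} (g : Graph₃ n) → Symmetric (at₃ g)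
  at₃-symmetric g = record { sym₁₂ = s₁₂ g ; sym₂₃ = s₂₃ g }
    where
    s₁₂ : ∀ {n} (g : Graph₃ n) i j k → at₃ g i j k ≡ at₃ g j i k
    s₁₂ (l , g) zero    zero    k       = refl
    s₁₂ (l , g) zero    (suc j) zero    = refl
    s₁₂ (l , g) zero    (suc j) (suc k) = refl
    s₁₂ (l , g) (suc i) zero    zero    = refl
    s₁₂ (l , g) (suc i) zero    (suc k) = refl
    s₁₂ (l , g) (suc i) (suc j) zero    = at₂-sym l i j
    s₁₂ (l , g) (suc i) (suc j) (suc k) = s₁₂ g i j k
    s₂₃ : ∀ {n} (g : Graph₃ n) i j k → at₃ g i j k ≡ at₃ g i k j
    s₂₃ (l , g) zero    zero    zero    = refl
    s₂₃ (l , g) zero    zero    (suc k) = refl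
    s₂₃ (l , g) zero    (suc j) zero    = refl
    s₂₃ (l , g) zero    (suc j) (suc k) = at₂-sym l j k
    s₂₃ (l , g) (suc i) zero    zero    = refl
    s₂₃ (l , g) (suc i) zero    (suc k) = refl
    s₂₃ (l , g) (suc i) (suc j) zero    = refl
    s₂₃ (l , g) (suc i) (suc j) (suc k) = s₂₃ g i j k

  pattern ⟨_,_,_,_,_,_⟩ a b c d e f = a ∷ b ∷ c ∷ d ∷ e ∷ f ∷ []

  -- Bits are listed for the pairs ab, ac, ad, bc, bd, cd of a 4-set {a, b, c, d}.
  cell₁₂ : Kernels → (abc abd acd bcd : Bool) → Bits 6 → Bits 6 → ℤ
  cell₁₂ t true false false false ⟨ ab , ac , ad , bc , bd , cd ⟩ ⟨ ab′ , ac′ , ad′ , bc′ , bd′ , cd′ ⟩ =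
    t₁ t ⟨ bc , ac , ab , ad , bd , cd ⟩ ⟨ bc′ , ac′ , ab′ , ad′ , bd′ , cd′ ⟩
  cell₁₂ t false true false false ⟨ ab , ac , ad , bc , bd , cd ⟩ ⟨ ab′ , ac′ , ad′ , bc′ , bd′ , cd′ ⟩ =
    t₁ t ⟨ bd , ad , ab , ac , bc , cd ⟩ ⟨ bd′ , ad′ , ab′ , ac′ , bc′ , cd′ ⟩
  cell₁₂ t false false true false ⟨ ab , ac , ad , bc , bd , cd ⟩ ⟨ ab′ , ac′ , ad′ , bc′ , bd′ , cd′ ⟩ =
    t₁ t ⟨ cd , ad , ac , ab , bc , bd ⟩ ⟨ cd′ , ad′ , ac′ , ab′ , bc′ , bd′ ⟩
  cell₁₂ t false false false true ⟨ ab , ac , ad , bc , bd , cd ⟩ ⟨ ab′ , ac′ , ad′ , bc′ , bd′ , cd′ ⟩ =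
    t₁ t ⟨ cd , bd , bc , ab , ac , ad ⟩ ⟨ cd′ , bd′ , bc′ , ab′ , ac′ , ad′ ⟩
  cell₁₂ t true true false false ⟨ ab , ac , ad , bc , bd , cd ⟩ ⟨ ab′ , ac′ , ad′ , bc′ , bd′ , cd′ ⟩ =
    t₂ t ⟨ ab , cd , ac , ad , bc , bd ⟩ ⟨ ab′ , cd′ , ac′ , ad′ , bc′ , bd′ ⟩
  cell₁₂ t true false true false ⟨ ab , ac , ad , bc , bd , cd ⟩ ⟨ ab′ , ac′ , ad′ , bc′ , bd′ , cd′ ⟩ =
    t₂ t ⟨ ac , bd , ab , ad , bc , cd ⟩ ⟨ ac′ , bd′ , ab′ , ad′ , bc′ , cd′ ⟩
  cell₁₂ t true false false true ⟨ ab , ac , ad , bc , bd , cd ⟩ ⟨ ab′ , ac′ , ad′ , bc′ , bd′ , cd′ ⟩ =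
    t₂ t ⟨ bc , ad , ab , bd , ac , cd ⟩ ⟨ bc′ , ad′ , ab′ , bd′ , ac′ , cd′ ⟩
  cell₁₂ t false true true false ⟨ ab , ac , ad , bc , bd , cd ⟩ ⟨ ab′ , ac′ , ad′ , bc′ , bd′ , cd′ ⟩ =
    t₂ t ⟨ ad , bc , ab , ac , bd , cd ⟩ ⟨ ad′ , bc′ , ab′ , ac′ , bd′ , cd′ ⟩
  cell₁₂ t false true false true ⟨ ab , ac , ad , bc , bd , cd ⟩ ⟨ ab′ , ac′ , ad′ , bc′ , bd′ , cd′ ⟩ =
    t₂ t ⟨ bd , ac , ab , bc , ad , cd ⟩ ⟨ bd′ , ac′ , ab′ , bc′ , ad′ , cd′ ⟩
  cell₁₂ t false false true true ⟨ ab , ac , ad , bc , bd , cd ⟩ ⟨ ab′ , ac′ , ad′ , bc′ , bd′ , cd′ ⟩ =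
    t₂ t ⟨ cd , ab , ac , bc , ad , bd ⟩ ⟨ cd′ , ab′ , ac′ , bc′ , ad′ , bd′ ⟩
  cell₁₂ t _ _ _ _ _ _ = 0ℤ

  -- One term for each of the three pairings of a 4-set. Among the splits each pairing occurs twice,
  -- once with either pair first, and `t₃` is symmetric; hence the factor 2 in `cell`.
  cell₃ : Kernels → Bits 4 → Bits 6 → Bits 6 → ℤ
  cell₃ t (a ∷ b ∷ c ∷ d ∷ []) ⟨ ab , ac , ad , bc , bd , cd ⟩ ⟨ ab′ , ac′ , ad′ , bc′ , bd′ , cd′ ⟩ =
      t₃ t (a ∷ b ∷ ab ∷ ab′ ∷ []) (c ∷ d ∷ cd ∷ cd′ ∷ [])
    + (t₃ t (a ∷ c ∷ ac ∷ ac′ ∷ []) (b ∷ d ∷ bd ∷ bd′ ∷ [])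
    + t₃ t (a ∷ d ∷ ad ∷ ad′ ∷ []) (b ∷ c ∷ bc ∷ bc′ ∷ []))

  Cell : Set
  Cell = (abc abd acd bcd : Bool) → Bits 4 → Bits 6 → Bits 6 → ℤ

  cell : Kernels → Cell
  cell t e₁ e₂ e₃ e₄ c p q = cell₁₂ t e₁ e₂ e₃ e₄ p q + + 2 * cell₃ t c p q

  four : Bits 10 → ℤ
  four bs = if foldr ℕ._+_ 0 (toList (Vec.map (λ e → if e then 1 else 0) bs)) ≡ᵇ 4 then 1ℤ else 0ℤ

  ∑ˡ : List ℤ → ℤ
  ∑ˡ = foldr _+_ 0ℤ

  ∑ˡ-single : ∀ m n x → ∑ˡ (replicate m 0ℤ ++ x ∷ replicate n 0ℤ) ≡ x
  ∑ˡ-single zero    n x = trans (cong (λ y → x + y) (∑ˡ-zeros n)) (+-identityʳ x)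
    where
    ∑ˡ-zeros : ∀ n → ∑ˡ (replicate n 0ℤ) ≡ 0ℤ
    ∑ˡ-zeros zero    = refl
    ∑ˡ-zeros (suc n) = trans (+-identityˡ _) (∑ˡ-zeros n)
  ∑ˡ-single (suc m) n x = trans (+-identityˡ _) (∑ˡ-single m n x)

  sums₁ sums₂ : Kernels → (abc abd acd bcd : Bool) → Bits 6 → Bits 6 → List ℤ
  sums₁ t e₁ e₂ e₃ e₄ ⟨ ab , ac , ad , bc , bd , cd ⟩ ⟨ ab′ , ac′ , ad′ , bc′ , bd′ , cd′ ⟩ =
      guarded₁ (t₁ t) e₁ e₂ e₃ e₄ ⟨ bc , ac , ab , ad , bd , cd ⟩ ⟨ bc′ , ac′ , ab′ , ad′ , bd′ , cd′ ⟩
    ∷ guarded₁ (t₁ t) e₂ e₁ e₃ e₄ ⟨ bd , ad , ab , ac , bc , cd ⟩ ⟨ bd′ , ad′ , ab′ , ac′ , bc′ , cd′ ⟩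
    ∷ guarded₁ (t₁ t) e₃ e₁ e₂ e₄ ⟨ cd , ad , ac , ab , bc , bd ⟩ ⟨ cd′ , ad′ , ac′ , ab′ , bc′ , bd′ ⟩
    ∷ guarded₁ (t₁ t) e₄ e₁ e₂ e₃ ⟨ cd , bd , bc , ab , ac , ad ⟩ ⟨ cd′ , bd′ , bc′ , ab′ , ac′ , ad′ ⟩
    ∷ []
  sums₂ t e₁ e₂ e₃ e₄ ⟨ ab , ac , ad , bc , bd , cd ⟩ ⟨ ab′ , ac′ , ad′ , bc′ , bd′ , cd′ ⟩ =
      guarded₂ (t₂ t) e₁ e₂ e₃ e₄ ⟨ ab , cd , ac , ad , bc , bd ⟩ ⟨ ab′ , cd′ , ac′ , ad′ , bc′ , bd′ ⟩
    ∷ guarded₂ (t₂ t) e₁ e₃ e₂ e₄ ⟨ ac , bd , ab , ad , bc , cd ⟩ ⟨ ac′ , bd′ , ab′ , ad′ , bc′ , cd′ ⟩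
    ∷ guarded₂ (t₂ t) e₂ e₃ e₁ e₄ ⟨ ad , bc , ab , ac , bd , cd ⟩ ⟨ ad′ , bc′ , ab′ , ac′ , bd′ , cd′ ⟩
    ∷ guarded₂ (t₂ t) e₁ e₄ e₂ e₃ ⟨ bc , ad , ab , bd , ac , cd ⟩ ⟨ bc′ , ad′ , ab′ , bd′ , ac′ , cd′ ⟩
    ∷ guarded₂ (t₂ t) e₂ e₄ e₁ e₃ ⟨ bd , ac , ab , bc , ad , cd ⟩ ⟨ bd′ , ac′ , ab′ , bc′ , ad′ , cd′ ⟩
    ∷ guarded₂ (t₂ t) e₃ e₄ e₁ e₂ ⟨ cd , ab , ac , bc , ad , bd ⟩ ⟨ cd′ , ab′ , ac′ , bc′ , ad′ , bd′ ⟩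
    ∷ []

  -- At most one guard is passed: a single edge determines d, and two triples of a 4-set share a
  -- pair, which determines a and b. With no, three or four edges every term is zero.
  sums≡cell₁₂ : ∀ t e₁ e₂ e₃ e₄ p q →
    ∑ˡ (sums₁ t e₁ e₂ e₃ e₄ p q) + ∑ˡ (sums₂ t e₁ e₂ e₃ e₄ p q) ≡ cell₁₂ t e₁ e₂ e₃ e₄ p q
  sums≡cell₁₂ t e₁ e₂ e₃ e₄ ⟨ ab , ac , ad , bc , bd , cd ⟩ ⟨ ab′ , ac′ , ad′ , bc′ , bd′ , cd′ ⟩ = go e₁ e₂ e₃ e₄
    where
    p = ⟨ ab , ac , ad , bc , bd , cd ⟩
    q = ⟨ ab′ , ac′ , ad′ , bc′ , bd′ , cd′ ⟩
    first : ∀ m n x → ∑ˡ (replicate m 0ℤ ++ x ∷ replicate n 0ℤ) + 0ℤ ≡ x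
    first m n x = trans (+-identityʳ _) (∑ˡ-single m n x)
    second : ∀ m n x → 0ℤ + ∑ˡ (replicate m 0ℤ ++ x ∷ replicate n 0ℤ) ≡ x
    second m n x = trans (+-identityˡ _) (∑ˡ-single m n x)
    go : ∀ e₁ e₂ e₃ e₄ → ∑ˡ (sums₁ t e₁ e₂ e₃ e₄ p q) + ∑ˡ (sums₂ t e₁ e₂ e₃ e₄ p q) ≡ cell₁₂ t e₁ e₂ e₃ e₄ p q
    go true  false false false = first 0 3 _
    go false true  false false = first 1 2 _
    go false false true  false = first 2 1 _
    go false false false true  = first 3 0 _
    go true  true  false false = second 0 5 _
    go true  false true  false = second 1 4 _
    go false true  true  false = second 2 3 _
    go true  false false true  = second 3 2 _
    go false true  false true  = second 4 1 _
    go false false true  true  = second 5 0 _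
    go false false false false = refl
    go true  true  true  e     = go₃ e
      where
      go₃ : ∀ e → ∑ˡ (sums₁ t true true true e p q) + ∑ˡ (sums₂ t true true true e p q) ≡ cell₁₂ t true true true e p q
      go₃ true  = refl
      go₃ false = refl
    go true  true  false true  = refl
    go true  false true  true  = refl
    go false true  true  true  = refl

  module _ {V : Set} (g : V → V → V → Bool) where

    pairBits : (a b c d w : V) → Bits 6
    pairBits a b c d w = ⟨ g a b w , g a c w , g a d w , g b c w , g b d w , g c d w ⟩

    cellAt : Cell → List V → List V → ℤ
    cellAt cell (a ∷ b ∷ c ∷ d ∷ []) (w ∷ v ∷ []) =
      cell (g a b c) (g a b d) (g a c d) (g b c d) (g w v a ∷ g w v b ∷ g w v c ∷ g w v d ∷ [])
           (pairBits a b c d w) (pairBits a b c d v)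
    cellAt _ _ _ = 0ℤ

  module _ {V : Set} {g : V → V → V → Bool} (symm : Symmetric g) {t : Kernels} (inv : Invariant t) (w v a b c d : V) where

    open Symmetric symm
    open Invariant inv

    private

      Q r : List V
      Q = a ∷ b ∷ c ∷ d ∷ []
      r = w ∷ v ∷ []
      p q : Bits 6
      p = pairBits g a b c d w
      q = pairBits g a b c d v

    rotate : ∀ x y z → g x y z ≡ g z x y
    rotate x y z = trans (sym₂₃ x y z) (sym₁₂ x z y)

    flag₁≡sums₁ : flag₁ g t Q r ≡ ∑ˡ (sums₁ t (g a b c) (g a b d) (g a c d) (g b c d) p q)
    flag₁≡sums₁ = trans (splits-choices 3 (term₁ g t r) Q)
      (cong ∑ˡ (cong (λ us → core₁ g (t₁ t) w v a b c d ∷ us)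
        (cong₂ _∷_ abd (cong₂ _∷_ acd (cong (_∷ []) bcd)))))
      where
      abd : core₁ g (t₁ t) w v a b d c ≡ _
      abd rewrite sym₂₃ a d c | sym₂₃ b d c | sym₁₂ d c w | sym₁₂ d c v = refl
      acd : core₁ g (t₁ t) w v a c d b ≡ _
      acd rewrite sym₂₃ a c b | sym₂₃ a d b | rotate c d b
        | sym₁₂ c b w | sym₁₂ d b w | sym₁₂ c b v | sym₁₂ d b v = refl
      bcd : core₁ g (t₁ t) w v b c d a ≡ _
      bcd rewrite rotate b c a | rotate b d a | rotate c d a
        | sym₁₂ b a w | sym₁₂ c a w | sym₁₂ d a w | sym₁₂ b a v | sym₁₂ c a v | sym₁₂ d a v = refl

    flag₂≡sums₂ : flag₂ g t Q r ≡ ∑ˡ (sums₂ t (g a b c) (g a b d) (g a c d) (g b c d) p q)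
    flag₂≡sums₂ = trans (splits-choices 2 (term₂ g t r) Q)
      (cong ∑ˡ (cong (λ us → core₂ g (t₂ t) w v a b c d ∷ us)
        (cong₂ _∷_ acbd (cong₂ _∷_ adbc (cong₂ _∷_ bcad (cong₂ _∷_ bdac (cong (_∷ []) cdab)))))))
      where
      acbd : core₂ g (t₂ t) w v a c b d ≡ _
      acbd rewrite sym₂₃ a c b | sym₁₂ c b d | sym₁₂ c b w | sym₁₂ c b v = refl
      adbc : core₂ g (t₂ t) w v a d b c ≡ _
      adbc rewrite sym₂₃ a d b | sym₂₃ a d c | sym (rotate b c d)
        | sym₁₂ d b w | sym₁₂ d c w | sym₁₂ d b v | sym₁₂ d c v = refl
      bcad : core₂ g (t₂ t) w v b c a d ≡ _
      bcad rewrite rotate b c a | sym₁₂ b a d | sym₁₂ c a d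
        | sym₁₂ b a w | sym₁₂ c a w | sym₁₂ b a v | sym₁₂ c a v = refl
      bdac : core₂ g (t₂ t) w v b d a c ≡ _
      bdac rewrite rotate b d a | sym₂₃ b d c | sym₁₂ b a c | sym (rotate a c d)
        | sym₁₂ b a w | sym₁₂ d a w | sym₁₂ d c w | sym₁₂ b a v | sym₁₂ d a v | sym₁₂ d c v = refl
      cdab : core₂ g (t₂ t) w v c d a b ≡ _
      cdab rewrite rotate c d a | rotate c d b | sym (rotate a b c) | sym (rotate a b d)
        | sym₁₂ c a w | sym₁₂ c b w | sym₁₂ d a w | sym₁₂ d b w
        | sym₁₂ c a v | sym₁₂ c b v | sym₁₂ d a v | sym₁₂ d b v = refl

    flag₃≡cell₃ : flag₃ g t Q r ≡ + 2 * cell₃ t (g w v a ∷ g w v b ∷ g w v c ∷ g w v d ∷ []) p q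
    flag₃≡cell₃ = trans (splits-choices 2 (term₃ g t r) Q)
      (trans (cong₂ (λ i j → x + (y + (z + (i + j)))) (t₃-comm _ _)
        (cong₂ (λ i j → i + (j + 0ℤ)) (t₃-comm _ _) (t₃-comm _ _))) (lemma x y z))
      where
      x = core₃ g (t₃ t) w v a b c d
      y = core₃ g (t₃ t) w v a c b d
      z = core₃ g (t₃ t) w v a d b c
      lemma : ∀ x y z → x + (y + (z + (z + (y + (x + 0ℤ))))) ≡ + 2 * (x + (y + z))
      lemma = solve-∀

    flags≡cellAt : flags g t Q r ≡ cellAt g (cell t) Q r
    flags≡cellAt = begin
      flag₁ g t Q r + flag₂ g t Q r + flag₃ g t Q r
        ≡⟨ cong (λ x → x + flag₂ g t Q r + flag₃ g t Q r) flag₁≡sums₁ ⟩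
      ∑ˡ (sums₁ t (g a b c) (g a b d) (g a c d) (g b c d) p q) + flag₂ g t Q r + flag₃ g t Q r
        ≡⟨ cong (λ x → ∑ˡ (sums₁ t (g a b c) (g a b d) (g a c d) (g b c d) p q) + x + flag₃ g t Q r) flag₂≡sums₂ ⟩
      ∑ˡ (sums₁ t (g a b c) (g a b d) (g a c d) (g b c d) p q)
        + ∑ˡ (sums₂ t (g a b c) (g a b d) (g a c d) (g b c d) p q) + flag₃ g t Q r
        ≡⟨ cong (λ x → x + flag₃ g t Q r) (sums≡cell₁₂ t (g a b c) (g a b d) (g a c d) (g b c d) p q) ⟩
      cell₁₂ t (g a b c) (g a b d) (g a c d) (g b c d) p q + flag₃ g t Q r
        ≡⟨ cong (λ x → cell₁₂ t (g a b c) (g a b d) (g a c d) (g b c d) p q + x) flag₃≡cell₃ ⟩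
      cellAt g (cell t) Q r ∎
      where open ≡-Reasoning

  positions : List (Fin 6)
  positions = 0F ∷ 1F ∷ 2F ∷ 3F ∷ 4F ∷ 5F ∷ []

  -- Fifteen 4-subsets and six 5-subsets, written out so that evaluation on many graphs involves no
  -- enumeration of choices. With `c` and `f` as variables the comparison with `sixSum` is purely
  -- syntactic.
  valueWith : Cell → (Bits 10 → ℤ) → Graph₃ 6 → ℤ
  valueWith c f
      (((b012 ∷ b013 ∷ b014 ∷ b015 ∷ []) , (b023 ∷ b024 ∷ b025 ∷ []) , (b034 ∷ b035 ∷ []) , (b045 ∷ []) , ([]) , tt)
      , ((b123 ∷ b124 ∷ b125 ∷ []) , (b134 ∷ b135 ∷ []) , (b145 ∷ []) , ([]) , tt)
      , ((b234 ∷ b235 ∷ []) , (b245 ∷ []) , ([]) , tt)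
      , ((b345 ∷ []) , ([]) , tt)
      , (([]) , tt)
      , (tt)
      , tt) =
      (c b012 b013 b023 b123 (b045 ∷ b145 ∷ b245 ∷ b345 ∷ []) (b014 ∷ b024 ∷ b034 ∷ b124 ∷ b134 ∷ b234 ∷ []) (b015 ∷ b025 ∷ b035 ∷ b125 ∷ b135 ∷ b235 ∷ [])
      + (c b012 b014 b024 b124 (b035 ∷ b135 ∷ b235 ∷ b345 ∷ []) (b013 ∷ b023 ∷ b034 ∷ b123 ∷ b134 ∷ b234 ∷ []) (b015 ∷ b025 ∷ b045 ∷ b125 ∷ b145 ∷ b245 ∷ [])
      + (c b012 b015 b025 b125 (b034 ∷ b134 ∷ b234 ∷ b345 ∷ []) (b013 ∷ b023 ∷ b035 ∷ b123 ∷ b135 ∷ b235 ∷ []) (b014 ∷ b024 ∷ b045 ∷ b124 ∷ b145 ∷ b245 ∷ [])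
      + (c b013 b014 b034 b134 (b025 ∷ b125 ∷ b235 ∷ b245 ∷ []) (b012 ∷ b023 ∷ b024 ∷ b123 ∷ b124 ∷ b234 ∷ []) (b015 ∷ b035 ∷ b045 ∷ b135 ∷ b145 ∷ b345 ∷ [])
      + (c b013 b015 b035 b135 (b024 ∷ b124 ∷ b234 ∷ b245 ∷ []) (b012 ∷ b023 ∷ b025 ∷ b123 ∷ b125 ∷ b235 ∷ []) (b014 ∷ b034 ∷ b045 ∷ b134 ∷ b145 ∷ b345 ∷ [])
      + (c b014 b015 b045 b145 (b023 ∷ b123 ∷ b234 ∷ b235 ∷ []) (b012 ∷ b024 ∷ b025 ∷ b124 ∷ b125 ∷ b245 ∷ []) (b013 ∷ b034 ∷ b035 ∷ b134 ∷ b135 ∷ b345 ∷ [])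
      + (c b023 b024 b034 b234 (b015 ∷ b125 ∷ b135 ∷ b145 ∷ []) (b012 ∷ b013 ∷ b014 ∷ b123 ∷ b124 ∷ b134 ∷ []) (b025 ∷ b035 ∷ b045 ∷ b235 ∷ b245 ∷ b345 ∷ [])
      + (c b023 b025 b035 b235 (b014 ∷ b124 ∷ b134 ∷ b145 ∷ []) (b012 ∷ b013 ∷ b015 ∷ b123 ∷ b125 ∷ b135 ∷ []) (b024 ∷ b034 ∷ b045 ∷ b234 ∷ b245 ∷ b345 ∷ [])
      + (c b024 b025 b045 b245 (b013 ∷ b123 ∷ b134 ∷ b135 ∷ []) (b012 ∷ b014 ∷ b015 ∷ b124 ∷ b125 ∷ b145 ∷ []) (b023 ∷ b034 ∷ b035 ∷ b234 ∷ b235 ∷ b345 ∷ [])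
      + (c b034 b035 b045 b345 (b012 ∷ b123 ∷ b124 ∷ b125 ∷ []) (b013 ∷ b014 ∷ b015 ∷ b134 ∷ b135 ∷ b145 ∷ []) (b023 ∷ b024 ∷ b025 ∷ b234 ∷ b235 ∷ b245 ∷ [])
      + (c b123 b124 b134 b234 (b015 ∷ b025 ∷ b035 ∷ b045 ∷ []) (b012 ∷ b013 ∷ b014 ∷ b023 ∷ b024 ∷ b034 ∷ []) (b125 ∷ b135 ∷ b145 ∷ b235 ∷ b245 ∷ b345 ∷ [])
      + (c b123 b125 b135 b235 (b014 ∷ b024 ∷ b034 ∷ b045 ∷ []) (b012 ∷ b013 ∷ b015 ∷ b023 ∷ b025 ∷ b035 ∷ []) (b124 ∷ b134 ∷ b145 ∷ b234 ∷ b245 ∷ b345 ∷ [])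
      + (c b124 b125 b145 b245 (b013 ∷ b023 ∷ b034 ∷ b035 ∷ []) (b012 ∷ b014 ∷ b015 ∷ b024 ∷ b025 ∷ b045 ∷ []) (b123 ∷ b134 ∷ b135 ∷ b234 ∷ b235 ∷ b345 ∷ [])
      + (c b134 b135 b145 b345 (b012 ∷ b023 ∷ b024 ∷ b025 ∷ []) (b013 ∷ b014 ∷ b015 ∷ b034 ∷ b035 ∷ b045 ∷ []) (b123 ∷ b124 ∷ b125 ∷ b234 ∷ b235 ∷ b245 ∷ [])
      + (c b234 b235 b245 b345 (b012 ∷ b013 ∷ b014 ∷ b015 ∷ []) (b023 ∷ b024 ∷ b025 ∷ b034 ∷ b035 ∷ b045 ∷ []) (b123 ∷ b124 ∷ b125 ∷ b134 ∷ b135 ∷ b145 ∷ [])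
      + 0ℤ)))))))))))))))
      + (f (b123 ∷ b124 ∷ b125 ∷ b134 ∷ b135 ∷ b145 ∷ b234 ∷ b235 ∷ b245 ∷ b345 ∷ [])
      + (f (b023 ∷ b024 ∷ b025 ∷ b034 ∷ b035 ∷ b045 ∷ b234 ∷ b235 ∷ b245 ∷ b345 ∷ [])
      + (f (b013 ∷ b014 ∷ b015 ∷ b034 ∷ b035 ∷ b045 ∷ b134 ∷ b135 ∷ b145 ∷ b345 ∷ [])
      + (f (b012 ∷ b014 ∷ b015 ∷ b024 ∷ b025 ∷ b045 ∷ b124 ∷ b125 ∷ b145 ∷ b245 ∷ [])
      + (f (b012 ∷ b013 ∷ b015 ∷ b023 ∷ b025 ∷ b035 ∷ b123 ∷ b125 ∷ b135 ∷ b235 ∷ [])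
      + (f (b012 ∷ b013 ∷ b014 ∷ b023 ∷ b024 ∷ b034 ∷ b123 ∷ b124 ∷ b134 ∷ b234 ∷ [])
      + 0ℤ)))))) * + 7776000

  value : Kernels → Graph₃ 6 → ℤ
  value t = valueWith (cell t) four

-- Transport to graphs on six positions, and the finite enumeration.

module Pointwise where

  open Sums
  open Forms
  open Flags
  open Total
  open Value
  open import Data.Nat as ℕ using (ℕ; zero; suc; _≡ᵇ_)
  open import Data.Integer using (ℤ; +_; 0ℤ; 1ℤ; _+_; _*_; _≤ᵇ_)
  open import Data.Integer.Properties using (+-*-commutativeSemiring; module ≤-Reasoning)
  open import Data.Bool using (Bool; true; false; _∧_; _∨_; not; if_then_else_)
  open import Data.List as List using (List; []; _∷_; _++_)
  import Data.Bool.ListAction as Boolᴸ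
  open import Data.Vec as Vec using (Vec; []; _∷_; lookup; toList; allFin)
  import Data.Vec.Properties as Vecₚ
  open import Data.Fin using (Fin; zero; suc)
  open import Data.Fin.Patterns
  open import Data.Product using (_,_)
  open import Data.Unit using (tt)
  open import Function using (_∘_)
  open import Relation.Binary.PropositionalEquality
  open TupleSums +-*-commutativeSemiring using (splits; splits-cong; splits-swap; splits-map; splits-choices)
  open Kernels

  four-spans : ∀ {V : Set} (g : V → V → V → Bool) a b c d e →
    spans4 g (a ∷ b ∷ c ∷ d ∷ e ∷ []) ≡
    four (g a b c ∷ g a b d ∷ g a b e ∷ g a c d ∷ g a c e ∷ g a d e ∷ g b c d ∷ g b c e ∷ g b d e ∷ g c d e ∷ [])
  four-spans g a b c d e =
    cong (λ m → if m ≡ᵇ 4 then 1ℤ else 0ℤ) (ℕΣ.splits-choices 3 (λ ys _ → edge₃ g ys) (a ∷ b ∷ c ∷ d ∷ e ∷ []))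

  fiveAt : ∀ {V : Set} → (V → V → V → Bool) → (Bits 10 → ℤ) → List V → ℤ
  fiveAt g f (a ∷ b ∷ c ∷ d ∷ e ∷ []) =
    f (g a b c ∷ g a b d ∷ g a b e ∷ g a c d ∷ g a c e ∷ g a d e ∷ g b c d ∷ g b c e ∷ g b d e ∷ g c d e ∷ [])
  fiveAt g f _ = 0ℤ

  -- Halfway between `total` and `valueWith`: flags are already merged into cells, but adjacency is
  -- still a function.
  sixSum : ∀ {V : Set} → (V → V → V → Bool) → Cell → (Bits 10 → ℤ) → List V → ℤ
  sixSum g c f xs = ∑ˡ (List.map (λ (Q , r) → cellAt g c Q r) (choices 4 xs))
                  + ∑ˡ (List.map (λ (_ , ys) → fiveAt g f ys) (choices 1 xs)) * + 7776000

  module _ {V : Set} {g : V → V → V → Bool} (symm : Symmetric g) {t : Kernels} (inv : Invariant t) where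

    total≡sixSum : ∀ a b c d e f → total g t (a ∷ b ∷ c ∷ d ∷ e ∷ f ∷ []) ≡ sixSum g (cell t) four (a ∷ b ∷ c ∷ d ∷ e ∷ f ∷ [])
    total≡sixSum a b c d e f = cong₂ (λ x y → x + y * + 7776000)
      (trans (splits-choices 4 (flags g t) xs) (cong ∑ˡ (
        cong₂ _∷_ (flags≡cellAt symm inv e f a b c d)
        (cong₂ _∷_ (flags≡cellAt symm inv d f a b c e)
        (cong₂ _∷_ (flags≡cellAt symm inv d e a b c f)
        (cong₂ _∷_ (flags≡cellAt symm inv c f a b d e)
        (cong₂ _∷_ (flags≡cellAt symm inv c e a b d f)
        (cong₂ _∷_ (flags≡cellAt symm inv c d a b e f)
        (cong₂ _∷_ (flags≡cellAt symm inv b f a c d e)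
        (cong₂ _∷_ (flags≡cellAt symm inv b e a c d f)
        (cong₂ _∷_ (flags≡cellAt symm inv b d a c e f)
        (cong₂ _∷_ (flags≡cellAt symm inv b c a d e f)
        (cong₂ _∷_ (flags≡cellAt symm inv a f b c d e)
        (cong₂ _∷_ (flags≡cellAt symm inv a e b c d f)
        (cong₂ _∷_ (flags≡cellAt symm inv a d b c e f)
        (cong₂ _∷_ (flags≡cellAt symm inv a c b d e f)
        (cong (_∷ []) (flags≡cellAt symm inv a b c d e f))))))))))))))))))
      (trans (splits-choices 1 (λ _ → spans4 g) xs) (cong ∑ˡ (
        cong₂ _∷_ (four-spans g b c d e f)
        (cong₂ _∷_ (four-spans g a c d e f)
        (cong₂ _∷_ (four-spans g a b d e f)
        (cong₂ _∷_ (four-spans g a b c e f)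
        (cong₂ _∷_ (four-spans g a b c d f)
        (cong (_∷ []) (four-spans g a b c d e)))))))))
      where
      xs : List V
      xs = a ∷ b ∷ c ∷ d ∷ e ∷ f ∷ []

  sixSum≡valueWith : ∀ c f G → sixSum (at₃ G) c f positions ≡ valueWith c f G
  sixSum≡valueWith c f (((b012 ∷ b013 ∷ b014 ∷ b015 ∷ []) , (b023 ∷ b024 ∷ b025 ∷ []) , (b034 ∷ b035 ∷ []) , (b045 ∷ []) , ([]) , tt) , ((b123 ∷ b124 ∷ b125 ∷ []) , (b134 ∷ b135 ∷ []) , (b145 ∷ []) , ([]) , tt) , ((b234 ∷ b235 ∷ []) , (b245 ∷ []) , ([]) , tt) , ((b345 ∷ []) , ([]) , tt) , (([]) , tt) , (tt) , tt) =
    refl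

  total≡value : ∀ {t} → Invariant t → ∀ G → total (at₃ G) t positions ≡ value t G
  total≡value {t} inv G =
    trans (total≡sixSum (at₃-symmetric G) inv 0F 1F 2F 3F 4F 5F) (sixSum≡valueWith (cell t) four G)

  record _≗ᵏ_ (t t′ : Kernels) : Set where
    field
      t₁≗ : ∀ p q → t₁ t p q ≡ t₁ t′ p q
      t₂≗ : ∀ p q → t₂ t p q ≡ t₂ t′ p q
      t₃≗ : ∀ p q → t₃ t p q ≡ t₃ t′ p q

  module _ {t t′ : Kernels} (t≗t′ : t ≗ᵏ t′) where

    open _≗ᵏ_ t≗t′

    invariant-resp : Invariant t → Invariant t′
    invariant-resp inv = record
      { t₁-comm    = λ p q → trans (sym (t₁≗ p q)) (trans (t₁-comm p q) (t₁≗ q p))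
      ; t₂-comm    = λ p q → trans (sym (t₂≗ p q)) (trans (t₂-comm p q) (t₂≗ q p))
      ; t₃-comm    = λ p q → trans (sym (t₃≗ p q)) (trans (t₃-comm p q) (t₃≗ q p))
      ; t₁-swap₁₂  = λ p q → trans (sym (t₁≗ _ _)) (trans (t₁-swap₁₂ p q) (t₁≗ p q))
      ; t₁-swap₂₃  = λ p q → trans (sym (t₁≗ _ _)) (trans (t₁-swap₂₃ p q) (t₁≗ p q))
      ; t₂-swap-ab = λ p q → trans (sym (t₂≗ _ _)) (trans (t₂-swap-ab p q) (t₂≗ p q))
      ; t₂-swap-cd = λ p q → trans (sym (t₂≗ _ _)) (trans (t₂-swap-cd p q) (t₂≗ p q))
      ; t₃-swap-xy = λ p q → trans (sym (t₃≗ _ _)) (trans (t₃-swap-xy p q) (t₃≗ p q))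
      ; t₃-swap-uv = λ p q → trans (sym (t₃≗ _ _)) (trans (t₃-swap-uv p q) (t₃≗ p q)) }
      where open Invariant inv

    module _ {U V : Set} (f : U → V) {g : V → V → V → Bool} {h : U → U → U → Bool}
             (h≗g : ∀ i j k → h i j k ≡ g (f i) (f j) (f k)) where

      private
        if-cong : ∀ {e e′} {x y : ℤ} → e ≡ e′ → x ≡ y → (if e then x else 0ℤ) ≡ (if e′ then y else 0ℤ)
        if-cong refl refl = refl

      on₁-map : ∀ {A : Set} (z : A) xs {F G} → (∀ a → F a ≡ G (f a)) → on₁ z xs F ≡ on₁ z (List.map f xs) G
      on₁-map z []          F≗G = refl
      on₁-map z (a ∷ [])    F≗G = F≗G a
      on₁-map z (_ ∷ _ ∷ _) F≗G = refl

      on₂-map : ∀ {A : Set} (z : A) xs {F G} → (∀ a b → F a b ≡ G (f a) (f b)) → on₂ z xs F ≡ on₂ z (List.map f xs) G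
      on₂-map z []              F≗G = refl
      on₂-map z (_ ∷ [])        F≗G = refl
      on₂-map z (a ∷ b ∷ [])    F≗G = F≗G a b
      on₂-map z (_ ∷ _ ∷ _ ∷ _) F≗G = refl

      on₃-map : ∀ {A : Set} (z : A) xs {F G} → (∀ a b c → F a b c ≡ G (f a) (f b) (f c)) →
                on₃ z xs F ≡ on₃ z (List.map f xs) G
      on₃-map z []                  F≗G = refl
      on₃-map z (_ ∷ [])            F≗G = refl
      on₃-map z (_ ∷ _ ∷ [])        F≗G = refl
      on₃-map z (a ∷ b ∷ c ∷ [])    F≗G = F≗G a b c
      on₃-map z (_ ∷ _ ∷ _ ∷ _ ∷ _) F≗G = refl

      bits₁-map : ∀ a b c d w → bits₁ h a b c d w ≡ bits₁ g (f a) (f b) (f c) (f d) (f w)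
      bits₁-map a b c d w
        rewrite h≗g b c w | h≗g a c w | h≗g a b w | h≗g a d w | h≗g b d w | h≗g c d w = refl

      bits₂-map : ∀ a b c d w → bits₂ h a b c d w ≡ bits₂ g (f a) (f b) (f c) (f d) (f w)
      bits₂-map a b c d w
        rewrite h≗g b c w | h≗g a c w | h≗g a b w | h≗g a d w | h≗g b d w | h≗g c d w = refl

      bits₃-map : ∀ x y u v → bits₃ h x y u v ≡ bits₃ g (f x) (f y) (f u) (f v)
      bits₃-map x y u v rewrite h≗g x y u | h≗g x y v | h≗g u v x | h≗g u v y = refl

      core₁-map : ∀ w v a b c d → core₁ h (t₁ t) w v a b c d ≡ core₁ g (t₁ t′) (f w) (f v) (f a) (f b) (f c) (f d)
      core₁-map w v a b c d = if-cong
        (cong₂ _∧_ (h≗g a b c) (cong₂ _∧_ (cong not (h≗g a b d)) (cong₂ _∧_ (cong not (h≗g a c d)) (cong not (h≗g b c d)))))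
        (trans (cong₂ (t₁ t) (bits₁-map a b c d w) (bits₁-map a b c d v)) (t₁≗ _ _))

      core₂-map : ∀ w v a b c d → core₂ h (t₂ t) w v a b c d ≡ core₂ g (t₂ t′) (f w) (f v) (f a) (f b) (f c) (f d)
      core₂-map w v a b c d = if-cong
        (cong₂ _∧_ (h≗g a b c) (cong₂ _∧_ (h≗g a b d) (cong₂ _∧_ (cong not (h≗g a c d)) (cong not (h≗g b c d)))))
        (trans (cong₂ (t₂ t) (bits₂-map a b c d w) (bits₂-map a b c d v)) (t₂≗ _ _))

      core₃-map : ∀ w v a b c d → core₃ h (t₃ t) w v a b c d ≡ core₃ g (t₃ t′) (f w) (f v) (f a) (f b) (f c) (f d)
      core₃-map w v a b c d = trans (cong₂ (t₃ t) (bits₃-map w v a b) (bits₃-map w v c d)) (t₃≗ _ _)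

      flags-map : ∀ Q r → flags h t Q r ≡ flags g t′ (List.map f Q) (List.map f r)
      flags-map Q r = cong₂ _+_ (cong₂ _+_
        (trans (splits-cong 3 {G = λ ys zs → term₁ g t′ r′ (List.map f ys) (List.map f zs)}
                 (λ ys zs → on₃-map 0ℤ ys λ a b c → on₁-map 0ℤ zs λ d → on₂-map 0ℤ r λ w v → core₁-map w v a b c d) Q)
               (sym (splits-map f 3 (term₁ g t′ r′) Q)))
        (trans (splits-cong 2 {G = λ ys zs → term₂ g t′ r′ (List.map f ys) (List.map f zs)}
                 (λ ys zs → on₂-map 0ℤ ys λ a b → on₂-map 0ℤ zs λ c d → on₂-map 0ℤ r λ w v → core₂-map w v a b c d) Q)
               (sym (splits-map f 2 (term₂ g t′ r′) Q))))
        (trans (splits-cong 2 {G = λ ys zs → term₃ g t′ r′ (List.map f ys) (List.map f zs)}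
                 (λ ys zs → on₂-map 0ℤ ys λ a b → on₂-map 0ℤ zs λ c d → on₂-map 0ℤ r λ w v → core₃-map w v a b c d) Q)
               (sym (splits-map f 2 (term₃ g t′ r′) Q)))
        where r′ = List.map f r

      edges-map : ∀ xs → edges h xs ≡ edges g (List.map f xs)
      edges-map xs = trans
        (ℕΣ.splits-cong 3 {G = λ ys _ → edge₃ g (List.map f ys)}
          (λ ys _ → on₃-map 0 ys λ a b c → cong (λ e → if e then 1 else 0) (h≗g a b c)) xs)
        (sym (ℕΣ.splits-map f 3 (λ ys _ → edge₃ g ys) xs))

      -- Only the adjacencies among the entries matter, so a six-tuple of vertices can be replaced
      -- by six positions with the graph pulled back along `f`. As `f` may identify positions,
      -- tuples with repeated vertices are covered. The kernels are exchanged in the same step.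
      total-map : ∀ xs → total h t xs ≡ total g t′ (List.map f xs)
      total-map xs = cong₂ (λ x y → x + y * + 7776000)
        (trans (splits-cong 4 {G = λ Q r → flags g t′ (List.map f Q) (List.map f r)} flags-map xs)
               (sym (splits-map f 4 (flags g t′) xs)))
        (trans (splits-cong 1 {G = λ _ ys → spans4 g (List.map f ys)}
                 (λ _ ys → cong (λ m → if m ≡ᵇ 4 then 1ℤ else 0ℤ) (edges-map ys)) xs)
               (sym (splits-map f 1 (λ _ → spans4 g) xs)))

  record Irreflexive {V : Set} (g : V → V → V → Bool) : Set where
    field
      irrefl : ∀ a b → g a a b ≡ false

  enc₂ : ∀ {V : Set} {n} → (V → V → Bool) → Vec V n → Graph₂ n
  enc₂ h []       = tt
  enc₂ h (x ∷ xs) = Vec.map (h x) xs , enc₂ h xs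

  enc₃ : ∀ {V : Set} {n} → (V → V → V → Bool) → Vec V n → Graph₃ n
  enc₃ g []       = tt
  enc₃ g (x ∷ xs) = enc₂ (g x) xs , enc₃ g xs

  at₂-enc₂ : ∀ {V : Set} {n} {h : V → V → Bool} → (∀ x y → h x y ≡ h y x) → (∀ x → h x x ≡ false) →
             ∀ (xs : Vec V n) i j → at₂ (enc₂ h xs) i j ≡ h (lookup xs i) (lookup xs j)
  at₂-enc₂     h-sym h-irr (x ∷ xs) zero    zero    = sym (h-irr x)
  at₂-enc₂ {h = h} h-sym h-irr (x ∷ xs) zero    (suc j) = Vecₚ.lookup-map j (h x) xs
  at₂-enc₂ {h = h} h-sym h-irr (x ∷ xs) (suc i) zero    = trans (Vecₚ.lookup-map i (h x) xs) (h-sym x (lookup xs i))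
  at₂-enc₂     h-sym h-irr (x ∷ xs) (suc i) (suc j) = at₂-enc₂ h-sym h-irr xs i j

  module _ {V : Set} {g : V → V → V → Bool} (symm : Symmetric g) (irr : Irreflexive g) where

    open Symmetric symm
    open Irreflexive irr

    -- Only triples in increasing position are stored; symmetry restores the others, and
    -- irreflexivity matches the value `false` at repeated positions. The entries of `xs` may
    -- coincide, so degenerate tuples also become genuine graphs on the positions.
    at₃-enc₃ : ∀ {n} (xs : Vec V n) i j k → at₃ (enc₃ g xs) i j k ≡ g (lookup xs i) (lookup xs j) (lookup xs k)
    at₃-enc₃ (x ∷ xs) zero zero k = sym (irrefl x _)
    at₃-enc₃ (x ∷ xs) zero (suc j) zero = sym (trans (sym₂₃ x _ x) (irrefl x _))
    at₃-enc₃ (x ∷ xs) zero (suc j) (suc k) =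
      at₂-enc₂ (sym₂₃ x) (λ y → trans (sym₁₂ x y y) (trans (sym₂₃ y x y) (irrefl y x))) xs j k
    at₃-enc₃ (x ∷ xs) (suc i) zero zero = sym (trans (sym₁₂ _ x x) (trans (sym₂₃ x _ x) (irrefl x _)))
    at₃-enc₃ (x ∷ xs) (suc i) zero (suc k) =
      trans (at₂-enc₂ (sym₂₃ x) (λ y → trans (sym₁₂ x y y) (trans (sym₂₃ y x y) (irrefl y x))) xs i k) (sym₁₂ x _ _)
    at₃-enc₃ (x ∷ xs) (suc i) (suc j) zero =
      trans (at₂-enc₂ (sym₂₃ x) (λ y → trans (sym₁₂ x y y) (trans (sym₂₃ y x y) (irrefl y x))) xs i j)
            (trans (sym₁₂ x _ _) (sym₂₃ _ x _))
    at₃-enc₃ (x ∷ xs) (suc i) (suc j) (suc k) = at₃-enc₃ xs i j k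

  enc₂-map : ∀ {U V : Set} {n} (f : U → V) {g : V → V → Bool} {h : U → U → Bool} →
             (∀ i j → h i j ≡ g (f i) (f j)) → (xs : Vec U n) → enc₂ g (Vec.map f xs) ≡ enc₂ h xs
  enc₂-map f h≗g []       = refl
  enc₂-map f {g} h≗g (x ∷ xs) = cong₂ _,_
    (trans (sym (Vecₚ.map-∘ (g (f x)) f xs)) (Vecₚ.map-cong (λ y → sym (h≗g x y)) xs)) (enc₂-map f h≗g xs)

  enc₃-map : ∀ {U V : Set} {n} (f : U → V) {g : V → V → V → Bool} {h : U → U → U → Bool} →
             (∀ i j k → h i j k ≡ g (f i) (f j) (f k)) → (xs : Vec U n) → enc₃ g (Vec.map f xs) ≡ enc₃ h xs
  enc₃-map f h≗g []       = refl
  enc₃-map f h≗g (x ∷ xs) = cong₂ _,_ (enc₂-map f (h≗g x) xs) (enc₃-map f h≗g xs)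

  swapAtᵛ : ∀ {A : Set} {n} → ℕ → Vec A n → Vec A n
  swapAtᵛ zero    (x ∷ y ∷ xs) = y ∷ x ∷ xs
  swapAtᵛ (suc i) (x ∷ xs)     = x ∷ swapAtᵛ i xs
  swapAtᵛ zero    []           = []
  swapAtᵛ zero    (x ∷ [])     = x ∷ []
  swapAtᵛ (suc i) []           = []

  act : ∀ {A : Set} {n} → List ℕ → Vec A n → Vec A n
  act []      xs = xs
  act (i ∷ σ) xs = swapAtᵛ i (act σ xs)

  swapAtᵛ-map : ∀ {A B : Set} {n} (f : A → B) i (xs : Vec A n) → swapAtᵛ i (Vec.map f xs) ≡ Vec.map f (swapAtᵛ i xs)
  swapAtᵛ-map f zero    []           = refl
  swapAtᵛ-map f zero    (x ∷ [])     = refl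
  swapAtᵛ-map f zero    (x ∷ y ∷ xs) = refl
  swapAtᵛ-map f (suc i) []           = refl
  swapAtᵛ-map f (suc i) (x ∷ xs)     = cong (f x ∷_) (swapAtᵛ-map f i xs)

  act-map : ∀ {A B : Set} {n} (f : A → B) σ (xs : Vec A n) → act σ (Vec.map f xs) ≡ Vec.map f (act σ xs)
  act-map f []      xs = refl
  act-map f (i ∷ σ) xs = trans (cong (swapAtᵛ i) (act-map f σ xs)) (swapAtᵛ-map f i (act σ xs))

  toList-swapAtᵛ : ∀ {A : Set} {n} i (xs : Vec A n) → toList (swapAtᵛ i xs) ≡ swapAt i (toList xs)
  toList-swapAtᵛ zero    []           = refl
  toList-swapAtᵛ zero    (x ∷ [])     = refl
  toList-swapAtᵛ zero    (x ∷ y ∷ xs) = refl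
  toList-swapAtᵛ (suc i) []           = refl
  toList-swapAtᵛ (suc i) (x ∷ xs)     = cong (x ∷_) (toList-swapAtᵛ i xs)

  -- Products of these words of adjacent transpositions run through S₅.
  chains : ℕ → List (List ℕ)
  chains zero    = [] ∷ (0 ∷ []) ∷ []
  chains (suc k) = [] ∷ List.map (suc k ∷_) (chains k)

  -- `chains k` lists `k + 2` coset representatives, so `words 3` has 2 · 3 · 4 · 5 = 120 members.
  words : ℕ → List (List ℕ)
  words zero    = chains 0
  words (suc k) = List.concatMap (λ w → List.map (w ++_) (chains (suc k))) (words k)

  allGraph₂ : ∀ n → (Graph₂ n → Bool) → Bool
  allGraph₂ zero    p = p tt
  allGraph₂ (suc n) p = allBits n (λ l → allGraph₂ n (λ g → p (l , g)))

  allGraph₃ : ∀ n → (Graph₃ n → Bool) → Bool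
  allGraph₃ zero    p = p tt
  allGraph₃ (suc n) p = allGraph₂ n (λ l → allGraph₃ n (λ g → p (l , g)))

  allGraph₂-sound : ∀ n (p : Graph₂ n → Bool) → allGraph₂ n p ≡ true → ∀ g → p g ≡ true
  allGraph₂-sound zero    p ok tt      = ok
  allGraph₂-sound (suc n) p ok (l , g) =
    allGraph₂-sound n (λ g → p (l , g)) (allBits-sound (λ l → allGraph₂ n (λ g → p (l , g))) ok l) g

  allGraph₃-sound : ∀ n (p : Graph₃ n → Bool) → allGraph₃ n p ≡ true → ∀ g → p g ≡ true
  allGraph₃-sound zero    p ok tt      = ok
  allGraph₃-sound (suc n) p ok (l , g) =
    allGraph₃-sound n (λ g → p (l , g)) (allGraph₂-sound n (λ l → allGraph₃ n (λ g → p (l , g))) ok l) g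

  code₃ : ∀ {n} → Graph₃ n → ℕ → ℕ
  code₃ {zero}  tt      m = m
  code₃ {suc n} (l , g) m = code₃ g (code₂ l m)
    where
    code₁ : ∀ {n} → Bits n → ℕ → ℕ
    code₁ []           m = m
    code₁ (true ∷ bs)  m = code₁ bs (suc (m ℕ.+ m))
    code₁ (false ∷ bs) m = code₁ bs (m ℕ.+ m)
    code₂ : ∀ {n} → Graph₂ n → ℕ → ℕ
    code₂ {zero}  tt      m = m
    code₂ {suc n} (b , g) m = code₂ g (code₁ b m)

  -- One labelling of each of the 34 graphs on five vertices, the bits being read in lexicographic order.
  representatives : List ℕ
  representatives =
    0 ∷ 19 ∷ 20 ∷ 21 ∷ 36 ∷ 58 ∷ 59 ∷ 91 ∷ 147 ∷ 163 ∷ 164 ∷ 183 ∷ 218 ∷ 219 ∷ 220 ∷ 221 ∷ 292 ∷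
    382 ∷ 383 ∷ 420 ∷ 421 ∷ 438 ∷ 443 ∷ 492 ∷ 511 ∷ 512 ∷ 531 ∷ 677 ∷ 695 ∷ 840 ∷ 860 ∷ 1003 ∷
    1004 ∷ 1023 ∷ []

  elem : ℕ → List ℕ → Bool
  elem m []       = false
  elem m (k ∷ ks) = if m ≡ᵇ k then true else elem m ks

  representative : Graph₃ 5 → Bool
  representative R = elem (code₃ R 0) representatives

  reducible : List (Vec (Fin 5) 5) → Graph₃ 5 → Bool
  reducible ps R = Boolᴸ.any (λ p → representative (enc₃ (at₃ R) p)) ps

  labellings : List (List ℕ) → List (Vec (Fin 5) 5)
  labellings σs = List.map (λ σ → act σ (allFin 5)) σs

  -- The kernels are tabulated because evaluating `bounded` directly would recompute their values.
  data Memo (A : Set) : ℕ → Set where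
    leaf : A → Memo A 0
    node : ∀ {k} → Memo A k → Memo A k → Memo A (suc k)

  memo : ∀ {A} k → (Bits k → A) → Memo A k
  memo zero    f = leaf (f [])
  memo (suc k) f = node (memo k (f ∘ (true ∷_))) (memo k (f ∘ (false ∷_)))

  recall : ∀ {A k} → Memo A k → Bits k → A
  recall (leaf x)   []          = x
  recall (node l r) (true ∷ p)  = recall l p
  recall (node l r) (false ∷ p) = recall r p

  recall-memo : ∀ {A k} (f : Bits k → A) p → recall (memo k f) p ≡ f p
  recall-memo f []          = refl
  recall-memo f (true ∷ p)  = recall-memo (f ∘ (true ∷_)) p
  recall-memo f (false ∷ p) = recall-memo (f ∘ (false ∷_)) p

  Memo² : ℕ → Set
  Memo² k = Memo (Memo ℤ k) k

  memo² : ∀ k → (Bits k → Bits k → ℤ) → Memo² k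
  memo² k f = memo k (λ p → memo k (f p))

  recall² : ∀ {k} → Memo² k → Bits k → Bits k → ℤ
  recall² m p = recall (recall m p)

  recall²-memo² : ∀ {k} (f : Bits k → Bits k → ℤ) p q → f p q ≡ recall² (memo² k f) p q
  recall²-memo² {k} f p q = sym (trans (cong (λ m → recall m q) (recall-memo (λ p → memo k (f p)) p)) (recall-memo (f p) q))

  tabulated : Memo² 6 → Memo² 6 → Memo² 4 → Kernels
  tabulated m₁ m₂ m₃ = record { t₁ = recall² m₁ ; t₂ = recall² m₂ ; t₃ = recall² m₃ }

  -- A graph on six vertices is a link `L` of the first vertex together with a graph `R` on the
  -- other five. Only `R` is normalised, while `L` runs through all 1024 possibilities.
  bounded : Kernels → Graph₃ 5 → Bool
  bounded t R = not (representative R) ∨ allGraph₂ 5 (λ L → value t (L , R) ≤ᵇ + 34560000)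

-- The bound on every six-tuple.

module Bound where

  open Sums
  open Forms
  open Flags
  open Total
  open Value
  open Pointwise
  open import Data.Nat using (ℕ)
  open import Data.Integer using (+_; _≤_; _≤ᵇ_)
  open import Data.Integer.Properties using (≤ᵇ⇒≤)
  open import Data.Bool using (Bool; true; T; not; _∨_)
  open import Data.List as List using (List; []; _∷_)
  open import Data.List.Relation.Unary.Any as Any using (Any)
  import Data.List.Relation.Unary.Any.Properties as Anyₚ
  open import Data.Vec as Vec using (Vec; []; _∷_; lookup; toList; allFin)
  import Data.Vec.Properties as Vecₚ
  open import Data.Product using (_,_; ∃; proj₁; proj₂)
  open import Data.Sum using (inj₁; inj₂)
  open import Function using (_∘_)
  open import Relation.Binary.PropositionalEquality
  open Kernels

  τ̂ : Kernels
  τ̂ = tabulated (memo² 6 τ₁) (memo² 6 τ₂) (memo² 4 τ₃)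

  τ≗τ̂ : τ ≗ᵏ τ̂
  τ≗τ̂ = record { t₁≗ = recall²-memo² τ₁ ; t₂≗ = recall²-memo² τ₂ ; t₃≗ = recall²-memo² τ₃ }

  τ̂≗τ : τ̂ ≗ᵏ τ
  τ̂≗τ = record { t₁≗ = λ p q → sym (recall²-memo² τ₁ p q)
               ; t₂≗ = λ p q → sym (recall²-memo² τ₂ p q)
               ; t₃≗ = λ p q → sym (recall²-memo² τ₃ p q) }

  abstract

    -- Exhaustive evaluation: each of the 1024 graphs on five positions is carried to a listed
    -- representative by one of the 120 permutations.
    reducible-holds : allGraph₃ 5 (reducible (labellings (words 3))) ≡ true
    reducible-holds = refl

    -- Here the actual entries of the matrices matter; the nonnegativity of the flag sums uses only
    -- that the matrices are positive definite.
    bounded-holds : allGraph₃ 5 (bounded τ̂) ≡ true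
    bounded-holds = refl

  toList-lookup : ∀ {V : Set} (zs : Vec V 6) → toList zs ≡ List.map (lookup zs) positions
  toList-lookup (_ ∷ _ ∷ _ ∷ _ ∷ _ ∷ _ ∷ []) = refl

  module _ {V : Set} {g : V → V → V → Bool} (symm : Symmetric g) (irr : Irreflexive g) where

    total-act : ∀ {t} → Invariant t → ∀ x σ {n} (ys : Vec V n) →
                total g t (x ∷ toList (act σ ys)) ≡ total g t (x ∷ toList ys)
    total-act         inv x []      ys = refl
    total-act {t = t} inv x (i ∷ σ) ys = trans swapped (total-act inv x σ ys)
      where
      zs = act σ ys
      swapped : total g t (x ∷ toList (swapAtᵛ i zs)) ≡ total g t (x ∷ toList zs)
      swapped rewrite toList-swapAtᵛ i zs with swapAt-Swap i (toList zs)
      ... | inj₁ eq = cong (λ us → total g t (x ∷ us)) eq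
      ... | inj₂ s  = sym (total-swap symm inv (there s))

    -- The enumeration concerns graphs on five positions. A permutation found for the encoded graph
    -- also serves the tuple, since permuting the entries amounts to permuting the positions.
    representable : ∀ σs → allGraph₃ 5 (reducible (labellings σs)) ≡ true →
                    ∀ (ys : Vec V 5) → ∃ λ σ → T (representative (enc₃ g (act σ ys)))
    representable σs ok ys = σ , subst (T ∘ representative) (sym enc-act) (proj₂ found)
      where
      open ≡-Reasoning
      R = enc₃ g ys
      found : ∃ λ σ → T (representative (enc₃ (at₃ R) (act σ (allFin 5))))
      found = Any.satisfied (Anyₚ.map⁻ (Anyₚ.any⁻ (λ p → representative (enc₃ (at₃ R) p)) (labellings σs)
        (≡true⇒T (allGraph₃-sound 5 (reducible (labellings σs)) ok R))))
      σ = proj₁ found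
      enc-act : enc₃ g (act σ ys) ≡ enc₃ (at₃ R) (act σ (allFin 5))
      enc-act = begin
        enc₃ g (act σ ys)                                ≡⟨ cong (enc₃ g ∘ act σ) (sym (Vecₚ.map-lookup-allFin ys)) ⟩
        enc₃ g (act σ (Vec.map (lookup ys) (allFin 5)))   ≡⟨ cong (enc₃ g) (act-map (lookup ys) σ (allFin 5)) ⟩
        enc₃ g (Vec.map (lookup ys) (act σ (allFin 5)))   ≡⟨ enc₃-map (lookup ys) (at₃-enc₃ symm irr ys) (act σ (allFin 5)) ⟩
        enc₃ (at₃ R) (act σ (allFin 5))                  ∎

    module _ (σs : List (List ℕ)) (reduces : allGraph₃ 5 (reducible (labellings σs)) ≡ true)
             {t t′ : Kernels} (t≗t′ : t ≗ᵏ t′) (inv : Invariant t) (inv′ : Invariant t′) (bounds : allGraph₃ 5 (bounded t) ≡ true) where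

      value-bound : ∀ L R → T (representative R) → value t (L , R) ≤ + 34560000
      value-bound L R rep = ≤ᵇ⇒≤ (≡true⇒T (allGraph₂-sound 5 (λ L → value t (L , R) ≤ᵇ + 34560000) all-L L))
        where
        modus-ponens : ∀ a b → T a → not a ∨ b ≡ true → b ≡ true
        modus-ponens true b _ ok = ok
        all-L : allGraph₂ 5 (λ L → value t (L , R) ≤ᵇ + 34560000) ≡ true
        all-L = modus-ponens (representative R) (allGraph₂ 5 (λ L → value t (L , R) ≤ᵇ + 34560000)) rep
                             (allGraph₃-sound 5 (bounded t) bounds R)

      -- The bound is checked for the tables `t` and wanted for the formulas `t′`. The first entry
      -- keeps its place; the others are permuted until they induce a representative.
      total-bound′ : ∀ x (ys : Vec V 5) → total g t′ (x ∷ toList ys) ≤ + 34560000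
      total-bound′ x ys = subst (_≤ + 34560000) (sym (chain (proj₁ found)))
        (value-bound (enc₂ (g x) (act (proj₁ found) ys)) (enc₃ g (act (proj₁ found) ys)) (proj₂ found))
        where
        open ≡-Reasoning
        found = representable σs reduces ys
        chain : ∀ σ → total g t′ (x ∷ toList ys) ≡ value t (enc₂ (g x) (act σ ys) , enc₃ g (act σ ys))
        chain σ = begin
          total g t′ (x ∷ toList ys)                         ≡⟨ total-act inv′ x σ ys ⟨
          total g t′ (x ∷ toList (act σ ys))                 ≡⟨ cong (total g t′) (toList-lookup (x ∷ act σ ys)) ⟩
          total g t′ (List.map (lookup zs) positions)        ≡⟨ total-map t≗t′ (lookup zs) {g} {at₃ (enc₃ g zs)} (at₃-enc₃ symm irr zs) positions ⟨
          total (at₃ (enc₃ g zs)) t positions                ≡⟨ total≡value {t} inv (enc₃ g zs) ⟩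
          value t (enc₃ g zs)                                ≡⟨ cong (value t) enc₃-∷ ⟩
          value t (enc₂ (g x) (act σ ys) , enc₃ g (act σ ys)) ∎
          where
          zs = x ∷ act σ ys
          enc₃-∷ : enc₃ g zs ≡ (enc₂ (g x) (act σ ys) , enc₃ g (act σ ys))
          enc₃-∷ = refl

    total-bound : ∀ x (ys : Vec V 5) → total g τ (x ∷ toList ys) ≤ + 34560000
    total-bound = total-bound′ (words 3) reducible-holds τ̂≗τ (invariant-resp τ≗τ̂ τ-invariant) τ-invariant bounded-holds

-- Nonnegativity of the flag sums.

module Positivity where

  open Sums
  open Forms
  open Flags
  open Total
  open import Algebra.Bundles using (CommutativeSemiring)
  open import Data.Nat as ℕ using (ℕ; zero; suc)
  open import Data.Integer using (ℤ; +_; 0ℤ; _+_; _≤_)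
  open import Data.Integer.Properties using (+-*-commutativeSemiring; +-mono-≤; ≤-refl)
  open import Data.Bool using (Bool; true; false; T; if_then_else_)
  open import Data.List as List using (List; []; _∷_)
  open import Data.Vec as Vec using (Vec; []; _∷_; toList)
  open import Data.Fin using (Fin; zero; suc)
  open import Function using (_∘_)
  open import Relation.Binary.PropositionalEquality
  open TupleSums +-*-commutativeSemiring
  open import Algebra.Properties.Semiring.Mult (CommutativeSemiring.semiring +-*-commutativeSemiring) using () renaming (_×_ to _×ₙ_)
  open Kernels

  ∑-nonneg : ∀ {n} {f : Fin n → ℤ} → (∀ x → 0ℤ ≤ f x) → 0ℤ ≤ ∑[ x < n ] f x
  ∑-nonneg {zero}  0≤f = ≤-refl
  ∑-nonneg {suc n} 0≤f = +-mono-≤ (0≤f zero) (∑-nonneg (0≤f ∘ suc))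

  ×ₙ-nonneg : ∀ c {x} → 0ℤ ≤ x → 0ℤ ≤ c ×ₙ x
  ×ₙ-nonneg zero    0≤x = ≤-refl
  ×ₙ-nonneg (suc c) 0≤x = +-mono-≤ 0≤x (×ₙ-nonneg c 0≤x)

  ∑ᵗ-monoᵛ : ∀ {n} (k : ℕ) {f g : List (Fin n) → ℤ} →
             (∀ (xs : Vec (Fin n) k) → f (toList xs) ≤ g (toList xs)) → ∑ᵗ k f ≤ ∑ᵗ k g
  ∑ᵗ-monoᵛ zero    f≤g = f≤g []
  ∑ᵗ-monoᵛ (suc k) f≤g = ∑-mono (λ x → ∑ᵗ-monoᵛ k (f≤g ∘ (x ∷_)))
    where
    ∑-mono : ∀ {n} {f g : Fin n → ℤ} → (∀ x → f x ≤ g x) → ∑[ x < n ] f x ≤ ∑[ x < n ] g x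
    ∑-mono {zero}  f≤g = ≤-refl
    ∑-mono {suc n} f≤g = +-mono-≤ (f≤g zero) (∑-mono (f≤g ∘ suc))

  ∑ᵗ-nonneg-+ : ∀ {n} (k : ℕ) {f g : List (Fin n) → ℤ} →
                0ℤ ≤ ∑ᵗ k f → 0ℤ ≤ ∑ᵗ k g → 0ℤ ≤ ∑ᵗ k (λ xs → f xs + g xs)
  ∑ᵗ-nonneg-+ k {f} {g} 0≤f 0≤g = subst (0ℤ ≤_) (sym (∑ᵗ-distrib-+ k f g)) (+-mono-≤ 0≤f 0≤g)

  module _ {n : ℕ} where

    0≤∑∑ : (Fin n → Fin n → ℤ) → Set
    0≤∑∑ f = 0ℤ ≤ ∑[ w < n ] ∑[ v < n ] f w v

    0≤∑∑-+ : ∀ {f g} → 0≤∑∑ f → 0≤∑∑ g → 0≤∑∑ (λ w v → f w v + g w v)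
    0≤∑∑-+ {f} {g} 0≤f 0≤g = subst (0ℤ ≤_)
      (sym (trans (sum-cong-≗ {n} (λ w → ∑-distrib-+ {n} (f w) (g w)))
                  (∑-distrib-+ {n} (λ w → ∑[ v < n ] f w v) (λ w → ∑[ v < n ] g w v))))
      (+-mono-≤ 0≤f 0≤g)

    0≤∑∑-form : ∀ {d} (M : Sym d) → T (positive M) → (φ : Fin n → Vec ℤ d) → 0≤∑∑ (λ w v → form M (φ w) (φ v))
    0≤∑∑-form {d} M pos φ = 0≤∑∑form 1 M pos φ′
      where
      φ′ : List (Fin n) → Vec ℤ d
      φ′ (x ∷ _) = φ x
      φ′ []      = 0ᵛ

    0≤∑∑-if : ∀ e {f} → 0≤∑∑ f → 0≤∑∑ (λ w v → if e then f w v else 0ℤ)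
    0≤∑∑-if true  0≤f = 0≤f
    0≤∑∑-if false 0≤f = ∑-nonneg {n} (λ _ → ∑-nonneg {n} (λ _ → ≤-refl))

    module _ (g : Fin n → Fin n → Fin n → Bool) where

      -- For fixed a, b, c, d the guard is constant, and each of the four double sums is a quadratic
      -- form in the sum over w of one flag vector. Each `refl` runs the elimination for the matrix
      -- concerned.
      0≤core₁ : ∀ a b c d → 0≤∑∑ (λ w v → core₁ g τ₁ w v a b c d)
      0≤core₁ a b c d = 0≤∑∑-if _
        (0≤∑∑-+ {λ w v → form M₁ (features₁ (bits₁ g a b c d w)) (features₁ (bits₁ g a b c d v))}
          (0≤∑∑-form M₁ (≡true⇒T refl) (λ w → features₁ (bits₁ g a b c d w)))
        (0≤∑∑-+ {λ w v → form M₁′ (features₁′ (bits₁ g a b c d w)) (features₁′ (bits₁ g a b c d v))}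
          (0≤∑∑-form M₁′ (≡true⇒T refl) (λ w → features₁′ (bits₁ g a b c d w)))
        (0≤∑∑-+ {λ w v → form M₁′ (features₁′ (rot (bits₁ g a b c d w))) (features₁′ (rot (bits₁ g a b c d v)))}
          (0≤∑∑-form M₁′ (≡true⇒T refl) (λ w → features₁′ (rot (bits₁ g a b c d w))))
          (0≤∑∑-form M₁′ (≡true⇒T refl) (λ w → features₁′ (rot (rot (bits₁ g a b c d w))))))))

      0≤core₂ : ∀ a b c d → 0≤∑∑ (λ w v → core₂ g τ₂ w v a b c d)
      0≤core₂ a b c d = 0≤∑∑-if _
        (0≤∑∑-+ {λ w v → form M₂ (features₂ (bits₂ g a b c d w)) (features₂ (bits₂ g a b c d v))}
          (0≤∑∑-form M₂ (≡true⇒T refl) (λ w → features₂ (bits₂ g a b c d w)))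
          (0≤∑∑-form M₂′ (≡true⇒T refl) (λ w → features₂′ (bits₂ g a b c d w))))

      -- The four splits contribute equally to the sum over all `Q`, leaving four times the double
      -- sums of `0≤core₁`.
      0≤flag₁ : 0ℤ ≤ ∑ᵗ 4 (λ Q → ∑ᵗ 2 (flag₁ g τ Q))
      0≤flag₁ = subst (0ℤ ≤_) (sym eq) (×ₙ-nonneg 4
        (∑-nonneg {n} λ a → ∑-nonneg {n} λ b → ∑-nonneg {n} λ c → ∑-nonneg {n} λ d → 0≤core₁ a b c d))
        where
        eq : ∑ᵗ 4 (λ Q → ∑ᵗ 2 (flag₁ g τ Q)) ≡ 4 ×ₙ ∑ᵗ 3 (λ ys → ∑ᵗ 1 (λ zs → ∑ᵗ 2 (λ r → term₁ g τ r ys zs)))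
        eq = trans (∑ᵗ-cong 4 (λ Q → ∑ᵗ-splits-inner 2 3 (term₁ g τ) Q)) (∑ᵗ-splits 4 3 (λ ys zs → ∑ᵗ 2 (λ r → term₁ g τ r ys zs)))

      0≤flag₂ : 0ℤ ≤ ∑ᵗ 4 (λ Q → ∑ᵗ 2 (flag₂ g τ Q))
      0≤flag₂ = subst (0ℤ ≤_) (sym eq) (×ₙ-nonneg 6
        (∑-nonneg {n} λ a → ∑-nonneg {n} λ b → ∑-nonneg {n} λ c → ∑-nonneg {n} λ d → 0≤core₂ a b c d))
        where
        eq : ∑ᵗ 4 (λ Q → ∑ᵗ 2 (flag₂ g τ Q)) ≡ 6 ×ₙ ∑ᵗ 2 (λ ys → ∑ᵗ 2 (λ zs → ∑ᵗ 2 (λ r → term₂ g τ r ys zs)))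
        eq = trans (∑ᵗ-cong 4 (λ Q → ∑ᵗ-splits-inner 2 2 (term₂ g τ) Q)) (∑ᵗ-splits 4 2 (λ ys zs → ∑ᵗ 2 (λ r → term₂ g τ r ys zs)))

      -- The type sits on the pair `r`, so the sums are interchanged to make `w`, `v` outermost; the
      -- two flags then range independently over pairs of vertices.
      0≤flag₃ : 0ℤ ≤ ∑ᵗ 4 (λ Q → ∑ᵗ 2 (flag₃ g τ Q))
      0≤flag₃ = subst (0ℤ ≤_) (sym (∑ᵗ-comm 4 2 (flag₃ g τ)))
        (∑-nonneg {n} λ w → ∑-nonneg {n} λ v → subst (0ℤ ≤_) (sym (∑ᵗ-splits 4 2 (term₃ g τ (w ∷ v ∷ []))))
          (×ₙ-nonneg 6 (0≤∑∑form 2 M₃ (≡true⇒T refl) (φ w v))))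
        where
        φ : Fin n → Fin n → List (Fin n) → Vec ℤ 7
        φ w v (a ∷ b ∷ _) = features₃ (bits₃ g w v a b)
        φ w v _           = 0ᵛ

      0≤flags : 0ℤ ≤ ∑ᵗ 6 (splits 4 (flags g τ))
      -- Fifteen is `binom 6 4`, the number of places for the four-vertex part.
      0≤flags = subst (0ℤ ≤_) (sym (∑ᵗ-splits 6 4 (flags g τ))) (×ₙ-nonneg 15 (subst (0ℤ ≤_) (sym distribute)
        (∑ᵗ-nonneg-+ 4 {λ Q → ∑ᵗ 2 (flag₁ g τ Q) + ∑ᵗ 2 (flag₂ g τ Q)} {λ Q → ∑ᵗ 2 (flag₃ g τ Q)}
          (∑ᵗ-nonneg-+ 4 {λ Q → ∑ᵗ 2 (flag₁ g τ Q)} {λ Q → ∑ᵗ 2 (flag₂ g τ Q)} 0≤flag₁ 0≤flag₂) 0≤flag₃)))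
        where
        distribute : ∑ᵗ 4 (λ Q → ∑ᵗ 2 (flags g τ Q)) ≡
                     ∑ᵗ 4 (λ Q → ∑ᵗ 2 (flag₁ g τ Q) + ∑ᵗ 2 (flag₂ g τ Q) + ∑ᵗ 2 (flag₃ g τ Q))
        distribute = ∑ᵗ-cong 4 (λ Q →
          trans (∑ᵗ-distrib-+ 2 (λ r → flag₁ g τ Q r + flag₂ g τ Q r) (flag₃ g τ Q))
                (cong (λ x → x + ∑ᵗ 2 (flag₃ g τ Q)) (∑ᵗ-distrib-+ 2 (flag₁ g τ Q) (flag₂ g τ Q))))

-- Counting subsets by recursion.

module Count where

  open import Data.Nat using (ℕ; zero; suc; _+_; _≟_)
  open import Data.Nat.Properties

  open import Data.Bool using (Bool; true; false; not)
  open import Data.List as List using (List; []; _∷_; _++_; filter; length)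
  open import Data.List.Properties using (length-++; filter-++; filter-≐; filter-none)
  open import Data.List.Relation.Unary.All as All using (All)
  open import Data.Fin using (Fin; zero; suc)
  open import Data.Vec using (Vec; []; _∷_; _[_]≔_; lookup)
  open import Data.Fin.Subset using (Subset; inside; outside; _⊆_; ∣_∣; ⊤; ⊥)
  open import Data.Fin.Subset.Properties
  open import Data.Product using (_×_; _,_; proj₁; proj₂)
  open import Function using (_∘_)
  open import Level using (0ℓ)
  open import Relation.Nullary using (does; ¬_)
  open import Relation.Nullary.Decidable using (_×-dec_)
  open import Relation.Unary using (Pred; Decidable)
  open import Relation.Binary.PropositionalEquality
  open import Algebra.Properties.Semiring.Sum +-*-semiring

  ⟦_⟧ : Bool → ℕ
  ⟦ true ⟧  = 1
  ⟦ false ⟧ = 0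

  -- Runs over the `k`-element subsets of `S` without a membership test, since a position outside
  -- `S` has a single branch. In this form the effect of adding a vertex to `S` can be computed, as
  -- in `subsum-⊕`.
  subsum : ∀ {n} → Subset n → ℕ → (Subset n → ℕ) → ℕ
  subsum []            zero    φ = φ []
  subsum []            (suc k) φ = 0
  subsum (outside ∷ S) k       φ = subsum S k (φ ∘ (outside ∷_))
  subsum (inside ∷ S)  zero    φ = subsum S zero (φ ∘ (outside ∷_))
  subsum (inside ∷ S)  (suc k) φ =
    subsum S k (φ ∘ (inside ∷_)) + subsum S (suc k) (φ ∘ (outside ∷_))

  subsum-cong : ∀ {n} (S : Subset n) k {φ ψ : Subset n → ℕ} →
                (∀ T → φ T ≡ ψ T) → subsum S k φ ≡ subsum S k ψ
  subsum-cong []            zero    φ≗ψ = φ≗ψ []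
  subsum-cong []            (suc k) φ≗ψ = refl
  subsum-cong (outside ∷ S) k       φ≗ψ = subsum-cong S k (φ≗ψ ∘ (outside ∷_))
  subsum-cong (inside ∷ S)  zero    φ≗ψ = subsum-cong S zero (φ≗ψ ∘ (outside ∷_))
  subsum-cong (inside ∷ S)  (suc k) φ≗ψ =
    cong₂ _+_ (subsum-cong S k (φ≗ψ ∘ (inside ∷_))) (subsum-cong S (suc k) (φ≗ψ ∘ (outside ∷_)))

  module _ {a b p} {A : Set a} {B : Set b} {P : Pred B p} (P? : Decidable P) (f : A → B) where

    length-filter-map : ∀ xs → length (filter P? (List.map f xs)) ≡ length (filter (P? ∘ f) xs)
    length-filter-map []       = refl
    length-filter-map (x ∷ xs) with does (P? (f x))
    ... | true  = cong suc (length-filter-map xs)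
    ... | false = length-filter-map xs

  module _ {p q} {A : Set} {P : Pred A p} {Q : Pred A q} (P? : Decidable P) (Q? : Decidable Q) where

    length-filter-≐ : (∀ {x} → P x → Q x) → (∀ {x} → Q x → P x) →
                      ∀ xs → length (filter P? xs) ≡ length (filter Q? xs)
    length-filter-≐ P⊆Q Q⊆P xs = cong length (filter-≐ P? Q? (P⊆Q , Q⊆P) xs)

  length-filter-none : ∀ {p} {A : Set} {P : Pred A p} (P? : Decidable P) →
                       (∀ {x} → ¬ P x) → ∀ xs → length (filter P? xs) ≡ 0
  length-filter-none P? ¬P xs = cong length (filter-none P? (All.universal (λ _ → ¬P) xs))

  length-filter-allSubsets : ∀ {n p} {P : Pred (Subset (suc n)) p} (P? : Decidable P) →
    length (filter P? (allSubsets (suc n))) ≡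
    length (filter (P? ∘ (outside ∷_)) (allSubsets n)) + length (filter (P? ∘ (inside ∷_)) (allSubsets n))
  length-filter-allSubsets {n} P? = begin
    length (filter P? (outs ++ ins))              ≡⟨ cong length (filter-++ P? outs ins) ⟩
    length (filter P? outs ++ filter P? ins)      ≡⟨ length-++ (filter P? outs) ⟩
    length (filter P? outs) + length (filter P? ins)
      ≡⟨ cong₂ _+_ (length-filter-map P? _ (allSubsets n)) (length-filter-map P? _ (allSubsets n)) ⟩
    _ ∎
    where
    open ≡-Reasoning
    outs = List.map (outside ∷_) (allSubsets n)
    ins  = List.map (inside ∷_) (allSubsets n)

  Below? : ∀ {n} (S : Subset n) k {Q : Pred (Subset n) 0ℓ} → Decidable Q →
           Decidable (λ T → T ⊆ S × ∣ T ∣ ≡ k × Q T)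
  Below? S k Q? T = (T ⊆? S) ×-dec ((∣ T ∣ ≟ k) ×-dec Q? T)

  length-filter-⊆ : ∀ {n} (S : Subset n) k {Q : Pred (Subset n) 0ℓ} (Q? : Decidable Q) →
    length (filter (Below? S k Q?) (allSubsets n)) ≡ subsum S k (λ T → ⟦ does (Q? T) ⟧)
  length-filter-⊆ [] zero Q? with does (Q? [])
  ... | true  = refl
  ... | false = refl
  length-filter-⊆ [] (suc k) Q? = refl
  length-filter-⊆ {suc n} (outside ∷ S) k Q? = begin
    _ ≡⟨ length-filter-allSubsets (Below? (outside ∷ S) k Q?) ⟩
    _ ≡⟨ cong₂ _+_
           (length-filter-≐ (Below? (outside ∷ S) k Q? ∘ (outside ∷_)) (Below? S k (Q? ∘ (outside ∷_)))
             (λ p → drop-∷-⊆ (proj₁ p) , proj₂ p) (λ p → out⊆ (proj₁ p) , proj₂ p) (allSubsets n))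
           (length-filter-none (Below? (outside ∷ S) k Q? ∘ (inside ∷_)) (λ p → in⊈out (proj₁ p)) (allSubsets n)) ⟩
    _ ≡⟨ +-identityʳ _ ⟩
    _ ≡⟨ length-filter-⊆ S k (Q? ∘ (outside ∷_)) ⟩
    _ ∎
    where
    open ≡-Reasoning
    in⊈out : ∀ {m} {p q : Subset m} → ¬ (inside ∷ p ⊆ outside ∷ q)
    in⊈out p⊆q with p⊆q Data.Vec.here
    ... | ()
  length-filter-⊆ {suc n} (inside ∷ S) zero Q? = begin
    _ ≡⟨ length-filter-allSubsets (Below? (inside ∷ S) zero Q?) ⟩
    _ ≡⟨ cong₂ _+_
           (length-filter-≐ (Below? (inside ∷ S) zero Q? ∘ (outside ∷_)) (Below? S zero (Q? ∘ (outside ∷_)))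
             (λ p → drop-∷-⊆ (proj₁ p) , proj₂ p) (λ p → out⊆ (proj₁ p) , proj₂ p) (allSubsets n))
           (length-filter-none (Below? (inside ∷ S) zero Q? ∘ (inside ∷_)) (λ { (_ , () , _) }) (allSubsets n)) ⟩
    _ ≡⟨ +-identityʳ _ ⟩
    _ ≡⟨ length-filter-⊆ S zero (Q? ∘ (outside ∷_)) ⟩
    _ ∎
    where open ≡-Reasoning
  length-filter-⊆ {suc n} (inside ∷ S) (suc k) Q? = begin
    _ ≡⟨ length-filter-allSubsets (Below? (inside ∷ S) (suc k) Q?) ⟩
    _ ≡⟨ cong₂ _+_
           (length-filter-≐ (Below? (inside ∷ S) (suc k) Q? ∘ (outside ∷_)) (Below? S (suc k) (Q? ∘ (outside ∷_)))
             (λ p → drop-∷-⊆ (proj₁ p) , proj₂ p) (λ p → out⊆ (proj₁ p) , proj₂ p) (allSubsets n))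
           (length-filter-≐ (Below? (inside ∷ S) (suc k) Q? ∘ (inside ∷_)) (Below? S k (Q? ∘ (inside ∷_)))
             (λ p → drop-∷-⊆ (proj₁ p) , suc-injective (proj₁ (proj₂ p)) , proj₂ (proj₂ p))
             (λ p → in⊆in (proj₁ p) , cong suc (proj₁ (proj₂ p)) , proj₂ (proj₂ p)) (allSubsets n)) ⟩
    _ ≡⟨ cong₂ _+_ (length-filter-⊆ S (suc k) (Q? ∘ (outside ∷_))) (length-filter-⊆ S k (Q? ∘ (inside ∷_))) ⟩
    _ ≡⟨ +-comm (subsum S (suc k) _) _ ⟩
    _ ∎
    where open ≡-Reasoning

  e-subsum : ∀ m k {n} (G : Graph3 n) → e m k G ≡ subsum ⊤ m (λ S → ⟦ does (edgesIn G S ≟ k) ⟧)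
  e-subsum m k {n} G =
    trans (length-filter-≐ _ (Below? ⊤ m (λ S → edgesIn G S ≟ k)) (λ p → ⊆⊤ , p) proj₂ (allSubsets n))
          (length-filter-⊆ ⊤ m (λ S → edgesIn G S ≟ k))

  infixr 5 _⊕_
  _⊕_ : ∀ {n} → Fin n → Subset n → Subset n
  x ⊕ S = S [ x ]≔ inside

  -- Pascal's rule: a subset of `x ⊕ S` contains `x` or is a subset of `S`.
  subsum-⊕ : ∀ {n} (S : Subset n) x → lookup S x ≡ outside → ∀ k (φ : Subset n → ℕ) →
             subsum (x ⊕ S) (suc k) φ ≡ subsum S k (φ ∘ (x ⊕_)) + subsum S (suc k) φ
  subsum-⊕ (outside ∷ S) zero    x∉S k φ = cong (_+ subsum S (suc k) (φ ∘ (outside ∷_))) refl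
  subsum-⊕ (outside ∷ S) (suc x) x∉S k φ = subsum-⊕ S x x∉S k (φ ∘ (outside ∷_))
  subsum-⊕ (inside ∷ S)  (suc x) x∉S zero φ = begin
    subsum (x ⊕ S) 0 φᵢ + subsum (x ⊕ S) 1 φₒ
      ≡⟨ cong₂ _+_ (subsum-0 (x ⊕ S) φᵢ) (subsum-⊕ S x x∉S zero φₒ) ⟩
    φᵢ ⊥ + (subsum S 0 (φₒ ∘ (x ⊕_)) + subsum S 1 φₒ)
      ≡⟨ +-comm-assoc (φᵢ ⊥) (subsum S 0 (φₒ ∘ (x ⊕_))) _ ⟩
    subsum S 0 (φₒ ∘ (x ⊕_)) + (φᵢ ⊥ + subsum S 1 φₒ)
      ≡⟨ cong (λ v → subsum S 0 (φₒ ∘ (x ⊕_)) + (v + subsum S 1 φₒ)) (subsum-0 S φᵢ) ⟨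
    subsum S 0 (φₒ ∘ (x ⊕_)) + (subsum S 0 φᵢ + subsum S 1 φₒ) ∎
    where
    open ≡-Reasoning
    φᵢ = φ ∘ (inside ∷_)
    φₒ = φ ∘ (outside ∷_)
    subsum-0 : ∀ {n} (S : Subset n) (φ : Subset n → ℕ) → subsum S 0 φ ≡ φ ⊥
    subsum-0 []            φ = refl
    subsum-0 (outside ∷ S) φ = subsum-0 S (φ ∘ (outside ∷_))
    subsum-0 (inside ∷ S)  φ = subsum-0 S (φ ∘ (outside ∷_))
    +-comm-assoc : ∀ a b c → a + (b + c) ≡ b + (a + c)
    +-comm-assoc a b c = trans (sym (+-assoc a b c)) (trans (cong (_+ c) (+-comm a b)) (+-assoc b a c))
  subsum-⊕ (inside ∷ S)  (suc x) x∉S (suc k) φ = begin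
    subsum (x ⊕ S) (suc k) φᵢ + subsum (x ⊕ S) (suc (suc k)) φₒ
      ≡⟨ cong₂ _+_ (subsum-⊕ S x x∉S k φᵢ) (subsum-⊕ S x x∉S (suc k) φₒ) ⟩
    (subsum S k (φᵢ ∘ (x ⊕_)) + subsum S (suc k) φᵢ) + (subsum S (suc k) (φₒ ∘ (x ⊕_)) + subsum S (suc (suc k)) φₒ)
      ≡⟨ +-interchange (subsum S k (φᵢ ∘ (x ⊕_))) _ _ _ ⟩
    (subsum S k (φᵢ ∘ (x ⊕_)) + subsum S (suc k) (φₒ ∘ (x ⊕_))) + (subsum S (suc k) φᵢ + subsum S (suc (suc k)) φₒ) ∎
    where
    open ≡-Reasoning
    open import Algebra.Properties.CommutativeSemigroup +-commutativeSemigroup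
      using () renaming (interchange to +-interchange)
    φᵢ = φ ∘ (inside ∷_)
    φₒ = φ ∘ (outside ∷_)

  fresh : ∀ {n} → Fin n → Subset n → ℕ
  fresh x S = ⟦ not (lookup S x) ⟧

-- Counting subsets by tuples of distinct vertices.

module Counting where

  open Sums

  open Count
  open import Data.Nat using (ℕ; zero; suc; _+_; _*_; _≟_; _!)
  open import Data.Nat.Properties
  open import Data.Bool using (Bool; true; false)
  open import Data.Fin using (Fin; zero; suc)
  open import Data.Vec using ([]; _∷_; lookup)
  open import Data.List using (List; []; _∷_; length)
  open import Data.Sum using (_⊎_; inj₁; inj₂)
  open import Data.Fin.Subset using (Subset; inside; outside; ⊤; ⊥)
  open import Data.Product using (_×_; _,_; proj₁; proj₂)
  open import Function using (_∘_)
  import Data.Bool.Properties as Boolₚ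
  open import Data.Fin.Subset using (∣_∣)
  open import Data.Fin.Subset.Properties using (_⊆?_)
  open import Relation.Nullary using (does)
  open import Relation.Nullary.Decidable using (_×-dec_)
  open import Relation.Binary.PropositionalEquality
  open TupleSums +-*-commutativeSemiring
  open import Algebra.Properties.CommutativeSemigroup +-commutativeSemigroup using (interchange)

  subsum-0 : ∀ {n} (S : Subset n) (φ : Subset n → ℕ) → subsum S 0 φ ≡ φ ⊥
  subsum-0 []            φ = refl
  subsum-0 (outside ∷ S) φ = subsum-0 S (φ ∘ (outside ∷_))
  subsum-0 (inside ∷ S)  φ = subsum-0 S (φ ∘ (outside ∷_))

  subsum-zero : ∀ {n} (S : Subset n) k → subsum S k (λ _ → 0) ≡ 0
  subsum-zero []            zero    = refl
  subsum-zero []            (suc k) = refl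
  subsum-zero (outside ∷ S) k       = subsum-zero S k
  subsum-zero (inside ∷ S)  zero    = subsum-zero S zero
  subsum-zero (inside ∷ S)  (suc k) = cong₂ _+_ (subsum-zero S k) (subsum-zero S (suc k))

  subsum-⊥ : ∀ n k (φ : Subset n → ℕ) → subsum ⊥ (suc k) φ ≡ 0
  subsum-⊥ zero    k φ = refl
  subsum-⊥ (suc n) k φ = subsum-⊥ n k (φ ∘ (outside ∷_))

  -- Counts the pairs (x , T) with x ∈ T and ∣ T ∣ ≡ suc m in two ways.
  ∑-fresh-subsum : ∀ n m (F : Subset n → ℕ) →
    ∑[ x < n ] subsum ⊤ m (λ S → fresh x S * F (x ⊕ S)) ≡ suc m * subsum ⊤ (suc m) F
  ∑-fresh-subsum zero    m       F = sym (*-zeroʳ (suc m))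
  ∑-fresh-subsum (suc n) zero    F = begin
    subsum ⊤ 0 (λ S → 1 * Fᵢ S) + ∑[ x < n ] subsum ⊤ 0 (λ S → fresh x S * Fₒ (x ⊕ S))
      ≡⟨ cong₂ _+_ (subsum-cong (⊤ {n}) 0 (λ S → *-identityˡ (Fᵢ S))) (∑-fresh-subsum n 0 Fₒ) ⟩
    subsum ⊤ 0 Fᵢ + 1 * subsum ⊤ 1 Fₒ
      ≡⟨ cong (subsum ⊤ 0 Fᵢ +_) (*-identityˡ _) ⟩
    subsum ⊤ 0 Fᵢ + subsum ⊤ 1 Fₒ
      ≡⟨ *-identityˡ _ ⟨
    1 * (subsum ⊤ 0 Fᵢ + subsum ⊤ 1 Fₒ) ∎
    where
    open ≡-Reasoning
    Fᵢ = F ∘ (inside ∷_)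
    Fₒ = F ∘ (outside ∷_)
  ∑-fresh-subsum (suc n) (suc m) F = begin
    (subsum (⊤ {n}) m (λ S → 0) + subsum ⊤ (suc m) (λ S → 1 * Fᵢ S))
      + ∑[ x < n ] (subsum ⊤ m (λ S → fresh x S * Fᵢ (x ⊕ S)) + subsum ⊤ (suc m) (λ S → fresh x S * Fₒ (x ⊕ S)))
      ≡⟨ cong₂ _+_ (cong₂ _+_ (subsum-zero (⊤ {n}) m) (subsum-cong (⊤ {n}) (suc m) (λ S → *-identityˡ (Fᵢ S))))
                   (∑-distrib-+ {n} (λ x → subsum ⊤ m (λ S → fresh x S * Fᵢ (x ⊕ S))) _) ⟩
    a + (∑[ x < n ] subsum ⊤ m (λ S → fresh x S * Fᵢ (x ⊕ S))
         + ∑[ x < n ] subsum ⊤ (suc m) (λ S → fresh x S * Fₒ (x ⊕ S)))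
      ≡⟨ cong (a +_) (cong₂ _+_ (∑-fresh-subsum n m Fᵢ) (∑-fresh-subsum n (suc m) Fₒ)) ⟩
    a + (suc m * a + suc (suc m) * b)
      ≡⟨ +-assoc a (suc m * a) _ ⟨
    suc (suc m) * a + suc (suc m) * b
      ≡⟨ *-distribˡ-+ (suc (suc m)) a b ⟨
    suc (suc m) * (a + b) ∎
    where
    open ≡-Reasoning
    Fᵢ = F ∘ (inside ∷_)
    Fₒ = F ∘ (outside ∷_)
    a = subsum ⊤ (suc m) Fᵢ
    b = subsum ⊤ (suc (suc m)) Fₒ

  insAll : ∀ {n} → List (Fin n) → Subset n
  insAll []       = ⊥
  insAll (x ∷ xs) = x ⊕ insAll xs

  distinct : ∀ {n} → List (Fin n) → ℕ
  distinct []       = 1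
  distinct (x ∷ xs) = fresh x (insAll xs) * distinct xs

  data Distinct {n} : List (Fin n) → Set where
    []  : Distinct []
    _∷_ : ∀ {x xs} → lookup (insAll xs) x ≡ outside → Distinct xs → Distinct (x ∷ xs)

  distinct-view : ∀ {n} (xs : List (Fin n)) → distinct xs ≡ 0 ⊎ (distinct xs ≡ 1 × Distinct xs)
  distinct-view []       = inj₂ (refl , [])
  distinct-view (x ∷ xs) with lookup (insAll xs) x in eq | distinct-view xs
  ... | inside  | _             = inj₁ refl
  ... | outside | inj₁ d≡0      = inj₁ (trans (+-identityʳ _) d≡0)
  ... | outside | inj₂ (d≡1 , d) = inj₂ (trans (+-identityʳ _) d≡1 , eq ∷ d)

  -- Every `k`-set is listed by `k !` tuples. Peeling off the first entry leaves the weight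
  -- `fresh x S`, and `∑-fresh-subsum` supplies the new factor `suc k`.
  ∑ᵗ-distinct : ∀ n k (F : Subset n → ℕ) →
                ∑ᵗ k (λ xs → distinct xs * F (insAll xs)) ≡ k ! * subsum ⊤ k F
  ∑ᵗ-distinct n zero    F = trans (*-identityˡ (F ⊥)) (sym (trans (*-identityˡ _) (subsum-0 (⊤ {n}) F)))
  ∑ᵗ-distinct n (suc k) F = begin
    ∑[ x < n ] ∑ᵗ k (λ xs → distinct (x ∷ xs) * F (x ⊕ insAll xs))
      ≡⟨ sum-cong-≗ {n} (λ x → ∑ᵗ-cong k (λ xs → rearrange (fresh x (insAll xs)) (distinct xs) _)) ⟩
    ∑[ x < n ] ∑ᵗ k (λ xs → distinct xs * (fresh x (insAll xs) * F (x ⊕ insAll xs)))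
      ≡⟨ sum-cong-≗ {n} (λ x → ∑ᵗ-distinct n k (λ S → fresh x S * F (x ⊕ S))) ⟩
    ∑[ x < n ] (k ! * subsum ⊤ k (λ S → fresh x S * F (x ⊕ S)))
      ≡⟨ *-distribˡ-sum {n} (k !) _ ⟨
    k ! * ∑[ x < n ] subsum ⊤ k (λ S → fresh x S * F (x ⊕ S))
      ≡⟨ cong (k ! *_) (∑-fresh-subsum n k F) ⟩
    k ! * (suc k * subsum ⊤ (suc k) F)
      ≡⟨ *-assoc (k !) (suc k) _ ⟨
    k ! * suc k * subsum ⊤ (suc k) F
      ≡⟨ cong (_* subsum ⊤ (suc k) F) (*-comm (k !) (suc k)) ⟩
    suc k ! * subsum ⊤ (suc k) F ∎
    where
    open ≡-Reasoning
    rearrange : ∀ a b c → a * b * c ≡ b * (a * c)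
    rearrange a b c = trans (cong (_* c) (*-comm a b)) (*-assoc b a c)

  -- For distinct entries, subsets of the underlying set correspond to sublists; both sides obey the
  -- same recursion on whether `x` is chosen.
  subsum-insAll : ∀ {n} {xs : List (Fin n)} → Distinct xs → ∀ k φ →
                  subsum (insAll xs) k φ ≡ splits k (λ ys _ → φ (insAll ys)) xs
  subsum-insAll {xs = xs} _        zero    φ = subsum-0 (insAll xs) φ
  subsum-insAll {n}       []       (suc k) φ = subsum-⊥ n k φ
  subsum-insAll {xs = x ∷ xs} (x∉xs ∷ d) (suc k) φ =
    trans (subsum-⊕ (insAll xs) x x∉xs k φ)
          (cong₂ _+_ (subsum-insAll d k (φ ∘ (x ⊕_))) (subsum-insAll d (suc k) φ))

  -- The size is tested as well because a triple of vertices with repetitions spans a smaller set.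
  edge : ∀ {n} → Graph3 n → Subset n → Bool
  edge G T = does ((∣ T ∣ ≟ 3) ×-dec (G T Boolₚ.≟ true))

  adjacent : ∀ {n} → Graph3 n → Fin n → Fin n → Fin n → Bool
  adjacent G x y z = edge G (x ⊕ y ⊕ z ⊕ ⊥)

  edgesIn-subsum : ∀ {n} (G : Graph3 n) S → edgesIn G S ≡ subsum S 3 (λ T → ⟦ edge G T ⟧)
  edgesIn-subsum {n} G S = trans
    (length-filter-≐ (λ T → (T ⊆? S) ×-dec ((∣ T ∣ ≟ 3) ×-dec (G T Boolₚ.≟ true)))
      (Below? S 3 (λ T → (∣ T ∣ ≟ 3) ×-dec (G T Boolₚ.≟ true)))
      (λ p → proj₁ p , proj₁ (proj₂ p) , proj₂ p) (λ p → proj₁ p , proj₂ (proj₂ p)) (allSubsets n))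
    (length-filter-⊆ S 3 (λ T → (∣ T ∣ ≟ 3) ×-dec (G T Boolₚ.≟ true)))

  edgesIn-edges : ∀ {n} (G : Graph3 n) {xs} → Distinct xs → edgesIn G (insAll xs) ≡ Total.edges (adjacent G) xs
  edgesIn-edges G {xs} d = trans (edgesIn-subsum G (insAll xs)) (trans (subsum-insAll d 3 _)
    (splits-cong-length 3 triple xs))
    where
    triple : ∀ ys zs → length ys ≡ 3 → ⟦ edge G (insAll ys) ⟧ ≡ Total.edge₃ (adjacent G) ys
    triple (a ∷ b ∷ c ∷ []) _ _ with adjacent G a b c
    ... | true  = refl
    ... | false = refl

  e-tuples : ∀ m k {n} (G : Graph3 n) →
             m ! * e m k G ≡ ∑ᵗ m (λ xs → distinct xs * ⟦ does (edgesIn G (insAll xs) ≟ k) ⟧)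
  e-tuples m k {n} G = trans (cong (m ! *_) (e-subsum m k G)) (sym (∑ᵗ-distinct n m _))

-- The upper bound for 5-sets with four edges.

module Upper where

  open Sums
  open Count
  open Counting
  open Total using (edges; spans4; total; flags; τ; Symmetric)
  open Pointwise using (Irreflexive)
  open Positivity using (0≤flags; ∑ᵗ-monoᵛ)
  open Bound using (total-bound)
  open import Data.Nat as ℕ using (ℕ; zero; suc; _≤_; _<_; z≤n; s≤s; _≟_; _≡ᵇ_; NonZero)
  import Data.Nat.Properties as ℕₚ
  open import Data.Nat.Tactic.RingSolver using (solve-∀)
  open import Data.Integer as ℤ using (ℤ; +_; 0ℤ)
  import Data.Integer.Properties as ℤₚ
  open import Data.Bool using (Bool; true; false; if_then_else_)
  open import Data.List using (List; []; _∷_)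
  open import Data.Vec using (Vec; []; _∷_; toList)
  open import Data.Fin using (Fin; zero; suc)
  open import Data.Fin.Subset using (Subset; inside; outside; ⊥; ∣_∣)
  open import Data.Fin.Subset.Properties using (∣⊥∣≡0)
  open import Data.Product using (_,_)
  open import Data.Sum using (inj₁; inj₂)
  open import Function using (_∘_)
  open import Relation.Nullary using (does; contradiction)
  open import Relation.Binary.PropositionalEquality

  private
    module ℕΣ = TupleSums ℕₚ.+-*-commutativeSemiring
    module ℤΣ = TupleSums ℤₚ.+-*-commutativeSemiring

  ⊕-comm : ∀ {n} x y (S : Subset n) → x ⊕ y ⊕ S ≡ y ⊕ x ⊕ S
  ⊕-comm zero    zero    (s ∷ S) = refl
  ⊕-comm zero    (suc y) (s ∷ S) = refl
  ⊕-comm (suc x) zero    (s ∷ S) = refl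
  ⊕-comm (suc x) (suc y) (s ∷ S) = cong (s ∷_) (⊕-comm x y S)

  ⊕-idem : ∀ {n} x (S : Subset n) → x ⊕ x ⊕ S ≡ x ⊕ S
  ⊕-idem zero    (s ∷ S) = refl
  ⊕-idem (suc x) (s ∷ S) = cong (s ∷_) (⊕-idem x S)

  ∣⊕∣≤ : ∀ {n} x (S : Subset n) → ∣ x ⊕ S ∣ ≤ suc ∣ S ∣
  ∣⊕∣≤ zero    (inside ∷ S)  = ℕₚ.n≤1+n _
  ∣⊕∣≤ zero    (outside ∷ S) = ℕₚ.≤-refl
  ∣⊕∣≤ (suc x) (inside ∷ S)  = s≤s (∣⊕∣≤ x S)
  ∣⊕∣≤ (suc x) (outside ∷ S) = ∣⊕∣≤ x S

  adjacent-symmetric : ∀ {n} (G : Graph3 n) → Symmetric (adjacent G)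
  adjacent-symmetric G = record
    { sym₁₂ = λ a b c → cong (edge G) (⊕-comm a b (c ⊕ ⊥))
    ; sym₂₃ = λ a b c → cong (λ S → edge G (a ⊕ S)) (⊕-comm b c ⊥) }

  adjacent-irreflexive : ∀ {n} (G : Graph3 n) → Irreflexive (adjacent G)
  adjacent-irreflexive {n} G = record { irrefl = λ a b → small (a ⊕ a ⊕ b ⊕ ⊥) (size a b) }
    where
    size : ∀ a b → ∣ a ⊕ a ⊕ b ⊕ ⊥ ∣ < 3
    size a b rewrite ⊕-idem a (b ⊕ ⊥) = s≤s (ℕₚ.≤-trans (∣⊕∣≤ a (b ⊕ ⊥))
      (s≤s (ℕₚ.≤-trans (∣⊕∣≤ b ⊥) (s≤s (ℕₚ.≤-reflexive (∣⊥∣≡0 n))))))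
    small : ∀ T → ∣ T ∣ < 3 → edge G T ≡ false
    small T T<3 with ∣ T ∣ ≡ᵇ 3 in eq
    ... | false = refl
    ... | true  = contradiction (ℕₚ.≡ᵇ⇒≡ ∣ T ∣ 3 (subst Data.Bool.T (sym eq) _)) (ℕₚ.<⇒≢ T<3)

  +-∑ᵗ : ∀ {n} (k : ℕ) (f : List (Fin n) → ℕ) → + ℕΣ.∑ᵗ k f ≡ ℤΣ.∑ᵗ k (λ xs → + f xs)
  +-∑ᵗ         zero    f = refl
  +-∑ᵗ {n = n} (suc k) f =
    trans (+-∑ {n} (λ x → ℕΣ.∑ᵗ k (f ∘ (x ∷_)))) (ℤΣ.sum-cong-≗ {n} (λ x → +-∑ᵗ k (f ∘ (x ∷_))))
    where
    +-∑ : ∀ {n} (f : Fin n → ℕ) → + ℕΣ.sum {n} f ≡ ℤΣ.sum {n} (λ x → + f x)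
    +-∑ {zero}  f = refl
    +-∑ {suc n} f = trans (ℤₚ.pos-+ (f zero) _) (cong (ℤ._+_ (+ f zero)) (+-∑ {n} (f ∘ suc)))

  ∑ᵗ-const : ∀ n (k : ℕ) c → ℕΣ.∑ᵗ {n} k (λ _ → c) ≡ n ℕ.^ k ℕ.* c
  ∑ᵗ-const n zero    c = sym (ℕₚ.*-identityˡ c)
  ∑ᵗ-const n (suc k) c =
    trans (ℕΣ.sum-cong-≗ {n} (λ _ → ∑ᵗ-const n k c)) (trans (∑-const n (n ℕ.^ k ℕ.* c)) (sym (ℕₚ.*-assoc n (n ℕ.^ k) c)))
    where
    ∑-const : ∀ n c → ℕΣ.sum {n} (λ _ → c) ≡ n ℕ.* c
    ∑-const zero    c = refl
    ∑-const (suc n) c = cong (c ℕ.+_) (∑-const n c)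

  is4 : ℕ → ℕ
  is4 m = if m ≡ᵇ 4 then 1 else 0

  module _ {n : ℕ} {g : Fin n → Fin n → Fin n → Bool} (symm : Symmetric g) (irr : Irreflexive g) where

    private
      X : ℕ
      X = ℕΣ.∑ᵗ 5 (λ xs → is4 (edges g xs))

    -- There are six positions for the omitted vertex, which itself ranges freely over `n` values.
    ∑-splits-spans4 : ℤΣ.∑ᵗ 6 (ℤΣ.splits 1 (λ _ → spans4 g)) ≡ + (6 ℕ.* (n ℕ.* X))
    ∑-splits-spans4 = begin
      ℤΣ.∑ᵗ 6 (ℤΣ.splits 1 (λ _ → spans4 g))                       ≡⟨ ℤΣ.∑ᵗ-cong {n} 6 to-ℕ ⟩
      ℤΣ.∑ᵗ 6 (λ xs → + ℕΣ.splits 1 (λ _ ys → is4 (edges g ys)) xs)  ≡⟨ +-∑ᵗ {n} 6 (ℕΣ.splits 1 (λ _ ys → is4 (edges g ys))) ⟨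
      + ℕΣ.∑ᵗ 6 (ℕΣ.splits 1 (λ _ ys → is4 (edges g ys)))       ≡⟨ cong +_ (ℕΣ.∑ᵗ-splits {n} 6 1 (λ _ ys → is4 (edges g ys))) ⟩
      + (X₁ ℕ.+ (X₁ ℕ.+ (X₁ ℕ.+ (X₁ ℕ.+ (X₁ ℕ.+ (X₁ ℕ.+ 0))))))  ≡⟨ cong (λ x → + (6 ℕ.* x)) X₁≡ ⟩
      + (6 ℕ.* (n ℕ.* X)) ∎
      where
      open ≡-Reasoning
      X₁ = ℕΣ.∑ᵗ {n} 1 (λ _ → X)
      X₁≡ : X₁ ≡ n ℕ.* X
      X₁≡ = trans (∑ᵗ-const n 1 X) (cong (ℕ._* X) (ℕₚ.*-identityʳ n))
      spans4-is4 : ∀ xs → spans4 g xs ≡ + is4 (edges g xs)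
      spans4-is4 xs with edges g xs ≡ᵇ 4
      ... | true  = refl
      ... | false = refl
      +-splits : ∀ m (F : List (Fin n) → List (Fin n) → ℕ) xs → + ℕΣ.splits m F xs ≡ ℤΣ.splits m (λ ys zs → + F ys zs) xs
      +-splits zero    F xs       = refl
      +-splits (suc m) F []       = refl
      +-splits (suc m) F (x ∷ xs) = trans (ℤₚ.pos-+ (ℕΣ.splits m _ xs) _) (cong₂ ℤ._+_ (+-splits m _ xs) (+-splits (suc m) _ xs))
      to-ℕ : ∀ xs → ℤΣ.splits 1 (λ _ → spans4 g) xs ≡ + ℕΣ.splits 1 (λ _ ys → is4 (edges g ys)) xs
      to-ℕ xs = trans (ℤΣ.splits-cong 1 {F = λ _ → spans4 g} (λ _ → spans4-is4) xs)
                      (sym (+-splits 1 (λ _ ys → is4 (edges g ys)) xs))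

    ∑-total-bound : ℤΣ.∑ᵗ 6 (total g τ) ℤ.≤ + (n ℕ.^ 6 ℕ.* 34560000)
    ∑-total-bound = ℤₚ.≤-trans
      (∑ᵗ-monoᵛ {n} 6 {total g τ} {λ _ → + 34560000} bound)
      (ℤₚ.≤-reflexive (trans (sym (+-∑ᵗ {n} 6 (λ _ → 34560000))) (cong +_ (∑ᵗ-const n 6 34560000))))
      where
      bound : ∀ (xs : Vec (Fin n) 6) → total g τ (toList xs) ℤ.≤ + 34560000
      bound (x ∷ ys) = total-bound symm irr x ys

    scaled-bound : + (6 ℕ.* (n ℕ.* X) ℕ.* 7776000) ℤ.≤ + (n ℕ.^ 6 ℕ.* 34560000)
    scaled-bound = begin
      + (6 ℕ.* (n ℕ.* X) ℕ.* 7776000)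
        ≡⟨ ℤₚ.pos-* (6 ℕ.* (n ℕ.* X)) 7776000 ⟩
      + (6 ℕ.* (n ℕ.* X)) ℤ.* + 7776000
        ≡⟨ cong (λ x → x ℤ.* + 7776000) ∑-splits-spans4 ⟨
      ℤΣ.∑ᵗ 6 B ℤ.* + 7776000
        ≡⟨ ℤₚ.+-identityˡ _ ⟨
      0ℤ ℤ.+ ℤΣ.∑ᵗ 6 B ℤ.* + 7776000
        -- The flag terms enter here: their sum `A` is nonnegative, so adding it can only increase
        -- the value.
        ≤⟨ ℤₚ.+-monoˡ-≤ (ℤΣ.∑ᵗ 6 B ℤ.* + 7776000) (0≤flags g) ⟩
      ℤΣ.∑ᵗ 6 A ℤ.+ ℤΣ.∑ᵗ 6 B ℤ.* + 7776000
        ≡⟨ cong (ℤ._+_ (ℤΣ.∑ᵗ 6 A)) (trans (ℤₚ.*-comm (ℤΣ.∑ᵗ 6 B) (+ 7776000)) (sym (ℤΣ.∑ᵗ-*ˡ {n} 6 (+ 7776000) B))) ⟩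
      ℤΣ.∑ᵗ 6 A ℤ.+ ℤΣ.∑ᵗ 6 (λ xs → + 7776000 ℤ.* B xs)
        ≡⟨ cong (ℤ._+_ (ℤΣ.∑ᵗ 6 A)) (ℤΣ.∑ᵗ-cong {n} 6 (λ xs → ℤₚ.*-comm (+ 7776000) (B xs))) ⟩
      ℤΣ.∑ᵗ 6 A ℤ.+ ℤΣ.∑ᵗ 6 (λ xs → B xs ℤ.* + 7776000)
        ≡⟨ ℤΣ.∑ᵗ-distrib-+ {n} 6 A (λ xs → B xs ℤ.* + 7776000) ⟨
      ℤΣ.∑ᵗ 6 (total g τ)
        ≤⟨ ∑-total-bound ⟩
      + (n ℕ.^ 6 ℕ.* 34560000) ∎
      where
      open ℤₚ.≤-Reasoning
      A B : List (Fin n) → ℤ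
      A = ℤΣ.splits 4 (flags g τ)
      B = ℤΣ.splits 1 (λ _ → spans4 g)

  -- The common factor `2 n K` cancels. It is applied with `K` = 864000, as 7776000 = 9 · 864000 and
  -- 34560000 = 40 · 864000. For `n = 0` there is no factor to cancel, hence the last hypothesis.
  cancel-n : ∀ n X K .{{_ : NonZero K}} → 6 ℕ.* (n ℕ.* X) ℕ.* (9 ℕ.* K) ≤ n ℕ.^ 6 ℕ.* (40 ℕ.* K) → (n ≡ 0 → X ≡ 0) →
             27 ℕ.* X ≤ 20 ℕ.* n ℕ.^ 5
  cancel-n zero    X K le X≡0 rewrite X≡0 refl = z≤n
  cancel-n (suc m) X K le _   = ℕₚ.*-cancelˡ-≤ (2 ℕ.* suc m ℕ.* K) {{nz}} (begin
    2 ℕ.* suc m ℕ.* K ℕ.* (27 ℕ.* X)              ≡⟨ left (suc m) X K ⟩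
    6 ℕ.* (suc m ℕ.* X) ℕ.* (9 ℕ.* K)             ≤⟨ le ⟩
    suc m ℕ.^ 6 ℕ.* (40 ℕ.* K)                    ≡⟨ right (suc m) (suc m ℕ.^ 5) K ⟩
    2 ℕ.* suc m ℕ.* K ℕ.* (20 ℕ.* suc m ℕ.^ 5)    ∎)
    where
    open ℕₚ.≤-Reasoning
    nz : NonZero (2 ℕ.* suc m ℕ.* K)
    nz = ℕₚ.m*n≢0 (2 ℕ.* suc m) K
    left : ∀ n X K → 2 ℕ.* n ℕ.* K ℕ.* (27 ℕ.* X) ≡ 6 ℕ.* (n ℕ.* X) ℕ.* (9 ℕ.* K)
    left = solve-∀
    right : ∀ n p K → n ℕ.* p ℕ.* (40 ℕ.* K) ≡ 2 ℕ.* n ℕ.* K ℕ.* (20 ℕ.* p)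
    right = solve-∀

  ∑-spans4-bound : ∀ {n} {g : Fin n → Fin n → Fin n → Bool} → Symmetric g → Irreflexive g →
                   27 ℕ.* ℕΣ.∑ᵗ 5 (λ xs → is4 (edges g xs)) ≤ 20 ℕ.* n ℕ.^ 5
  ∑-spans4-bound {n} {g} symm irr =
    cancel-n n X 864000 (ℤₚ.drop‿+≤+ (scaled-bound symm irr)) (X≡0 n g)
    where
    X = ℕΣ.∑ᵗ 5 (λ xs → is4 (edges g xs))
    X≡0 : ∀ n (g : Fin n → Fin n → Fin n → Bool) → n ≡ 0 → ℕΣ.∑ᵗ 5 (λ xs → is4 (edges g xs)) ≡ 0
    X≡0 zero g refl = refl

  ∑ᵗ-monoᴺ : ∀ {n} (k : ℕ) {f g : List (Fin n) → ℕ} → (∀ xs → f xs ≤ g xs) → ℕΣ.∑ᵗ k f ≤ ℕΣ.∑ᵗ k g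
  ∑ᵗ-monoᴺ zero    f≤g = f≤g []
  ∑ᵗ-monoᴺ (suc k) f≤g = ∑-mono (λ x → ∑ᵗ-monoᴺ k (f≤g ∘ (x ∷_)))
    where
    ∑-mono : ∀ {n} {f g : Fin n → ℕ} → (∀ x → f x ≤ g x) → ℕΣ.sum {n} f ≤ ℕΣ.sum {n} g
    ∑-mono {zero}  f≤g = z≤n
    ∑-mono {suc n} f≤g = ℕₚ.+-mono-≤ (f≤g zero) (∑-mono (f≤g ∘ suc))

  -- Passing from tuples of distinct vertices to all tuples can only increase the count, so
  -- degenerate tuples cause no loss of validity in this direction.
  e₅₄-upper : ∀ {n} (G : Graph3 n) → 27 ℕ.* (120 ℕ.* e 5 4 G) ≤ 20 ℕ.* n ℕ.^ 5
  e₅₄-upper {n} G = ℕₚ.≤-trans (ℕₚ.*-monoʳ-≤ 27 (ℕₚ.≤-trans (ℕₚ.≤-reflexive (e-tuples 5 4 G)) (∑ᵗ-monoᴺ {n} 5 compare)))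
                               (∑-spans4-bound (adjacent-symmetric G) (adjacent-irreflexive G))
    where
    compare : ∀ xs → distinct xs ℕ.* ⟦ does (edgesIn G (insAll xs) ≟ 4) ⟧ ≤ is4 (edges (adjacent G) xs)
    compare xs with distinct-view xs
    ... | inj₁ d≡0 rewrite d≡0 = z≤n
    ... | inj₂ (d≡1 , d) rewrite d≡1 | edgesIn-edges G d with edges (adjacent G) xs ≡ᵇ 4
    ...   | true  = ℕₚ.≤-refl
    ...   | false = z≤n

-- Complements and the three-part construction.

module Lower where

  open Sums
  open Count
  open Counting
  open Upper using (is4; ∑ᵗ-const; ∑ᵗ-monoᴺ)
  open import Data.Nat as ℕ using (ℕ; zero; suc; _+_; _*_; _^_; _≤_; _<_; z≤n; s≤s; _≟_; _≡ᵇ_; _!; _%_)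
  open import Data.Nat.Properties
  open import Data.Nat.Combinatorics using (_C_; nCk+nC[k+1]≡[n+1]C[k+1]; nCn≡1; k>n⇒nCk≡0; nCk≡nC[n∸k])
  open import Data.Nat.Tactic.RingSolver using (solve-∀)
  open import Data.Bool using (true; false; not)
  import Data.Bool.Properties as Boolₚ
  open import Data.List using (List; []; _∷_; map)
  open import Data.Vec using (Vec; []; _∷_; lookup; toList)
  open import Data.Fin using (Fin; zero; suc; toℕ)
  open import Data.Fin.Patterns
  open import Data.Fin.Subset using (Subset; inside; outside; ⊥; ⊤)
  open import Data.Product using (_,_)
  open import Data.Sum using (inj₁; inj₂)
  open import Function using (_∘_)
  open import Relation.Nullary using (does; yes; no)
  open import Relation.Nullary.Decidable using (dec-true; dec-false)
  open import Relation.Binary.PropositionalEquality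
  open TupleSums +-*-commutativeSemiring

  -- `subsum S 3` visits three-element sets only, so `G` itself can be summed, and `not ∘ G` behaves
  -- as the complementary graph.
  edgesIn-subsum′ : ∀ {n} (G : Graph3 n) S → edgesIn G S ≡ subsum S 3 (λ T → ⟦ G T ⟧)
  edgesIn-subsum′ G S = trans (length-filter-⊆ S 3 (λ T → G T Boolₚ.≟ true)) (subsum-cong S 3 does-≟)
    where
    does-≟ : ∀ T → ⟦ does (G T Boolₚ.≟ true) ⟧ ≡ ⟦ G T ⟧
    does-≟ T with G T
    ... | true  = refl
    ... | false = refl

  edgesIn-complement : ∀ {n} (G : Graph3 n) (xs : Vec (Fin n) 5) → Distinct (toList xs) →
                       edgesIn G (insAll (toList xs)) + edgesIn (not ∘ G) (insAll (toList xs)) ≡ 10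
  edgesIn-complement {n} G xs@(_ ∷ _ ∷ _ ∷ _ ∷ _ ∷ []) d = begin
    edgesIn G S + edgesIn (not ∘ G) S
      ≡⟨ cong₂ _+_ (trans (edgesIn-subsum′ G S) (subsum-insAll d 3 (λ T → ⟦ G T ⟧)))
                   (trans (edgesIn-subsum′ (not ∘ G) S) (subsum-insAll d 3 (λ T → ⟦ not (G T) ⟧))) ⟩
    splits 3 (λ ys _ → ⟦ G (insAll ys) ⟧) (toList xs) + splits 3 (λ ys _ → ⟦ not (G (insAll ys)) ⟧) (toList xs)
      ≡⟨ splits-distrib-+ 3 (λ ys _ → ⟦ G (insAll ys) ⟧) (λ ys _ → ⟦ not (G (insAll ys)) ⟧) (toList xs) ⟨
    splits 3 (λ ys _ → ⟦ G (insAll ys) ⟧ + ⟦ not (G (insAll ys)) ⟧) (toList xs)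
      ≡⟨ splits-cong 3 {λ ys _ → ⟦ G (insAll ys) ⟧ + ⟦ not (G (insAll ys)) ⟧} {λ _ _ → 1}
           (λ ys _ → either (G (insAll ys))) (toList xs) ⟩
    10 ∎
    where
    open ≡-Reasoning
    S = insAll (toList xs)
    either : ∀ b → ⟦ b ⟧ + ⟦ not b ⟧ ≡ 1
    either true  = refl
    either false = refl

  -- Each of the ten triples of a 5-set is an edge of exactly one of `G` and `not ∘ G`. The
  -- comparison is made over ordered tuples, whence the factor 120.
  e-complement : ∀ a b → a + b ≡ 10 → ∀ {n} (G : Graph3 n) → e 5 a G ≡ e 5 b (not ∘ G)
  e-complement a b a+b≡10 {n} G = *-cancelˡ-≡ _ _ 120 (begin
    120 * e 5 a G            ≡⟨ e-tuples 5 a G ⟩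
    ∑ᵗ 5 (spanned G a)       ≡⟨ ∑ᵗ-congᵛ {n} 5 {spanned G a} {spanned (not ∘ G) b} pointwise ⟩
    ∑ᵗ 5 (spanned (not ∘ G) b) ≡⟨ e-tuples 5 b (not ∘ G) ⟨
    120 * e 5 b (not ∘ G) ∎)
    where
    open ≡-Reasoning
    spanned : Graph3 n → ℕ → List (Fin n) → ℕ
    spanned H k xs = distinct xs * ⟦ does (edgesIn H (insAll xs) ≟ k) ⟧
    agree : ∀ k l → k + l ≡ 10 → does (k ≟ a) ≡ does (l ≟ b)
    agree k l k+l≡10 with k ≟ a
    ... | yes k≡a = trans (dec-true (k ≟ a) k≡a) (sym (dec-true (l ≟ b)
      (+-cancelˡ-≡ k l b (trans k+l≡10 (trans (sym a+b≡10) (cong (_+ b) (sym k≡a)))))))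
    ... | no  k≢a = trans (dec-false (k ≟ a) k≢a) (sym (dec-false (l ≟ b)
      (λ l≡b → k≢a (+-cancelʳ-≡ l k a (trans k+l≡10 (trans (sym a+b≡10) (cong (a +_) (sym l≡b))))))))
    pointwise : ∀ (xs : Vec (Fin n) 5) → spanned G a (toList xs) ≡ spanned (not ∘ G) b (toList xs)
    pointwise xs with distinct-view (toList xs)
    ... | inj₁ d≡0       = trans (cong (_* ⟦ does (edgesIn G (insAll (toList xs)) ≟ a) ⟧) d≡0)
                                 (sym (cong (_* ⟦ does (edgesIn (not ∘ G) (insAll (toList xs)) ≟ b) ⟧) d≡0))
    ... | inj₂ (_ , d)   = cong (λ e → distinct (toList xs) * ⟦ e ⟧) 
      (agree (edgesIn G (insAll (toList xs))) (edgesIn (not ∘ G) (insAll (toList xs))) (edgesIn-complement G xs d))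

  weight : ∀ {n} → (Fin n → ℕ) → Subset n → ℕ
  weight c []            = 0
  weight c (outside ∷ S) = weight (c ∘ suc) S
  weight c (inside ∷ S)  = c zero + weight (c ∘ suc) S

  weight-⊥ : ∀ {n} (c : Fin n → ℕ) → weight c ⊥ ≡ 0
  weight-⊥ {zero}  c = refl
  weight-⊥ {suc n} c = weight-⊥ (c ∘ suc)

  weights : ∀ {A : Set} → (A → ℕ) → List A → ℕ
  weights c []       = 0
  weights c (x ∷ xs) = c x + weights c xs

  weights-map : ∀ {A B : Set} (c : B → ℕ) (f : A → B) xs → weights (c ∘ f) xs ≡ weights c (map f xs)
  weights-map c f []       = refl
  weights-map c f (x ∷ xs) = cong (c (f x) +_) (weights-map c f xs)

  -- Additivity of the weight requires `x` to lie outside `T`; under the sum this holds because `T`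
  -- is contained in `S`.
  subsum-weight-⊕ : ∀ {n} (c : Fin n → ℕ) (S : Subset n) x → lookup S x ≡ outside → ∀ k (f : ℕ → ℕ) →
                    subsum S k (λ T → f (weight c (x ⊕ T))) ≡ subsum S k (λ T → f (c x + weight c T))
  subsum-weight-⊕ c (outside ∷ S) zero    x∉S k       f = refl
  subsum-weight-⊕ c (outside ∷ S) (suc x) x∉S k       f = subsum-weight-⊕ (c ∘ suc) S x x∉S k f
  subsum-weight-⊕ c (inside ∷ S)  (suc x) x∉S zero    f = subsum-weight-⊕ (c ∘ suc) S x x∉S zero f
  subsum-weight-⊕ c (inside ∷ S)  (suc x) x∉S (suc k) f = cong₂ _+_
    (trans (subsum-weight-⊕ (c ∘ suc) S x x∉S k (f ∘ (c zero +_)))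
           (subsum-cong S k (λ T → cong f (exchange (c zero) (c (suc x)) (weight (c ∘ suc) T)))))
    (subsum-weight-⊕ (c ∘ suc) S x x∉S (suc k) f)
    where
    exchange : ∀ a b w → a + (b + w) ≡ b + (a + w)
    exchange = solve-∀

  subsum-weight : ∀ {n} (c : Fin n → ℕ) {xs} → Distinct xs → ∀ k (f : ℕ → ℕ) →
                  subsum (insAll xs) k (f ∘ weight c) ≡ splits k (λ ys _ → f (weights c ys)) xs
  subsum-weight     c {xs} _  zero    f = trans (subsum-0 (insAll xs) (f ∘ weight c)) (cong f (weight-⊥ c))
  subsum-weight {n} c      [] (suc k) f = subsum-⊥ n k (f ∘ weight c)
  subsum-weight     c {x ∷ xs} (x∉xs ∷ d) (suc k) f = trans (subsum-⊕ (insAll xs) x x∉xs k (f ∘ weight c))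
    (cong₂ _+_ (trans (subsum-weight-⊕ c (insAll xs) x x∉xs k f) (subsum-weight c d k (f ∘ (c x +_))))
               (subsum-weight c d (suc k) f))

  rotate : Fin 3 → Fin 3
  rotate 0F = 1F
  rotate 1F = 2F
  rotate 2F = 0F

  -- The index modulo 3. In recursive form, removing three vertices applies `rotate` three times,
  -- which is the identity; `∑-colour` relies on this.
  colour : ∀ {n} → Fin n → Fin 3
  colour zero    = 0F
  colour (suc i) = rotate (colour i)

  balanced : ℕ → ℕ
  balanced w = ⟦ w % 3 ≡ᵇ 0 ⟧

  -- Three colours sum to 0 modulo 3 exactly if they are all equal or all distinct.
  construction : ∀ n → Graph3 n
  construction n T = weight (toℕ ∘ colour) T % 3 ≡ᵇ 0

  colourEdges : List (Fin 3) → ℕ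
  colourEdges = splits 3 (λ ys _ → balanced (weights toℕ ys))

  edgesIn-construction : ∀ {n} {xs : List (Fin n)} → Distinct xs →
                         edgesIn (construction n) (insAll xs) ≡ colourEdges (map colour xs)
  edgesIn-construction {n} {xs} d = begin
    edgesIn (construction n) (insAll xs)
      ≡⟨ edgesIn-subsum′ (construction n) (insAll xs) ⟩
    subsum (insAll xs) 3 (balanced ∘ weight (toℕ ∘ colour))
      ≡⟨ subsum-weight (toℕ ∘ colour) d 3 balanced ⟩
    splits 3 (λ ys _ → balanced (weights (toℕ ∘ colour) ys)) xs
      ≡⟨ splits-cong 3 {λ ys _ → balanced (weights (toℕ ∘ colour) ys)} {λ ys _ → balanced (weights toℕ (map colour ys))}
           (λ ys _ → cong balanced (weights-map toℕ colour ys)) xs ⟩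
    splits 3 (λ ys _ → balanced (weights toℕ (map colour ys))) xs
      ≡⟨ splits-map colour 3 (λ ys _ → balanced (weights toℕ ys)) xs ⟨
    colourEdges (map colour xs) ∎
    where open ≡-Reasoning

  ∑-mono-≤ : ∀ {n} {f g : Fin n → ℕ} → (∀ x → f x ≤ g x) → sum f ≤ sum g
  ∑-mono-≤ {zero}  f≤g = z≤n
  ∑-mono-≤ {suc n} f≤g = +-mono-≤ (f≤g zero) (∑-mono-≤ (f≤g ∘ suc))

  -- Each block of three consecutive vertices shows every colour once; the contribution of the `r`
  -- remaining vertices is discarded.
  ∑-colour : ∀ m r (ψ : Fin 3 → ℕ) → m * ∑[ a < 3 ] ψ a ≤ ∑[ x < m * 3 + r ] ψ (colour x)
  ∑-colour zero    r ψ = z≤n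
  ∑-colour (suc m) r ψ = begin
    ψ 0F + (ψ 1F + (ψ 2F + 0)) + m * ∑[ a < 3 ] ψ a
      ≤⟨ +-monoʳ-≤ (ψ 0F + (ψ 1F + (ψ 2F + 0))) (∑-colour m r ψ) ⟩
    ψ 0F + (ψ 1F + (ψ 2F + 0)) + ∑[ x < m * 3 + r ] ψ (colour x)
      ≡⟨ shuffle (ψ 0F) (ψ 1F) (ψ 2F) _ ⟩
    ψ 0F + (ψ 1F + (ψ 2F + ∑[ x < m * 3 + r ] ψ (colour x)))
      ≡⟨ cong (λ s → ψ 0F + (ψ 1F + (ψ 2F + s))) (sum-cong-≗ {m * 3 + r} (λ x → cong ψ (sym (rotate³ (colour x))))) ⟩
    ∑[ x < suc m * 3 + r ] ψ (colour x) ∎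
    where
    open ≤-Reasoning
    shuffle : ∀ a b c s → a + (b + (c + 0)) + s ≡ a + (b + (c + s))
    shuffle = solve-∀
    rotate³ : ∀ a → rotate (rotate (rotate a)) ≡ a
    rotate³ 0F = refl
    rotate³ 1F = refl
    rotate³ 2F = refl

  -- Every colour pattern of length `k` is realised by at least `m ^ k` tuples.
  ∑ᵗ-colour : ∀ m r k (F : List (Fin 3) → ℕ) → m ^ k * ∑ᵗ k F ≤ ∑ᵗ {m * 3 + r} k (F ∘ map colour)
  ∑ᵗ-colour m r zero    F = ≤-reflexive (*-identityˡ (F []))
  ∑ᵗ-colour m r (suc k) F = begin
    m * m ^ k * ∑[ a < 3 ] ∑ᵗ k (F ∘ (a ∷_))
      ≡⟨ *-assoc m (m ^ k) _ ⟩
    m * (m ^ k * ∑[ a < 3 ] ∑ᵗ k (F ∘ (a ∷_)))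
      ≡⟨ cong (m *_) (*-distribˡ-sum {3} (m ^ k) (λ a → ∑ᵗ k (F ∘ (a ∷_)))) ⟩
    m * ∑[ a < 3 ] (m ^ k * ∑ᵗ k (F ∘ (a ∷_)))
      ≤⟨ *-monoʳ-≤ m (∑-mono-≤ {3} (λ a → ∑ᵗ-colour m r k (F ∘ (a ∷_)))) ⟩
    m * ∑[ a < 3 ] ∑ᵗ {m * 3 + r} k (F ∘ (a ∷_) ∘ map colour)
      ≤⟨ ∑-colour m r (λ a → ∑ᵗ {m * 3 + r} k (F ∘ (a ∷_) ∘ map colour)) ⟩
    ∑ᵗ {m * 3 + r} (suc k) (F ∘ map colour) ∎
    where open ≤-Reasoning

  subsets : ℕ → ℕ → ℕ
  subsets n k = subsum (⊤ {n}) k (λ _ → 1)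

  subsets-C : ∀ n k → subsets n k ≡ n C k
  subsets-C n       zero    = trans (subsum-0 (⊤ {n}) (λ _ → 1)) (sym (trans (nCk≡nC[n∸k] (z≤n {n})) (nCn≡1 n)))
  subsets-C zero    (suc k) = sym (k>n⇒nCk≡0 (s≤s (z≤n {k})))
  subsets-C (suc n) (suc k) = trans (cong₂ _+_ (subsets-C n k) (subsets-C n (suc k))) (nCk+nC[k+1]≡[n+1]C[k+1] n k)

  -- Pairs of a `k`-set and a vertex are counted according to whether the vertex lies in the set.
  -- The additive form avoids the factor n - k.
  subsets-step : ∀ n k → suc k * subsets n (suc k) + k * subsets n k ≡ n * subsets n k
  subsets-step zero    zero          = refl
  subsets-step zero    (suc k)       = trans (cong₂ _+_ (*-zeroʳ (suc (suc k))) (*-zeroʳ (suc k))) refl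
  subsets-step (suc n) zero          = trans (lemma (subsets n 0) (subsets n 1)) (cong (subsets n 0 +_) (subsets-step n 0))
    where
    lemma : ∀ a b → 1 * (a + b) + 0 * a ≡ a + (1 * b + 0 * a)
    lemma = solve-∀
  subsets-step (suc n) (suc k)       = begin
    suc (suc k) * (s₁ + s₂) + suc k * (s₀ + s₁)
      ≡⟨ left k s₀ s₁ s₂ ⟩
    (suc (suc k) * s₂ + suc k * s₁) + (suc k * s₁ + k * s₀) + (s₀ + s₁)
      ≡⟨ cong (_+ (s₀ + s₁)) (cong₂ _+_ (subsets-step n (suc k)) (subsets-step n k)) ⟩
    n * s₁ + n * s₀ + (s₀ + s₁)
      ≡⟨ right n s₀ s₁ ⟩
    suc n * (s₀ + s₁) ∎
    where
    open ≡-Reasoning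
    s₀ = subsets n k
    s₁ = subsets n (suc k)
    s₂ = subsets n (suc (suc k))
    left : ∀ k a b c → suc (suc k) * (b + c) + suc k * (a + b) ≡ (suc (suc k) * c + suc k * b) + (suc k * b + k * a) + (a + b)
    left = solve-∀
    right : ∀ n a b → n * b + n * a + (a + b) ≡ suc n * (a + b)
    right = solve-∀

  -- The falling power n (n - 1) ... (n - k + 1), which counts injective tuples, expressed without
  -- truncated subtraction.
  falling : ℕ → ℕ → ℕ
  falling n k = k ! * subsets n k

  falling-step : ∀ n k → falling n (suc k) + k * falling n k ≡ n * falling n k
  falling-step n k = begin
    suc k * k ! * subsets n (suc k) + k * (k ! * subsets n k)   ≡⟨ left k (k !) (subsets n (suc k)) (subsets n k) ⟩
    k ! * (suc k * subsets n (suc k) + k * subsets n k)         ≡⟨ cong (k ! *_) (subsets-step n k) ⟩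
    k ! * (n * subsets n k)                                     ≡⟨ right n (k !) (subsets n k) ⟩
    n * (k ! * subsets n k) ∎
    where
    open ≡-Reasoning
    left : ∀ k f a b → suc k * f * a + k * (f * b) ≡ f * (suc k * a + k * b)
    left = solve-∀
    right : ∀ n f b → f * (n * b) ≡ n * (f * b)
    right = solve-∀

  falling≤^ : ∀ n k → falling n k ≤ n ^ k
  falling≤^ n zero    = ≤-reflexive (trans (*-identityˡ _) (subsum-0 (⊤ {n}) (λ _ → 1)))
  falling≤^ n (suc k) = ≤-trans (m≤m+n (falling n (suc k)) (k * falling n k))
    (≤-trans (≤-reflexive (falling-step n k)) (*-monoʳ-≤ n (falling≤^ n k)))

  triangle : ℕ → ℕ
  triangle zero    = 0
  triangle (suc k) = k + triangle k

  -- The product of the factors 1 - i/n is at least 1 minus the sum of the i/n; here denominators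
  -- are cleared and i runs from 0 to `k`. For fifth powers the coefficient `triangle 5` is 10.
  ^≤falling : ∀ n k → n ^ suc k ≤ falling n (suc k) + triangle (suc k) * n ^ k
  ^≤falling n zero = ≤-reflexive (begin
    n * 1                         ≡⟨ cong (n *_) (trans (*-identityˡ _) (subsum-0 (⊤ {n}) (λ _ → 1))) ⟨
    n * falling n 0               ≡⟨ falling-step n 0 ⟨
    falling n 1 + 0 ∎)
    where open ≡-Reasoning
  ^≤falling n (suc k) = begin
    n * n ^ suc k
      ≤⟨ *-monoʳ-≤ n (^≤falling n k) ⟩
    n * (falling n (suc k) + triangle (suc k) * n ^ k)
      ≡⟨ expand n (falling n (suc k)) (triangle (suc k)) (n ^ k) ⟩
    n * falling n (suc k) + triangle (suc k) * n ^ suc k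
      ≡⟨ cong (_+ triangle (suc k) * n ^ suc k) (falling-step n (suc k)) ⟨
    falling n (suc (suc k)) + suc k * falling n (suc k) + triangle (suc k) * n ^ suc k
      ≤⟨ +-monoˡ-≤ (triangle (suc k) * n ^ suc k) (+-monoʳ-≤ (falling n (suc (suc k))) (*-monoʳ-≤ (suc k) (falling≤^ n (suc k)))) ⟩
    falling n (suc (suc k)) + suc k * n ^ suc k + triangle (suc k) * n ^ suc k
      ≡⟨ collect (falling n (suc (suc k))) (suc k) (triangle (suc k)) (n ^ suc k) ⟩
    falling n (suc (suc k)) + triangle (suc (suc k)) * n ^ suc k ∎
    where
    open ≤-Reasoning
    expand : ∀ n f t p → n * (f + t * p) ≡ n * f + t * (n * p)
    expand = solve-∀
    collect : ∀ f k t p → f + k * p + t * p ≡ f + (k + t) * p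
    collect = solve-∀

  -- The increment over a step of length `r` is at most `r` times the slope at the right end.
  ^-+-≤ : ∀ a r k → (a + r) ^ suc k ≤ a ^ suc k + suc k * r * (a + r) ^ k
  ^-+-≤ a r zero    = ≤-reflexive (base a r)
    where
    base : ∀ a r → (a + r) * 1 ≡ a * 1 + (r + 0) * 1
    base = solve-∀
  ^-+-≤ a r (suc k) = begin
    (a + r) * p
      ≡⟨ *-distribʳ-+ p a r ⟩
    a * p + r * p
      ≤⟨ +-monoˡ-≤ (r * p) (*-monoʳ-≤ a (^-+-≤ a r k)) ⟩
    a * (a ^ suc k + suc k * r * q) + r * p
      ≡⟨ expand a (a ^ suc k) (suc k * r) q (r * p) ⟩
    a * a ^ suc k + suc k * r * (a * q) + r * p
      ≤⟨ +-monoˡ-≤ (r * p) (+-monoʳ-≤ (a * a ^ suc k) (*-monoʳ-≤ (suc k * r) (*-monoˡ-≤ q (m≤m+n a r)))) ⟩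
    a * a ^ suc k + suc k * r * p + r * p
      ≡⟨ collect (a * a ^ suc k) k r p ⟩
    a * a ^ suc k + suc (suc k) * r * p ∎
    where
    open ≤-Reasoning
    p = (a + r) ^ suc k
    q = (a + r) ^ k
    expand : ∀ a b s q t → a * (b + s * q) + t ≡ a * b + s * (a * q) + t
    expand = solve-∀
    collect : ∀ b k r p → b + suc k * r * p + r * p ≡ b + suc (suc k) * r * p
    collect = solve-∀

  -- A colour pattern with four edges may come from a tuple with repeated vertices, which is no
  -- 5-set. The number of repeated tuples is the fifth power minus 120 times the number of 5-sets;
  -- the two terms stand on opposite sides to avoid subtraction.
  construction-count : ∀ m r → 20 * 9 * m ^ 5 + 120 * subsets (m * 3 + r) 5 ≤
                               120 * e 5 4 (construction (m * 3 + r)) + (m * 3 + r) ^ 5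
  construction-count m r = begin
    20 * 9 * m ^ 5 + 120 * subsets n 5
      ≡⟨ cong₂ _+_ (*-comm (20 * 9) (m ^ 5)) (sym (trans (∑ᵗ-cong {n} 5 (λ xs → sym (*-identityʳ (distinct xs)))) (∑ᵗ-distinct n 5 (λ _ → 1)))) ⟩
    -- The sum over the 243 colour patterns evaluates to 180 = 20 · 9: the 3 constant patterns and
    -- the 60 of shape 3 + 2 do not count.
    m ^ 5 * ∑ᵗ {3} 5 (is4 ∘ colourEdges) + ∑ᵗ {n} 5 distinct
      ≤⟨ +-monoˡ-≤ (∑ᵗ {n} 5 distinct) (∑ᵗ-colour m r 5 (is4 ∘ colourEdges)) ⟩
    ∑ᵗ {n} 5 (is4 ∘ colourEdges ∘ map colour) + ∑ᵗ {n} 5 distinct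
      ≡⟨ ∑ᵗ-distrib-+ {n} 5 (is4 ∘ colourEdges ∘ map colour) distinct ⟨
    ∑ᵗ {n} 5 (λ xs → is4 (colourEdges (map colour xs)) + distinct xs)
      ≤⟨ ∑ᵗ-monoᴺ {n} 5 pointwise ⟩
    ∑ᵗ {n} 5 (λ xs → spanned xs + 1)
      ≡⟨ ∑ᵗ-distrib-+ {n} 5 spanned (λ _ → 1) ⟩
    ∑ᵗ {n} 5 spanned + ∑ᵗ {n} 5 (λ _ → 1)
      ≡⟨ cong₂ _+_ (sym (e-tuples 5 4 (construction n))) (trans (∑ᵗ-const n 5 1) (*-identityʳ (n ^ 5))) ⟩
    120 * e 5 4 (construction n) + n ^ 5 ∎
    where
    open ≤-Reasoning
    n = m * 3 + r
    spanned : List (Fin n) → ℕ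
    spanned xs = distinct xs * ⟦ does (edgesIn (construction n) (insAll xs) ≟ 4) ⟧
    is4≤1 : ∀ k → is4 k ≤ 1
    is4≤1 k with k ≡ᵇ 4
    ... | true  = ≤-refl
    ... | false = z≤n
    is4-does : ∀ k → is4 k ≡ ⟦ does (k ≟ 4) ⟧
    is4-does k with k ≡ᵇ 4
    ... | true  = refl
    ... | false = refl
    pointwise : ∀ xs → is4 (colourEdges (map colour xs)) + distinct xs ≤ spanned xs + 1
    pointwise xs with distinct-view xs
    ... | inj₁ d≡0 rewrite d≡0 | +-identityʳ (is4 (colourEdges (map colour xs))) = is4≤1 (colourEdges (map colour xs))
    ... | inj₂ (d≡1 , d) rewrite d≡1 | edgesIn-construction d =
      +-monoˡ-≤ 1 (≤-reflexive (trans (is4-does (colourEdges (map colour xs))) (sym (+-identityʳ _))))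

-- Arithmetic of the limit.

module Final where

  open Counting
  open Upper using (e₅₄-upper)
  open Lower
  open import Data.Nat using (ℕ; zero; suc; _+_; _*_; _^_; _≤_; _%_; _/_)
  open import Data.Nat.Properties
  open import Data.Nat.DivMod using (m≡m%n+[m/n]*n; m%n<n)
  open import Data.Nat.Combinatorics using (_C_)
  open import Data.Nat.Tactic.RingSolver using (solve-∀)
  open import Data.Bool using (not)
  open import Data.Product using (_×_; _,_)
  open import Function using (_∘_)
  open import Relation.Binary.PropositionalEquality
  open ≤-Reasoning

  n⁵≤120C+10n⁴ : ∀ n → n ^ 5 ≤ 120 * (n C 5) + 10 * n ^ 4
  n⁵≤120C+10n⁴ n = subst (λ c → n ^ 5 ≤ 120 * c + 10 * n ^ 4) (subsets-C n 5) (^≤falling n 4)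

  120C≤n⁵ : ∀ n → 120 * (n C 5) ≤ n ^ 5
  120C≤n⁵ n = subst (λ c → 120 * c ≤ n ^ 5) (subsets-C n 5) (falling≤^ n 5)

  -- The lower-order errors amount to at most (20 + 27) · 10 = 470 copies of J n⁴, and 490 leaves a
  -- margin. The summand 10 absorbs the gap between n⁵ and 120 times the binomial coefficient.
  threshold : ℕ → ℕ
  threshold J = 490 * J + 10

  n⁴-small : ∀ J n → threshold J ≤ n → 490 * J * n ^ 4 ≤ 120 * (n C 5)
  n⁴-small J n N≤n = +-cancelʳ-≤ (10 * n ^ 4) _ _ (begin
    490 * J * n ^ 4 + 10 * n ^ 4   ≡⟨ *-distribʳ-+ (n ^ 4) (490 * J) 10 ⟨
    threshold J * n ^ 4            ≤⟨ *-monoˡ-≤ (n ^ 4) N≤n ⟩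
    n * n ^ 4                      ≤⟨ n⁵≤120C+10n⁴ n ⟩
    120 * (n C 5) + 10 * n ^ 4     ∎)

  -- Scaling by 120 turns binomial coefficients into falling powers.
  upper-arithmetic : ∀ J E c n₄ n₅ → 27 * (120 * E) ≤ 20 * n₅ → n₅ ≤ 120 * c + 10 * n₄ → 490 * J * n₄ ≤ 120 * c →
                     27 * J * E ≤ (20 * J + 27) * c
  upper-arithmetic J E c n₄ n₅ E≤ n₅≤ n₄≤ = *-cancelˡ-≤ 120 (begin
    120 * (27 * J * E)                              ≡⟨ l₁ 120 27 J E ⟩
    J * (27 * (120 * E))                            ≤⟨ *-monoʳ-≤ J E≤ ⟩
    J * (20 * n₅)                                   ≤⟨ *-monoʳ-≤ J (*-monoʳ-≤ 20 n₅≤) ⟩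
    J * (20 * (120 * c + 10 * n₄))                  ≡⟨ l₂ 20 120 10 J c n₄ ⟩
    120 * (20 * J * c) + (20 * 10) * (J * n₄)       ≤⟨ +-monoʳ-≤ (120 * (20 * J * c)) (*-monoˡ-≤ (J * n₄) (m≤m+n 200 290)) ⟩
    120 * (20 * J * c) + 490 * (J * n₄)             ≡⟨ cong (120 * (20 * J * c) +_) (*-assoc 490 J n₄) ⟨
    120 * (20 * J * c) + 490 * J * n₄               ≤⟨ +-monoʳ-≤ (120 * (20 * J * c)) (≤-trans n₄≤ (m≤n*m (120 * c) 27)) ⟩
    120 * (20 * J * c) + 27 * (120 * c)             ≡⟨ l₃ 20 27 120 J c ⟩
    120 * ((20 * J + 27) * c)                       ∎)
    where
    l₁ : ∀ q b J E → q * (b * J * E) ≡ J * (b * (q * E))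
    l₁ = solve-∀
    l₂ : ∀ p q t J c n₄ → J * (p * (q * c + t * n₄)) ≡ q * (p * J * c) + (p * t) * (J * n₄)
    l₂ = solve-∀
    l₃ : ∀ p b q J c → q * (p * J * c) + b * (q * c) ≡ q * ((p * J + b) * c)
    l₃ = solve-∀

  -- `m₅` drops out because 20 · (27 · 9) = 27 · (20 · 9), that is 180/243 = 20/27. Adding
  -- `27 * J * n₅` to both sides lets the `n₅` of the counting inequality cancel without
  -- subtraction.
  lower-arithmetic : ∀ J E c m₅ n₄ n₅ → (20 * 9) * m₅ + 120 * c ≤ 120 * E + n₅ → n₅ ≤ (27 * 9) * m₅ + 10 * n₄ →
                     n₅ ≤ 120 * c + 10 * n₄ → 120 * c ≤ n₅ → 490 * J * n₄ ≤ 120 * c →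
                     20 * J * c ≤ 27 * J * E + 27 * c
  lower-arithmetic J E c m₅ n₄ n₅ count n₅≤m n₅≤c c≤n₅ n₄≤ = *-cancelˡ-≤ 120 (+-cancelʳ-≤ (27 * J * n₅) _ _ (begin
    120 * (20 * J * c) + 27 * J * n₅
      ≡⟨ l₁ 120 20 J c (27 * J * n₅) ⟩
    20 * J * (120 * c) + 27 * J * n₅
      ≤⟨ +-mono-≤ (*-monoʳ-≤ (20 * J) (≤-trans c≤n₅ n₅≤m)) (*-monoʳ-≤ (27 * J) n₅≤c) ⟩
    20 * J * ((27 * 9) * m₅ + 10 * n₄) + 27 * J * (120 * c + 10 * n₄)
      ≡⟨ l₂ 20 27 9 10 120 J m₅ n₄ c ⟩
    27 * J * ((20 * 9) * m₅ + 120 * c) + ((20 + 27) * 10) * (J * n₄)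
      ≤⟨ +-mono-≤ (*-monoʳ-≤ (27 * J) count) (*-monoˡ-≤ (J * n₄) (m≤m+n 470 20)) ⟩
    27 * J * (120 * E + n₅) + 490 * (J * n₄)
      ≡⟨ cong (27 * J * (120 * E + n₅) +_) (*-assoc 490 J n₄) ⟨
    27 * J * (120 * E + n₅) + 490 * J * n₄
      ≤⟨ +-monoʳ-≤ (27 * J * (120 * E + n₅)) (≤-trans n₄≤ (m≤n*m (120 * c) 27)) ⟩
    27 * J * (120 * E + n₅) + 27 * (120 * c)
      ≡⟨ l₃ 27 120 J E n₅ c ⟩
    120 * (27 * J * E + 27 * c) + 27 * J * n₅ ∎))
    where
    l₁ : ∀ q p J c x → q * (p * J * c) + x ≡ p * J * (q * c) + x
    l₁ = solve-∀
    l₂ : ∀ p b s t q J m₅ n₄ c → p * J * ((b * s) * m₅ + t * n₄) + b * J * (q * c + t * n₄)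
                                 ≡ b * J * ((p * s) * m₅ + q * c) + ((p + b) * t) * (J * n₄)
    l₂ = solve-∀
    l₃ : ∀ b q J E n₅ c → b * J * (q * E + n₅) + b * (q * c) ≡ q * (b * J * E + b * c) + b * J * n₅
    l₃ = solve-∀

  *-distrib-^ : ∀ a b k → (a * b) ^ k ≡ a ^ k * b ^ k
  *-distrib-^ a b zero    = refl
  *-distrib-^ a b (suc k) = trans (cong (a * b *_) (*-distrib-^ a b k)) (exchange a b (a ^ k) (b ^ k))
    where
    exchange : ∀ a b p q → a * b * (p * q) ≡ a * p * (b * q)
    exchange = solve-∀

  -- At most two vertices exceed a multiple of three, whence the coefficient 5 · 2 = 10; and 27 · 9
  -- is the fifth power of 3.
  power-bound : ∀ m r → r ≤ 2 → (m * 3 + r) ^ 5 ≤ (27 * 9) * m ^ 5 + 10 * (m * 3 + r) ^ 4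
  power-bound m r r≤2 = begin
    (m * 3 + r) ^ 5                               ≤⟨ ^-+-≤ (m * 3) r 4 ⟩
    (m * 3) ^ 5 + 5 * r * (m * 3 + r) ^ 4         ≤⟨ +-monoʳ-≤ ((m * 3) ^ 5) (*-monoˡ-≤ ((m * 3 + r) ^ 4) 5r≤10) ⟩
    (m * 3) ^ 5 + 10 * (m * 3 + r) ^ 4            ≡⟨ cong (_+ 10 * (m * 3 + r) ^ 4) cube ⟩
    (27 * 9) * m ^ 5 + 10 * (m * 3 + r) ^ 4       ∎
    where
    5r≤10 : 5 * r ≤ 10
    5r≤10 = *-monoʳ-≤ 5 r≤2
    cube : (m * 3) ^ 5 ≡ (27 * 9) * m ^ 5
    cube = trans (*-distrib-^ m 3 5) (*-comm (m ^ 5) (27 * 9))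

  construction-count′ : ∀ m r → (20 * 9) * m ^ 5 + 120 * ((m * 3 + r) C 5) ≤
                                120 * e 5 4 (construction (m * 3 + r)) + (m * 3 + r) ^ 5
  construction-count′ m r =
    ≤-trans (≤-reflexive (cong (λ c → (20 * 9) * m ^ 5 + 120 * c) (sym (subsets-C (m * 3 + r) 5)))) (construction-count m r)

  lower-bound : ∀ J n → threshold J ≤ n → 20 * J * (n C 5) ≤ 27 * J * e 5 4 (construction n) + 27 * (n C 5)
  lower-bound J n N≤n = subst Goal (sym n≡) (λ N≤k → prove (n / 3) (n % 3) (≤-pred (m%n<n n 3)) N≤k) N≤n
    where
    Goal : ℕ → Set
    Goal k = threshold J ≤ k → 20 * J * (k C 5) ≤ 27 * J * e 5 4 (construction k) + 27 * (k C 5)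
    n≡ : n ≡ n / 3 * 3 + n % 3
    n≡ = trans (m≡m%n+[m/n]*n n 3) (+-comm (n % 3) (n / 3 * 3))
    prove : ∀ m r → r ≤ 2 → Goal (m * 3 + r)
    prove m r r≤2 N≤k = lower-arithmetic J (e 5 4 (construction k)) (k C 5) (m ^ 5) (k ^ 4) (k ^ 5)
      (construction-count′ m r) (power-bound m r r≤2) (n⁵≤120C+10n⁴ k) (120C≤n⁵ k) (n⁴-small J k N≤k)
      where k = m * 3 + r

-- The two densities.

open import Data.Nat using (ℕ; suc; _+_; _*_; _^_; _≤_)
open import Data.Nat.Combinatorics using (_C_)
open import Data.Bool using (not)
open import Data.Product using (_,_)
open import Function using (_∘_)
open import Relation.Binary.PropositionalEquality using (refl; sym; subst)
open Upper using (e₅₄-upper)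
open Lower using (construction; e-complement)
open Final

theorem2p29 : TuranDensityIs 5 4 20 27 × TuranDensityIs 5 6 20 27
theorem2p29 = four , six
  where
  upper : ∀ j n → threshold (suc j) ≤ n → (G : Graph3 n) → 27 * suc j * e 5 4 G ≤ (20 * suc j + 27) * (n C 5)
  upper j n N≤n G = upper-arithmetic (suc j) (e 5 4 G) (n C 5) (n ^ 4) (n ^ 5)
    (e₅₄-upper G) (n⁵≤120C+10n⁴ n) (n⁴-small (suc j) n N≤n)
  four : TuranDensityIs 5 4 20 27
  four j = threshold (suc j) , λ n N≤n → upper j n N≤n , construction n , lower-bound (suc j) n N≤n
  six : TuranDensityIs 5 6 20 27
  six j = threshold (suc j) , λ n N≤n →
    (λ G → subst (λ k → 27 * suc j * k ≤ (20 * suc j + 27) * (n C 5)) (sym (e-complement 6 4 refl G)) (upper j n N≤n (not ∘ G)))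
    , not ∘ construction n
    , subst (λ k → 20 * suc j * (n C 5) ≤ 27 * suc j * k + 27 * (n C 5)) (e-complement 4 6 refl (construction n)) (lower-bound (suc j) n N≤n)
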